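{- Let $n\geq1$, $r=2^n$ and $M=34^{2^n}+1$. Let $\pi=1+\zeta_{17}^2+\zeta_{17}^9\in\mathbb{Z}[\zeta_{34}]$ and $\alpha=(\pi/\bar\pi)^{\tau}$, where $\tau=1+3\sigma_{ -11}+5\sigma_7+7\sigma_5+9\sigma_{ -15}+11\sigma_{ -3}+13\sigma_{ -13}+15\sigma_{ -9}$. For $k\ge0$ and $1\leq j\leq8$ define $S_k^{(j)}=f^{(j)}(\alpha_1^{(k)},\ldots,\alpha_8^{(k)})$, where $f^{(j)}$ is the $j$-th elementary symmetric polynomial in $8$ variables, $\alpha_1^{(k)}=\alpha^{34^k}+\bar\alpha^{34^k}$, and $\alpha_i^{(k)}=\sigma_{2i-1}(\alpha_1^{(k)})$ for $2\leq i\leq8$. Suppose that every integer $x$ with $1<x<17^r$ and $x^{16}\equiv1\pmod{17^r}$ does not divide $M$. Then $M$ is prime if and only if one of the following holds: (i) $M$ is congruent modulo $103$ to one of $-21,\ 15$, and $S_{r-1}^{(1)}\equiv-1$, $S_{r-1}^{(2)}\equiv-7$, $S_{r-1}^{(3)}\equiv6$, $S_{r-1}^{(4)}\equiv15$, $S_{r-1}^{(5)}\equiv-10$, $S_{r-1}^{(6)}\equiv-10$, $S_{r-1}^{(7)}\equiv4$, $S_{r-1}^{(8)}\equiv1\pmod M$; (ii) $M$ is congruent modulo $103$ to one of $35,\ 24,\ -2,\ -9,\ 10,\ -30$, and $S_{r-1}^{(1)}\equiv1$, $S_{r-1}^{(2)}\equiv-7$, $S_{r-1}^{(3)}\equiv-6$,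 $S_{r-1}^{(4)}\equiv15$, $S_{r-1}^{(5)}\equiv10$, $S_{r-1}^{(6)}\equiv-10$, $S_{r-1}^{(7)}\equiv-4$, $S_{r-1}^{(8)}\equiv1\pmod M$.
   Context: $\zeta_m=e^{2\pi\sqrt{ -1}/m}$ and a bar denotes complex conjugation. For $c$ coprime to $34$, $\sigma_c\in G=\mathrm{Gal}(\mathbb{Q}(\zeta_{34})/\mathbb{Q})$ sends $\zeta_{34}$ to $\zeta_{34}^c$; $1$ denotes $\sigma_1$ in $\mathbb{Z}[G]$. For $\tau=\sum_{\sigma\in G}k_\sigma\sigma\in\mathbb{Z}[G]$ and $\beta\neq0$, $\beta^\tau:=\prod_{\sigma}\sigma(\beta)^{k_\sigma}$. The $S_k^{(j)}$ are rational numbers with denominators prime to $M$; congruences modulo $M$ are understood in the ring of rationals with denominator prime to $M$. -}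

module Defs where

open import Algebra.Bundles.Raw using (RawRing)
import Algebra.Definitions.RawSemiring as RawSemiringDefinitions
open import Data.Integer.Base as ℤ using (ℤ; +_; -[1+_]; -_; _%ℕ_)
import Data.Integer.Divisibility as ℤ
open import Data.List.Base as List using (List; []; _∷_)
open import Data.Nat.Base as ℕ using (ℕ; zero; suc)
open import Data.Nat.Coprimality using (Coprime)
open import Data.Product.Base using (∃-syntax; _×_; _,_)
open import Data.Rational.Base as ℚ using (ℚ; 0ℚ; 1ℚ)
import Data.Rational.Properties as ℚ
open import Data.Vec.Base as Vec using (Vec; []; _∷_)
open import Level using (0ℓ)
open import Relation.Binary.PropositionalEquality using (_≡_)
open import Relation.Nullary using (yes; no)

-- The field ℚ(ζ₃₄) = ℚ[x]/(Φ₃₄), with Φ₃₄ = x¹⁶ - x¹⁵ + x¹⁴ - ⋯ - x + 1.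
-- The vector (a₀ , … , a₁₅) stands for a₀ + a₁ζ₃₄ + ⋯ + a₁₅ζ₃₄¹⁵, so that
-- equality in the field is propositional equality of vectors.

ℚζ₃₄ : Set
ℚζ₃₄ = Vec ℚ 16

infixl 7 _·_ _*_ _÷_
infixl 6 _+_ _-_
infix  8 _⁻¹
infixr 8 _^ℤ_ _^^_

ι : ℚ → ℚζ₃₄
ι q = q ∷ Vec.replicate 15 0ℚ

_+_ : ℚζ₃₄ → ℚζ₃₄ → ℚζ₃₄
_+_ = Vec.zipWith ℚ._+_

neg : ℚζ₃₄ → ℚζ₃₄
neg = Vec.map (λ q → ℚ.- q)

_-_ : ℚζ₃₄ → ℚζ₃₄ → ℚζ₃₄
x - y = x + neg y

_·_ : ℚ → ℚζ₃₄ → ℚζ₃₄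
q · x = Vec.map (q ℚ.*_) x

alternating : ∀ n → ℚ → Vec ℚ n
alternating zero    q = []
alternating (suc n) q = q ∷ alternating n (ℚ.- q)

-- ζ₃₄¹⁶ = -1 + ζ₃₄ - ζ₃₄² + ⋯ + ζ₃₄¹⁵, by Φ₃₄(ζ₃₄) = 0.
ζ₃₄¹⁶ : ℚζ₃₄
ζ₃₄¹⁶ = alternating 16 (ℚ.- 1ℚ)

ζ₃₄*_ : ℚζ₃₄ → ℚζ₃₄
ζ₃₄* x = (0ℚ ∷ Vec.init x) + Vec.last x · ζ₃₄¹⁶

-- Horner's rule: (a₀ + a₁ζ₃₄ + ⋯) y = a₀y + ζ₃₄(a₁y + ζ₃₄(⋯)).
_*_ : ℚζ₃₄ → ℚζ₃₄ → ℚζ₃₄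
x * y = Vec.foldr′ (λ a acc → a · y + (ζ₃₄* acc)) (ι 0ℚ) x

ℚζ₃₄-rawRing : RawRing 0ℓ 0ℓ
ℚζ₃₄-rawRing = record
  { Carrier = ℚζ₃₄
  ; _≈_     = _≡_
  ; _+_     = _+_
  ; _*_     = _*_
  ; -_      = neg
  ; 0#      = ι 0ℚ
  ; 1#      = ι 1ℚ
  }

open RawRing ℚζ₃₄-rawRing public using (0#; 1#)
open RawSemiringDefinitions (RawRing.rawSemiring ℚζ₃₄-rawRing) public using (_^_)

sum product : List ℚζ₃₄ → ℚζ₃₄
sum     = List.foldr _+_ 0#
product = List.foldr _*_ 1#

ζ₃₄ ζ₁₇ : ℚζ₃₄
ζ₃₄ = ζ₃₄* 1#
ζ₁₇ = ζ₃₄ ^ 2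

-- a₀ + a₁ζ₃₄ + ⋯ ↦ a₀ + a₁w + ⋯
substitute : ℚζ₃₄ → ℚζ₃₄ → ℚζ₃₄
substitute w x = Vec.foldr′ (λ a acc → ι a + w * acc) 0# x

-- σ c is the automorphism ζ₃₄ ↦ ζ₃₄ᶜ when c is coprime to 34; it has no
-- meaning for other c, where it is never used.
σ : ℤ → ℚζ₃₄ → ℚζ₃₄
σ c x = substitute (ζ₃₄ ^ (c %ℕ 34)) x

-- Complex conjugation sends ζ₃₄ = exp(2πi/34) to its inverse.
conj : ℚζ₃₄ → ℚζ₃₄
conj = σ (- + 1)

-- Representatives of the elements σ c ≠ 1 of the Galois group.
nontrivial : List ℤ
nontrivial = List.map +_
  (3 ∷ 5 ∷ 7 ∷ 9 ∷ 11 ∷ 13 ∷ 15 ∷ 19 ∷ 21 ∷ 23 ∷ 25 ∷ 27 ∷ 29 ∷ 31 ∷ 33 ∷ [])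

cofactor : ℚζ₃₄ → ℚζ₃₄
cofactor x = product (List.map (λ c → σ c x) nontrivial)

-- The norm x * cofactor x is rational, i.e. equal to ι of its constant
-- coefficient.
norm : ℚζ₃₄ → ℚ
norm x = Vec.head (x * cofactor x)

-- Totalised by 0⁻¹ = 0.
recip : ℚ → ℚ
recip q with q ℚ.≟ 0ℚ
... | yes _  = 0ℚ
... | no q≢0 = (ℚ.1/ q) {{ℚ.≢-nonZero q≢0}}

_⁻¹ : ℚζ₃₄ → ℚζ₃₄
x ⁻¹ = recip (norm x) · cofactor x

_÷_ : ℚζ₃₄ → ℚζ₃₄ → ℚζ₃₄
x ÷ y = x * y ⁻¹

_^ℤ_ : ℚζ₃₄ → ℤ → ℚζ₃₄
x ^ℤ (+ k)    = x ^ k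
x ^ℤ -[1+ k ] = (x ⁻¹) ^ suc k

-- Elements of ℤ[G] as formal sums: the pair (k , c) stands for k σ_c.
ℤ[G] : Set
ℤ[G] = List (ℤ × ℤ)

_^^_ : ℚζ₃₄ → ℤ[G] → ℚζ₃₄
x ^^ τ = product (List.map (λ (k , c) → σ c x ^ℤ k) τ)

-- Entries are chosen by position, so equal entries count separately.
choose : ∀ {A : Set} → ℕ → List A → List (List A)
choose zero    xs       = [] ∷ []
choose (suc j) []       = []
choose (suc j) (x ∷ xs) = List.map (x ∷_) (choose j xs) List.++ choose (suc j) xs

esym : ℕ → List ℚζ₃₄ → ℚζ₃₄
esym j xs = sum (List.map product (choose j xs))

infix 4 _≡_[mod_] _≡_[mod′_]

_≡_[mod_] : ℤ → ℤ → ℕ → Set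
a ≡ b [mod m ] = + m ℤ.∣ (a ℤ.- b)

-- x ≡ a modulo m in the ring of rationals with denominator prime to m,
-- viewed inside ℚ(ζ₃₄): x - a = m t for some t in that ring. In particular
-- x itself then belongs to that ring.
_≡_[mod′_] : ℚζ₃₄ → ℤ → ℕ → Set
x ≡ a [mod′ m ] =
  ∃[ t ] Coprime (ℚ.denominatorℕ t) m
       × x - ι (a ℚ./ 1) ≡ ι ((+ m ℚ./ 1) ℚ.* t)

r M : ℕ → ℕ
r n = 2 ℕ.^ n
M n = 34 ℕ.^ (2 ℕ.^ n) ℕ.+ 1

π : ℚζ₃₄
π = 1# + ζ₁₇ ^ 2 + ζ₁₇ ^ 9

τ : ℤ[G]
τ = (+ 1  , + 1)
  ∷ (+ 3  , - + 11)
  ∷ (+ 5  , + 7)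
  ∷ (+ 7  , + 5)
  ∷ (+ 9  , - + 15)
  ∷ (+ 11 , - + 3)
  ∷ (+ 13 , - + 13)
  ∷ (+ 15 , - + 9)
  ∷ []

α : ℚζ₃₄
α = (π ÷ conj π) ^^ τ

α₁ : ℕ → ℚζ₃₄
α₁ k = α ^ (34 ℕ.^ k) + conj α ^ (34 ℕ.^ k)

-- The entries after the first are σ_{2i-1}(α₁) for i = 2, …, 8.
αs : ℕ → List ℚζ₃₄
αs k = α₁ k ∷ List.map (λ i → σ (+ (2 ℕ.* i ℕ.∸ 1)) (α₁ k))
                       (2 ∷ 3 ∷ 4 ∷ 5 ∷ 6 ∷ 7 ∷ 8 ∷ [])

S : (k j : ℕ) → ℚζ₃₄
S k j = esym j (αs k)

{-# OPTIONS --safe #-}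
module Submission where

-- Let G be the Gauss sum modulo 103 of the character of order 34 sending the
-- primitive root 86 to ζ, and let B be the product of σ_c(π) over
-- c = 9, 13, 15, 3, 11, 27, 29, 33.  Then B B̄ = 103 and α B³⁴ = ζ²¹ G³⁴, where
-- G³⁴ lies in ℤ[ζ] and is a product of Jacobi sums.
--
-- If M is prime and M ≡ 86ᵐ modulo 103, then Frobenius gives G^(M-1) ≡ ζ⁻ᵐ and,
-- as M ≡ 1 modulo 34, B^(M-1) ≡ 1.  Since M - 1 = 34 · 34ʳ⁻¹, this yields
-- α^(34ʳ⁻¹) ≡ ζ⁻ᵐ modulo M, and the S_j are congruent to the elementary symmetric
-- functions of the conjugates of ζᵐ + ζ⁻ᵐ.
--
-- Conversely, let q be a prime divisor of M.  Modulo q the conditions on the S_j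
-- make y = α^(34ʳ⁻¹) satisfy Φ₁₇(y²) = 0, so 17ʳ divides the order of α, which
-- divides q¹⁶ - 1 because q¹⁶ ≡ 1 modulo 34.  A composite M = 34ʳ + 1 < 17²ʳ would
-- have such a divisor q < 17ʳ, which the hypothesis excludes.
--
-- Congruences are treated in the ring of elements of ℚ(ζ) with denominator prime
-- to p, modulo p; G lives in an extension of it by a 103rd root of unity.

open import Algebra.Bundles using (CommutativeRing; AbelianGroup)
open import Algebra.Morphism.Structures using (IsRingHomomorphism)
import Algebra.Properties.AbelianGroup as AbelianGroupProperties
import Algebra.Properties.CommutativeMonoid.Mult as CommutativeMult
import Algebra.Properties.CommutativeSemigroup as CommutativeSemigroupProperties
import Algebra.Properties.CommutativeSemiring.Binomial as Binomial
import Algebra.Properties.CommutativeSemiring.Exp as CommutativeExp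
import Algebra.Properties.Monoid.Mult as MonoidMult
import Algebra.Properties.Monoid.Mult.TCOptimised as OptimisedMonoidMult
import Algebra.Properties.Ring as RingProperties
import Algebra.Properties.Semiring.Exp as Exp
import Algebra.Properties.Semiring.Mult as Mult
import Algebra.Properties.Semiring.Mult.TCOptimised as OptimisedMult
import Algebra.Properties.Semiring.Sum as SemiringSum
import Algebra.Solver.Ring.NaturalCoefficients.Default as NaturalCoefficients
open import Algebra.Structures using (IsCommutativeRing)
open import Data.Bool.Base using (T)
open import Data.Empty using (⊥-elim)
open import Data.Fin.Base as Fin using (toℕ)
import Data.Fin.Properties as Finₚ
open import Data.Integer.Base as ℤ using (ℤ; +_; -[1+_])
import Data.Integer.DivMod as ℤDivMod
open import Data.Integer.Divisibility using () renaming (_∣_ to _∣ᶻ_)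
import Data.Integer.Properties as ℤₚ
open import Data.Integer.Solver using () renaming (module +-*-Solver to ℤ-Solver)
open import Data.List.Base as List using (List; []; _∷_)
import Data.List.Properties as Listₚ
open import Data.List.Relation.Binary.Permutation.Propositional as Perm using (_↭_)
import Data.List.Relation.Binary.Permutation.Propositional.Properties as Permₚ
open import Data.List.Relation.Binary.Pointwise using ([]; _∷_) renaming (Pointwise to Pointwiseᴸ)
open import Data.List.Relation.Unary.All as All using (All; []; _∷_)
open import Data.List.Relation.Unary.Any as Any using (Any; here; there; any?)
open import Data.Nat.Base as ℕ using (ℕ; zero; suc; _≤_; _<_; z≤n; s≤s; _!; NonZero)
open import Data.Nat.Combinatorics as Combinatorics using (nCk≡n!/k![n-k]!; k![n∸k]!∣n!; nCn≡1)
open import Data.Nat.Coprimality as Coprimality using (Coprime)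
open import Data.Nat.DivMod using (_%_; _/_; m/n*n≡m; m≡m%n+[m/n]*n; %-distribˡ-+; %-distribˡ-*; m%n%n≡m%n; m%n<n; [m+kn]%n≡m%n)
open import Data.Nat.Divisibility as ∣ using (_∣_; divides; _∣?_; >⇒∤; m∣m*n)
open import Data.Nat.GCD using (gcd; gcd[m,n]∣m; gcd[m,n]∣n; gcd-GCD; module Bézout)
import Data.Nat.ListAction as ListAction
open import Data.Nat.Primality using (Prime; prime?; euclidsLemma; prime⇒irreducible; ¬prime⇒composite; ¬prime[0]; ¬prime[1]; prime⇒nonTrivial; prime⇒nonZero; Composite; composite)
open import Data.Nat.Primality.Factorisation using (factorise)
import Data.Nat.Properties as ℕₚ
open import Data.Nat.Solver using (module +-*-Solver)
open import Data.List.Sort.Base ℕₚ.≤-totalOrder using (module SortingAlgorithm)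
open import Data.List.Sort.InsertionSort ℕₚ.≤-decTotalOrder using (insertionSort)
open import Data.Product.Base using (_×_; _,_; proj₁; proj₂; ∃-syntax; Σ-syntax)
open import Data.Rational.Base as ℚ using (ℚ; 0ℚ; 1ℚ)
import Data.Rational.Properties as ℚₚ
import Data.Rational.Unnormalised.Base as ℚᵘ
import Data.Rational.Unnormalised.Properties as ℚᵘₚ
open import Data.Sum.Base using (_⊎_; inj₁; inj₂)
open import Data.Vec.Base as Vec using (Vec; []; _∷_)
import Data.Vec.Properties as Vecₚ
open import Data.Vec.Relation.Binary.Pointwise.Inductive as Pointwise using (Pointwise; []; _∷_; Pointwise-≡⇒≡; ≡⇒Pointwise-≡)
open import Function.Base using (_∘_; case_of_)
open import Function.Bundles using (_⇔_; mk⇔)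
import Level
open import Relation.Binary.Definitions using (DecidableEquality)
open import Relation.Binary.PropositionalEquality as ≡ using (_≡_; _≢_; cong; cong₂; subst)
import Relation.Binary.Reasoning.Setoid as SetoidReasoning
open import Relation.Nullary using (¬_; Dec; yes; no)
open import Relation.Nullary.Decidable as Dec using (from-yes)

-- The inverses modulo 34 of 1, 3, 5, ..., 15 are 1, -11, 7, 5, -15, -3, -13, -9, so `τ` is the sum
-- of c σ_c⁻¹ over odd c < 17: the half of the Stickelberger element that remains after complex
-- conjugation is divided out. The indices of B are the negatives of these inverses. In the full
-- element σ₋c⁻¹ has coefficient 34 - c, so α B³⁴ is π raised to the sum of c σ_c⁻¹ over all c in
-- [1, 33] prime to 34. Stickelberger's theorem predicts that this is G³⁴ up to a unit; absolute
-- values leave only a root of unity, here ζ²¹. The resulting identity is verified in ℤ[ζ]. Raising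
-- to the power 34ʳ⁻¹ removes ζ²¹ because r ≥ 2 makes 34 divide the exponent. The residue rings
-- modulo p may have zero divisors, so cancellation always rests on an explicit inverse. These come
-- from complex conjugation: α ᾱ = 1 and B B̄ = 103, with 103 prime to p; G³⁴ is then invertible as
-- well. For the same reason the converse works with an order and with Φ₁₇(1) = 17 instead of
-- counting roots.

-- Ring homomorphisms and quotients of polynomial rings.

module Homomorphism {a b ℓ ℓ′} (R : CommutativeRing a ℓ) (S : CommutativeRing b ℓ′) where
  private
    module R = CommutativeRing R
    module S = CommutativeRing S

  Hom : (R.Carrier → S.Carrier) → Set _
  Hom = IsRingHomomorphism R.rawRing S.rawRing

  module _ (h : R.Carrier → S.Carrier)
    (h-cong : ∀ {x y} → x R.≈ y → h x S.≈ h y)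
    (h-+ : ∀ x y → h (x R.+ y) S.≈ h x S.+ h y)
    (h-* : ∀ x y → h (x R.* y) S.≈ h x S.* h y)
    (h-1 : h R.1# S.≈ S.1#) where

    private
      h-0 : h R.0# S.≈ S.0#
      h-0 = S.sym (RingProperties.+-cancelˡ S.ring (h R.0#) _ _
        (S.trans (S.+-identityʳ _)
          (S.trans (S.sym (h-cong (R.+-identityʳ R.0#))) (h-+ _ _))))

      h-neg : ∀ x → h (R.- x) S.≈ S.- h x
      h-neg x = S.sym (RingProperties.+-cancelˡ S.ring (h x) _ _
        (S.trans (S.-‿inverseʳ _)
          (S.sym (S.trans (S.sym (h-+ _ _)) (S.trans (h-cong (R.-‿inverseʳ x)) h-0)))))

    -- Zero and negatives are respected by cancellation in the additive group, so only addition,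
    -- multiplication and the unit are asked for.
    mkHom : Hom h
    mkHom = record
      { isSemiringHomomorphism = record
        { isNearSemiringHomomorphism = record
          { +-isMonoidHomomorphism = record
            { isMagmaHomomorphism = record
              { isRelHomomorphism = record { cong = h-cong }
              ; homo = h-+ }
            ; ε-homo = h-0 }
          ; *-homo = h-* }
        ; 1#-homo = h-1 }
      ; -‿homo = h-neg }

open Homomorphism using (Hom; mkHom)

-- R[x]/(xᵏ⁺¹ - c), where the vector c lists the coefficients of a polynomial
-- of degree at most k.
module Adjoin {a ℓ} (R : CommutativeRing a ℓ) (k : ℕ)
              (c : Vec (CommutativeRing.Carrier R) (suc k)) where
  open CommutativeRing R
  open RingProperties ring using (-‿distribʳ-*)

  infix 4 _∼_
  infixl 6 _⊕_
  infixr 7 _⊙_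
  infixl 7 _⊛_

  _∼_ : ∀ {n} → Vec Carrier n → Vec Carrier n → Set _
  _∼_ = Pointwise _≈_

  _⊕_ : ∀ {n} → Vec Carrier n → Vec Carrier n → Vec Carrier n
  _⊕_ = Vec.zipWith _+_

  ⊝_ : ∀ {n} → Vec Carrier n → Vec Carrier n
  ⊝_ = Vec.map (λ a → - a)

  𝟎 : ∀ {n} → Vec Carrier n
  𝟎 = Vec.replicate _ 0#

  _⊙_ : ∀ {n} → Carrier → Vec Carrier n → Vec Carrier n
  a ⊙ x = Vec.map (a *_) x

  ∼-refl : ∀ {n} {x : Vec Carrier n} → x ∼ x
  ∼-refl = Pointwise.refl refl

  ⊕-cong : ∀ {n} {x x′ y y′ : Vec Carrier n} → x ∼ x′ → y ∼ y′ → x ⊕ y ∼ x′ ⊕ y′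
  ⊕-cong [] [] = []
  ⊕-cong (p ∷ ps) (q ∷ qs) = +-cong p q ∷ ⊕-cong ps qs

  ⊙-cong : ∀ {n a b} {x y : Vec Carrier n} → a ≈ b → x ∼ y → a ⊙ x ∼ b ⊙ y
  ⊙-cong p [] = []
  ⊙-cong p (q ∷ qs) = *-cong p q ∷ ⊙-cong p qs

  ⊕-abelianGroup : ℕ → AbelianGroup _ _
  ⊕-abelianGroup n = record
    { Carrier = Vec Carrier n
    ; _≈_ = _∼_
    ; _∙_ = _⊕_
    ; ε = 𝟎
    ; _⁻¹ = ⊝_
    ; isAbelianGroup = record
      { isGroup = record
        { isMonoid = record
          { isSemigroup = record
            { isMagma = record
              { isEquivalence = Pointwise.isEquivalence isEquivalence n
              ; ∙-cong = ⊕-cong }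
            ; assoc = assocV }
          ; identity = identityˡV , λ x → Pointwise.trans trans (commV x 𝟎) (identityˡV x) }
        ; inverse = inverseˡV , λ x → Pointwise.trans trans (commV x (⊝ x)) (inverseˡV x)
        ; ⁻¹-cong = negCongV }
      ; comm = commV }
    }
    where
    assocV : ∀ {n} (x y z : Vec Carrier n) → (x ⊕ y) ⊕ z ∼ x ⊕ (y ⊕ z)
    assocV [] [] [] = []
    assocV (a ∷ x) (b ∷ y) (c ∷ z) = +-assoc a b c ∷ assocV x y z
    commV : ∀ {n} (x y : Vec Carrier n) → x ⊕ y ∼ y ⊕ x
    commV [] [] = []
    commV (a ∷ x) (b ∷ y) = +-comm a b ∷ commV x y
    identityˡV : ∀ {n} (x : Vec Carrier n) → 𝟎 ⊕ x ∼ x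
    identityˡV [] = []
    identityˡV (a ∷ x) = +-identityˡ a ∷ identityˡV x
    inverseˡV : ∀ {n} (x : Vec Carrier n) → (⊝ x) ⊕ x ∼ 𝟎
    inverseˡV [] = []
    inverseˡV (a ∷ x) = -‿inverseˡ a ∷ inverseˡV x
    negCongV : ∀ {n} {x y : Vec Carrier n} → x ∼ y → ⊝ x ∼ ⊝ y
    negCongV [] = []
    negCongV (p ∷ ps) = -‿cong p ∷ negCongV ps

  ⊙-distribˡ : ∀ {n} a (x y : Vec Carrier n) → a ⊙ (x ⊕ y) ∼ a ⊙ x ⊕ a ⊙ y
  ⊙-distribˡ a [] [] = []
  ⊙-distribˡ a (b ∷ x) (c ∷ y) = distribˡ a b c ∷ ⊙-distribˡ a x y

  ⊙-distribʳ : ∀ {n} a b (x : Vec Carrier n) → (a + b) ⊙ x ∼ a ⊙ x ⊕ b ⊙ x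
  ⊙-distribʳ a b [] = []
  ⊙-distribʳ a b (c ∷ x) = distribʳ c a b ∷ ⊙-distribʳ a b x

  ⊙-assoc : ∀ {n} a b (x : Vec Carrier n) → (a * b) ⊙ x ∼ a ⊙ (b ⊙ x)
  ⊙-assoc a b [] = []
  ⊙-assoc a b (c ∷ x) = *-assoc a b c ∷ ⊙-assoc a b x

  ⊙-comm : ∀ {n} a b (x : Vec Carrier n) → a ⊙ (b ⊙ x) ∼ b ⊙ (a ⊙ x)
  ⊙-comm a b [] = []
  ⊙-comm a b (c ∷ x) =
    trans (sym (*-assoc a b c)) (trans (*-congʳ (*-comm a b)) (*-assoc b a c)) ∷ ⊙-comm a b x

  ⊙-zeroˡ : ∀ {n} (x : Vec Carrier n) → 0# ⊙ x ∼ 𝟎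
  ⊙-zeroˡ [] = []
  ⊙-zeroˡ (a ∷ x) = zeroˡ a ∷ ⊙-zeroˡ x

  ⊙-zeroʳ : ∀ {n} a → a ⊙ 𝟎 {n} ∼ 𝟎
  ⊙-zeroʳ {zero} a = []
  ⊙-zeroʳ {suc n} a = zeroʳ a ∷ ⊙-zeroʳ a

  init-cong : ∀ {n} {x y : Vec Carrier (suc n)} → x ∼ y → Vec.init x ∼ Vec.init y
  init-cong {zero} (p ∷ []) = []
  init-cong {suc n} (p ∷ ps) = p ∷ init-cong ps

  last-cong : ∀ {n} {x y : Vec Carrier (suc n)} → x ∼ y → Vec.last x ≈ Vec.last y
  last-cong {zero} (p ∷ []) = p
  last-cong {suc n} (p ∷ ps) = last-cong ps

  init-⊕ : ∀ {n} (x y : Vec Carrier (suc n)) → Vec.init (x ⊕ y) ∼ Vec.init x ⊕ Vec.init y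
  init-⊕ (a ∷ []) (b ∷ []) = []
  init-⊕ (a ∷ x@(_ ∷ _)) (b ∷ y@(_ ∷ _)) = refl ∷ init-⊕ x y

  last-⊕ : ∀ {n} (x y : Vec Carrier (suc n)) → Vec.last (x ⊕ y) ≈ Vec.last x + Vec.last y
  last-⊕ (a ∷ []) (b ∷ []) = refl
  last-⊕ (a ∷ x@(_ ∷ _)) (b ∷ y@(_ ∷ _)) = last-⊕ x y

  init-⊙ : ∀ {n} a (x : Vec Carrier (suc n)) → Vec.init (a ⊙ x) ∼ a ⊙ Vec.init x
  init-⊙ a (b ∷ []) = []
  init-⊙ a (b ∷ x@(_ ∷ _)) = refl ∷ init-⊙ a x

  last-⊙ : ∀ {n} a (x : Vec Carrier (suc n)) → Vec.last (a ⊙ x) ≈ a * Vec.last x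
  last-⊙ a (b ∷ []) = refl
  last-⊙ a (b ∷ x@(_ ∷ _)) = last-⊙ a x

  V : Set _
  V = Vec Carrier (suc k)

  private module V = AbelianGroup (⊕-abelianGroup (suc k))
  open CommutativeSemigroupProperties V.commutativeSemigroup using (interchange)
  open SetoidReasoning V.setoid

  shift : V → V
  shift x = (0# ∷ Vec.init x) ⊕ (Vec.last x ⊙ c)

  shift-cong : ∀ {x y} → x ∼ y → shift x ∼ shift y
  shift-cong p = ⊕-cong (refl ∷ init-cong p) (⊙-cong (last-cong p) ∼-refl)

  shift-⊕ : ∀ x y → shift (x ⊕ y) ∼ shift x ⊕ shift y
  shift-⊕ x y = begin
    shift (x ⊕ y)
      ≈⟨ ⊕-cong (sym (+-identityˡ 0#) ∷ init-⊕ x y)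
                (V.trans (⊙-cong (last-⊕ x y) ∼-refl) (⊙-distribʳ _ _ c)) ⟩
    ((0# ∷ Vec.init x) ⊕ (0# ∷ Vec.init y)) ⊕ ((Vec.last x ⊙ c) ⊕ (Vec.last y ⊙ c))
      ≈⟨ interchange (0# ∷ Vec.init x) _ _ _ ⟩
    shift x ⊕ shift y ∎

  shift-⊙ : ∀ a x → shift (a ⊙ x) ∼ a ⊙ shift x
  shift-⊙ a x = begin
    shift (a ⊙ x)
      ≈⟨ ⊕-cong (sym (zeroʳ a) ∷ init-⊙ a x)
                (V.trans (⊙-cong (last-⊙ a x) ∼-refl) (⊙-assoc a _ c)) ⟩
    (a ⊙ (0# ∷ Vec.init x)) ⊕ (a ⊙ (Vec.last x ⊙ c))
      ≈⟨ ⊙-distribˡ a (0# ∷ Vec.init x) _ ⟨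
    a ⊙ shift x ∎

  shift-𝟎 : shift 𝟎 ∼ 𝟎
  shift-𝟎 = begin
    shift 𝟎          ≈⟨ shift-cong (⊙-zeroˡ 𝟎) ⟨
    shift (0# ⊙ 𝟎)   ≈⟨ shift-⊙ 0# 𝟎 ⟩
    0# ⊙ shift 𝟎     ≈⟨ ⊙-zeroˡ _ ⟩
    𝟎                ∎

  -- Horner's rule: `x` is read as a polynomial in the operator `shift` and applied to `y`. The
  -- length of `x` is kept independent of k so that induction on `x` is possible.
  act : ∀ {n} → Vec Carrier n → V → V
  act x y = Vec.foldr′ (λ a acc → (a ⊙ y) ⊕ shift acc) 𝟎 x

  act-cong : ∀ {n} {x x′ : Vec Carrier n} {y y′} → x ∼ x′ → y ∼ y′ → act x y ∼ act x′ y′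
  act-cong [] q = V.refl
  act-cong (p ∷ ps) q = ⊕-cong (⊙-cong p q) (shift-cong (act-cong ps q))

  act-⊕ʳ : ∀ {n} (x : Vec Carrier n) y z → act x (y ⊕ z) ∼ act x y ⊕ act x z
  act-⊕ʳ [] y z = V.sym (V.identityˡ 𝟎)
  act-⊕ʳ (a ∷ x) y z = begin
    (a ⊙ (y ⊕ z)) ⊕ shift (act x (y ⊕ z))
      ≈⟨ ⊕-cong (⊙-distribˡ a y z) (V.trans (shift-cong (act-⊕ʳ x y z)) (shift-⊕ _ _)) ⟩
    ((a ⊙ y) ⊕ (a ⊙ z)) ⊕ (shift (act x y) ⊕ shift (act x z))
      ≈⟨ interchange (a ⊙ y) _ _ _ ⟩
    act (a ∷ x) y ⊕ act (a ∷ x) z ∎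

  act-⊙ʳ : ∀ {n} (x : Vec Carrier n) b y → act x (b ⊙ y) ∼ b ⊙ act x y
  act-⊙ʳ [] b y = V.sym (⊙-zeroʳ b)
  act-⊙ʳ (a ∷ x) b y = begin
    (a ⊙ (b ⊙ y)) ⊕ shift (act x (b ⊙ y))
      ≈⟨ ⊕-cong (⊙-comm a b y) (V.trans (shift-cong (act-⊙ʳ x b y)) (shift-⊙ b _)) ⟩
    (b ⊙ (a ⊙ y)) ⊕ (b ⊙ shift (act x y))
      ≈⟨ ⊙-distribˡ b _ _ ⟨
    b ⊙ act (a ∷ x) y ∎

  act-shift : ∀ {n} (x : Vec Carrier n) y → act x (shift y) ∼ shift (act x y)
  act-shift [] y = V.sym shift-𝟎
  act-shift (a ∷ x) y = begin
    (a ⊙ shift y) ⊕ shift (act x (shift y))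
      ≈⟨ ⊕-cong (V.sym (shift-⊙ a y)) (shift-cong (act-shift x y)) ⟩
    shift (a ⊙ y) ⊕ shift (shift (act x y))
      ≈⟨ shift-⊕ _ _ ⟨
    shift (act (a ∷ x) y) ∎

  act-⊙ˡ : ∀ {n} b (x : Vec Carrier n) y → act (b ⊙ x) y ∼ b ⊙ act x y
  act-⊙ˡ b [] y = V.sym (⊙-zeroʳ b)
  act-⊙ˡ b (a ∷ x) y = begin
    ((b * a) ⊙ y) ⊕ shift (act (b ⊙ x) y)
      ≈⟨ ⊕-cong (⊙-assoc b a y) (V.trans (shift-cong (act-⊙ˡ b x y)) (shift-⊙ b _)) ⟩
    (b ⊙ (a ⊙ y)) ⊕ (b ⊙ shift (act x y))
      ≈⟨ ⊙-distribˡ b _ _ ⟨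
    b ⊙ act (a ∷ x) y ∎

  -- Both factors are polynomials in the single linear operator `shift`, and such operators commute.
  -- Together with `act-𝟏` this yields commutativity and then associativity of the product, without
  -- any formula for its coefficients.
  act-comm : ∀ {m n} (x : Vec Carrier m) (y : Vec Carrier n) z →
             act x (act y z) ∼ act y (act x z)
  act-comm [] y z = begin
    𝟎              ≈⟨ ⊙-zeroˡ _ ⟨
    0# ⊙ act y 𝟎   ≈⟨ act-⊙ʳ y 0# 𝟎 ⟨
    act y (0# ⊙ 𝟎) ≈⟨ act-cong {x = y} (∼-refl) (⊙-zeroˡ 𝟎) ⟩
    act y 𝟎        ∎
  act-comm (a ∷ x) y z = begin
    (a ⊙ act y z) ⊕ shift (act x (act y z))
      ≈⟨ ⊕-cong (V.sym (act-⊙ʳ y a z))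
                (V.trans (shift-cong (act-comm x y z)) (V.sym (act-shift y _))) ⟩
    act y (a ⊙ z) ⊕ act y (shift (act x z))
      ≈⟨ act-⊕ʳ y _ _ ⟨
    act y (act (a ∷ x) z) ∎

  𝟏 : V
  𝟏 = 1# ∷ 𝟎

  private
    pad : ∀ {m} → Vec Carrier m → ∀ n → Vec Carrier n
    pad []      n       = 𝟎
    pad (a ∷ x) zero    = []
    pad (a ∷ x) (suc n) = a ∷ pad x n

    pad-self : ∀ {n} (x : Vec Carrier n) → pad x n ∼ x
    pad-self [] = []
    pad-self (a ∷ x) = refl ∷ pad-self x

    init-𝟎 : ∀ n → Vec.init {n = n} 𝟎 ∼ 𝟎
    init-𝟎 zero = []
    init-𝟎 (suc n) = refl ∷ init-𝟎 n

    last-𝟎 : ∀ n → Vec.last {n = n} 𝟎 ≈ 0#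
    last-𝟎 zero = refl
    last-𝟎 (suc n) = last-𝟎 n

    init-pad : ∀ {m n} (x : Vec Carrier m) → m ≤ n → Vec.init (pad x (suc n)) ∼ pad x n
    init-pad {n = n} [] m≤n = init-𝟎 n
    init-pad (a ∷ x) (s≤s m≤n) = refl ∷ init-pad x m≤n

    last-pad : ∀ {m n} (x : Vec Carrier m) → m ≤ n → Vec.last (pad x (suc n)) ≈ 0#
    last-pad {n = n} [] m≤n = last-𝟎 n
    last-pad (a ∷ x) (s≤s m≤n) = last-pad x m≤n

    -- While the length stays within k + 1, the vector being shifted has top coefficient zero, so no
    -- power of x overflows and `c` never enters.
    act-pad : ∀ {m} (x : Vec Carrier m) → m ≤ suc k → act x 𝟏 ∼ pad x (suc k)
    act-pad [] m≤ = V.refl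
    act-pad (a ∷ x) (s≤s m≤) = begin
      (a ⊙ 𝟏) ⊕ shift (act x 𝟏)
        ≈⟨ ⊕-cong (*-identityʳ a ∷ ⊙-zeroʳ a)
                  (V.trans (shift-cong (act-pad x (ℕₚ.m≤n⇒m≤1+n m≤)))
                    (⊕-cong (refl ∷ init-pad x m≤)
                      (V.trans (⊙-cong (last-pad x m≤) ∼-refl) (⊙-zeroˡ c)))) ⟩
      (a ∷ 𝟎) ⊕ ((0# ∷ pad x k) ⊕ 𝟎)
        ≈⟨ ⊕-cong ∼-refl (V.identityʳ (0# ∷ pad x k)) ⟩
      (a ∷ 𝟎) ⊕ (0# ∷ pad x k)
        ≈⟨ +-identityʳ a ∷ AbelianGroup.identityˡ (⊕-abelianGroup k) (pad x k) ⟩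
      a ∷ pad x k ∎

  act-𝟏 : ∀ x → act x 𝟏 ∼ x
  act-𝟏 x = V.trans (act-pad x ℕₚ.≤-refl) (pad-self x)

  _⊛_ : V → V → V
  x ⊛ y = act x y

  ⊛-comm : ∀ x y → x ⊛ y ∼ y ⊛ x
  ⊛-comm x y = begin
    act x y         ≈⟨ act-cong {x = x} ∼-refl (act-𝟏 y) ⟨
    act x (act y 𝟏) ≈⟨ act-comm x y 𝟏 ⟩
    act y (act x 𝟏) ≈⟨ act-cong {x = y} ∼-refl (act-𝟏 x) ⟩
    act y x         ∎

  ⊛-assoc : ∀ x y z → (x ⊛ y) ⊛ z ∼ x ⊛ (y ⊛ z)
  ⊛-assoc x y z = begin
    act (act x y) z ≈⟨ ⊛-comm (act x y) z ⟩
    act z (act x y) ≈⟨ act-comm z x y ⟩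
    act x (act z y) ≈⟨ act-cong {x = x} ∼-refl (⊛-comm z y) ⟩
    act x (act y z) ∎

  commutativeRing : CommutativeRing _ _
  commutativeRing = record
    { Carrier = V
    ; _≈_ = _∼_
    ; _+_ = _⊕_
    ; _*_ = _⊛_
    ; -_ = ⊝_
    ; 0# = 𝟎
    ; 1# = 𝟏
    ; isCommutativeRing = record
      { isRing = record
        { +-isAbelianGroup = V.isAbelianGroup
        ; *-cong = act-cong
        ; *-assoc = ⊛-assoc
        ; *-identity = (λ x → V.trans (⊛-comm 𝟏 x) (act-𝟏 x)) , act-𝟏
        ; distrib = act-⊕ʳ , λ x y z → V.trans (⊛-comm (y ⊕ z) x)
            (V.trans (act-⊕ʳ x y z) (⊕-cong (⊛-comm x y) (⊛-comm x z)))
        }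
      ; *-comm = ⊛-comm }
    }

  ⟨x⟩ : V
  ⟨x⟩ = shift 𝟏

  shift≈⟨x⟩⊛ : ∀ y → shift y ∼ ⟨x⟩ ⊛ y
  shift≈⟨x⟩⊛ y = begin
    shift y         ≈⟨ shift-cong (act-𝟏 y) ⟨
    shift (act y 𝟏) ≈⟨ act-shift y 𝟏 ⟨
    act y (shift 𝟏) ≈⟨ ⊛-comm y ⟨x⟩ ⟩
    act ⟨x⟩ y       ∎

  shift≈root⊛ : ∀ {z} → z ∼ ⟨x⟩ → ∀ y → shift y ∼ z ⊛ y
  shift≈root⊛ {z} p y = V.trans (shift≈⟨x⟩⊛ y) (act-cong {x = ⟨x⟩} {z} (V.sym p) ∼-refl)

  constant : Carrier → V
  constant a = a ∷ 𝟎

  constant-⊛ : ∀ a y → constant a ⊛ y ∼ a ⊙ y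
  constant-⊛ a y = begin
    constant a ⊛ y ≈⟨ act-cong {x = constant a} {a ⊙ 𝟏} (sym (*-identityʳ a) ∷ V₀.sym (⊙-zeroʳ a)) ∼-refl ⟩
    act (a ⊙ 𝟏) y  ≈⟨ act-⊙ˡ a 𝟏 y ⟩
    a ⊙ act 𝟏 y    ≈⟨ ⊙-cong refl (V.trans (⊛-comm 𝟏 y) (act-𝟏 y)) ⟩
    a ⊙ y          ∎
    where module V₀ = AbelianGroup (⊕-abelianGroup k)

  constant-hom : Hom R commutativeRing constant
  constant-hom = mkHom R commutativeRing constant
    (λ p → p ∷ ∼-refl)
    (λ a b → refl ∷ V₀.sym (V₀.identityˡ 𝟎))
    (λ a b → V.trans (refl ∷ V₀.sym (⊙-zeroʳ a)) (V.sym (constant-⊛ a (constant b))))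
    ∼-refl
    where module V₀ = AbelianGroup (⊕-abelianGroup k)

  constant-injective : ∀ {a b} → constant a ∼ constant b → a ≈ b
  constant-injective (p ∷ _) = p

-- Evaluation at a root, and change of coefficients.

module Horner {a b ℓ ℓ′} (R : CommutativeRing a ℓ) (S : CommutativeRing b ℓ′)
              {h : CommutativeRing.Carrier R → CommutativeRing.Carrier S}
              (h-hom : Hom R S h) where
  private
    module R = CommutativeRing R
    module H = IsRingHomomorphism h-hom
  open CommutativeRing S
  open Exp semiring using (_^_)
  open CommutativeSemigroupProperties +-commutativeSemigroup using (interchange)
  open CommutativeSemigroupProperties *-commutativeSemigroup using (x∙yz≈y∙xz)
  open SetoidReasoning setoid

  eval : ∀ {n} → Carrier → Vec R.Carrier n → Carrier
  eval w x = Vec.foldr′ (λ a acc → h a + w * acc) 0# x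

  eval-cong : ∀ {n} {w w′} {x y : Vec R.Carrier n} →
              w ≈ w′ → Pointwise R._≈_ x y → eval w x ≈ eval w′ y
  eval-cong p [] = refl
  eval-cong p (q ∷ qs) = +-cong (H.⟦⟧-cong q) (*-cong p (eval-cong p qs))

  eval-𝟎 : ∀ w n → eval w (Vec.replicate n R.0#) ≈ 0#
  eval-𝟎 w zero = refl
  eval-𝟎 w (suc n) = trans (+-cong H.0#-homo (trans (*-congˡ (eval-𝟎 w n)) (zeroʳ w))) (+-identityˡ 0#)

  module Hom-eval (k : ℕ) (c : Vec R.Carrier (suc k)) (w : Carrier) where
    open Adjoin R k c

    private
      ev : ∀ {n} → Vec R.Carrier n → Carrier
      ev = eval w

    ev-⊕ : ∀ {n} (x y : Vec R.Carrier n) → ev (x ⊕ y) ≈ ev x + ev y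
    ev-⊕ [] [] = sym (+-identityʳ 0#)
    ev-⊕ (a ∷ x) (b ∷ y) = begin
      h (a R.+ b) + w * ev (x ⊕ y)
        ≈⟨ +-cong (H.+-homo a b) (trans (*-congˡ (ev-⊕ x y)) (distribˡ w _ _)) ⟩
      (h a + h b) + (w * ev x + w * ev y)
        ≈⟨ interchange _ _ _ _ ⟩
      ev (a ∷ x) + ev (b ∷ y) ∎

    ev-⊙ : ∀ {n} b (x : Vec R.Carrier n) → ev (b ⊙ x) ≈ h b * ev x
    ev-⊙ b [] = sym (zeroʳ _)
    ev-⊙ b (a ∷ x) = begin
      h (b R.* a) + w * ev (b ⊙ x)
        ≈⟨ +-cong (H.*-homo b a) (trans (*-congˡ (ev-⊙ b x)) (x∙yz≈y∙xz w (h b) _)) ⟩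
      h b * h a + h b * (w * ev x)
        ≈⟨ distribˡ (h b) _ _ ⟨
      h b * ev (a ∷ x) ∎

    ev-init-last : ∀ {n} (x : Vec R.Carrier (suc n)) →
                   ev x ≈ ev (Vec.init x) + h (Vec.last x) * w ^ n
    ev-init-last (a ∷ []) = begin
      h a + w * 0#  ≈⟨ +-congˡ (zeroʳ w) ⟩
      h a + 0#      ≈⟨ +-comm _ _ ⟩
      0# + h a      ≈⟨ +-congˡ (*-identityʳ (h a)) ⟨
      0# + h a * 1# ∎
    ev-init-last {suc n} (a ∷ x@(_ ∷ _)) = begin
      h a + w * ev x
        ≈⟨ +-congˡ (*-congˡ (ev-init-last x)) ⟩
      h a + w * (ev (Vec.init x) + h (Vec.last x) * w ^ n)
        ≈⟨ +-congˡ (trans (distribˡ w _ _) (+-congˡ (x∙yz≈y∙xz w _ _))) ⟩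
      h a + (w * ev (Vec.init x) + h (Vec.last x) * w ^ suc n)
        ≈⟨ +-assoc _ _ _ ⟨
      (h a + w * ev (Vec.init x)) + h (Vec.last x) * w ^ suc n ∎

    module _ (root : w ^ suc k ≈ ev c) where

      -- The overflowing top coefficient is multiplied by `c` in the quotient and by the power wᵏ⁺¹
      -- in the target; `root` says that these agree. All multiplicativity of evaluation comes from
      -- this.
      ev-shift : ∀ x → ev (shift x) ≈ w * ev x
      ev-shift x = begin
        ev (shift x)
          ≈⟨ trans (ev-⊕ (R.0# ∷ Vec.init x) (Vec.last x ⊙ c)) (+-congˡ (ev-⊙ (Vec.last x) c)) ⟩
        (h R.0# + w * ev (Vec.init x)) + h (Vec.last x) * ev c
          ≈⟨ +-cong (trans (+-congʳ H.0#-homo) (+-identityˡ _)) (*-congˡ (sym root)) ⟩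
        w * ev (Vec.init x) + h (Vec.last x) * (w * w ^ k)
          ≈⟨ +-congˡ (x∙yz≈y∙xz _ w _) ⟩
        w * ev (Vec.init x) + w * (h (Vec.last x) * w ^ k)
          ≈⟨ distribˡ w _ _ ⟨
        w * (ev (Vec.init x) + h (Vec.last x) * w ^ k)
          ≈⟨ *-congˡ (ev-init-last x) ⟨
        w * ev x ∎

      ev-act : ∀ {n} (x : Vec R.Carrier n) y → ev (act x y) ≈ ev x * ev y
      ev-act [] y = trans (eval-𝟎 w (suc k)) (sym (zeroˡ _))
      ev-act (a ∷ x) y = begin
        ev ((a ⊙ y) ⊕ shift (act x y))
          ≈⟨ trans (ev-⊕ (a ⊙ y) (shift (act x y)))
                   (+-cong (ev-⊙ a y) (trans (ev-shift _) (*-congˡ (ev-act x y)))) ⟩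
        h a * ev y + w * (ev x * ev y)
          ≈⟨ +-congˡ (*-assoc w _ _) ⟨
        h a * ev y + (w * ev x) * ev y
          ≈⟨ distribʳ _ _ _ ⟨
        ev (a ∷ x) * ev y ∎

      eval-hom : Hom commutativeRing S ev
      eval-hom = mkHom commutativeRing S ev (eval-cong refl) ev-⊕ ev-act
        (trans (+-cong H.1#-homo (trans (*-congˡ (eval-𝟎 w k)) (zeroʳ w))) (+-identityʳ 1#))

  eval-map : ∀ {c} {A : Set c} (f : A → R.Carrier) w {n} (x : Vec A n) →
             eval w (Vec.map f x) ≡ Vec.foldr′ (λ a acc → h (f a) + w * acc) 0# x
  eval-map f w [] = ≡.refl
  eval-map f w (a ∷ x) = cong (λ t → h (f a) + w * t) (eval-map f w x)

  module _ {c ℓ″} (T : CommutativeRing c ℓ″) {g : Carrier → CommutativeRing.Carrier T}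
           (g-hom : Hom S T g) where
    private
      module T = CommutativeRing T
      module G = IsRingHomomorphism g-hom

    eval-natural : ∀ {n} w (x : Vec R.Carrier n) →
      g (eval w x) T.≈ Vec.foldr′ (λ a acc → g (h a) T.+ g w T.* acc) T.0# x
    eval-natural w [] = G.0#-homo
    eval-natural w (a ∷ x) =
      T.trans (G.+-homo _ _) (T.+-congˡ (T.trans (G.*-homo _ _) (T.*-congˡ (eval-natural w x))))

module AdjoinRoot {a ℓ} (R : CommutativeRing a ℓ) (k : ℕ)
                  (c : Vec (CommutativeRing.Carrier R) (suc k)) where
  open Adjoin R k c
  open Horner R commutativeRing constant-hom
  open Hom-eval k c ⟨x⟩ using (ev-init-last)
  private
    module R = CommutativeRing R
    module A = CommutativeRing commutativeRing
  open Exp A.semiring using (_^_)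
  open SetoidReasoning A.setoid

  private
    eval∼act : ∀ {n} (v : Vec R.Carrier n) → eval ⟨x⟩ v ∼ act v 𝟏
    eval∼act [] = A.refl
    eval∼act (a ∷ v) = ⊕-cong
      (A.trans (A.sym (A.*-identityʳ (constant a))) (constant-⊛ a 𝟏))
      (A.trans (A.sym (shift≈⟨x⟩⊛ (eval ⟨x⟩ v))) (shift-cong (eval∼act v)))

    top : ∀ n → Vec R.Carrier (suc n)
    top n = 𝟎 Vec.∷ʳ R.1#

    init-top : ∀ n → Vec.init (top n) ∼ 𝟎
    init-top zero    = []
    init-top (suc n) = R.refl ∷ init-top n

    last-top : ∀ n → Vec.last (top n) R.≈ R.1#
    last-top zero    = R.refl
    last-top (suc n) = last-top n

  eval-⟨x⟩ : ∀ v → eval ⟨x⟩ v ∼ v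
  eval-⟨x⟩ v = A.trans (eval∼act v) (act-𝟏 v)

  eval≈⟨x⟩ : ∀ w → w ∼ ⟨x⟩ → ∀ v → eval w v ∼ v
  eval≈⟨x⟩ w p v = A.trans (eval-cong {x = v} p ∼-refl) (eval-⟨x⟩ v)

  power-top : ⟨x⟩ ^ k ∼ top k
  power-top = begin
    ⟨x⟩ ^ k
      ≈⟨ A.trans (A.+-identityˡ _) (A.*-identityˡ (⟨x⟩ ^ k)) ⟨
    𝟎 ⊕ constant R.1# ⊛ ⟨x⟩ ^ k
      ≈⟨ ⊕-cong (A.trans (eval-cong (A.refl {x = ⟨x⟩}) (init-top k)) (eval-𝟎 ⟨x⟩ k))
                (A.*-congʳ {⟨x⟩ ^ k} {constant (Vec.last (top k))} {constant R.1#} (last-top k ∷ ∼-refl)) ⟨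
    eval ⟨x⟩ (Vec.init (top k)) ⊕ constant (Vec.last (top k)) ⊛ ⟨x⟩ ^ k
      ≈⟨ ev-init-last (top k) ⟨
    eval ⟨x⟩ (top k)
      ≈⟨ eval-⟨x⟩ (top k) ⟩
    top k ∎

  -- ⟨x⟩ᵏ is the last basis vector, and one more shift moves its coefficient 1 onto `c`.
  power-root : ⟨x⟩ ^ suc k ∼ eval ⟨x⟩ c
  power-root = begin
    ⟨x⟩ ⊛ ⟨x⟩ ^ k   ≈⟨ A.*-congˡ {x = ⟨x⟩} power-top ⟩
    ⟨x⟩ ⊛ top k     ≈⟨ shift≈⟨x⟩⊛ (top k) ⟨
    shift (top k)
      ≈⟨ ⊕-cong (R.refl ∷ init-top k) (⊙-cong (last-top k) ∼-refl) ⟩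
    𝟎 ⊕ (R.1# ⊙ c)
      ≈⟨ A.trans (A.+-identityˡ _) (A.trans (A.sym (constant-⊛ R.1# c)) (A.*-identityˡ c)) ⟩
    c               ≈⟨ eval-⟨x⟩ c ⟨
    eval ⟨x⟩ c      ∎

module _ {a ℓ} (R : CommutativeRing a ℓ) where
  private module R = CommutativeRing R
  -- Transfers the laws from pointwise equality of coefficient vectors to propositional equality,
  -- the equality in which the field of the theorem is given.
  strictRing : ({x y : R.Carrier} → x R.≈ y → x ≡ y) → IsCommutativeRing _≡_ R._+_ R._*_ R.-_ R.0# R.1#
  strictRing strict = record
    { isRing = record
      { +-isAbelianGroup = record
        { isGroup = record
          { isMonoid = record
            { isSemigroup = record
              { isMagma = record { isEquivalence = ≡.isEquivalence ; ∙-cong = cong₂ R._+_ }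
              ; assoc = λ x y z → strict (R.+-assoc x y z) }
            ; identity = (λ x → strict (R.+-identityˡ x)) , (λ x → strict (R.+-identityʳ x)) }
          ; inverse = (λ x → strict (R.-‿inverseˡ x)) , (λ x → strict (R.-‿inverseʳ x))
          ; ⁻¹-cong = cong (λ x → R.- x) }
        ; comm = λ x y → strict (R.+-comm x y) }
      ; *-cong = cong₂ R._*_
      ; *-assoc = λ x y z → strict (R.*-assoc x y z)
      ; *-identity = (λ x → strict (R.*-identityˡ x)) , (λ x → strict (R.*-identityʳ x))
      ; distrib = (λ x y z → strict (R.distribˡ x y z)) , (λ x y z → strict (R.distribʳ x y z)) }
    ; *-comm = λ x y → strict (R.*-comm x y) }

module CoefficientMap {a b ℓ ℓ′} (R : CommutativeRing a ℓ) (S : CommutativeRing b ℓ′)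
  {g : CommutativeRing.Carrier R → CommutativeRing.Carrier S} (g-hom : Hom R S g) (k : ℕ)
  (c : Vec (CommutativeRing.Carrier R) (suc k)) (d : Vec (CommutativeRing.Carrier S) (suc k))
  (c↦d : Pointwise (CommutativeRing._≈_ S) (Vec.map g c) d) where
  private
    module R = CommutativeRing R
    module S = CommutativeRing S
    module A = Adjoin R k c
    module B = Adjoin S k d
    module G = IsRingHomomorphism g-hom
    module B-ring = CommutativeRing B.commutativeRing
  open B using (_∼_; ∼-refl)

  map-cong : ∀ {n} {x y : Vec R.Carrier n} → x A.∼ y → Vec.map g x ∼ Vec.map g y
  map-cong [] = []
  map-cong (p ∷ ps) = G.⟦⟧-cong p ∷ map-cong ps

  map-⊕ : ∀ {n} (x y : Vec R.Carrier n) → Vec.map g (x A.⊕ y) ∼ Vec.map g x B.⊕ Vec.map g y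
  map-⊕ [] [] = []
  map-⊕ (a ∷ x) (b ∷ y) = G.+-homo a b ∷ map-⊕ x y

  map-⊙ : ∀ {n} a (x : Vec R.Carrier n) → Vec.map g (a A.⊙ x) ∼ g a B.⊙ Vec.map g x
  map-⊙ a [] = []
  map-⊙ a (b ∷ x) = G.*-homo a b ∷ map-⊙ a x

  map-𝟎 : ∀ n → Vec.map g (A.𝟎 {n}) ∼ B.𝟎
  map-𝟎 zero = []
  map-𝟎 (suc n) = G.0#-homo ∷ map-𝟎 n

  map-init : ∀ {n} (x : Vec R.Carrier (suc n)) → Vec.map g (Vec.init x) ∼ Vec.init (Vec.map g x)
  map-init (a ∷ []) = []
  map-init (a ∷ x@(_ ∷ _)) = S.refl ∷ map-init x

  map-last : ∀ {n} (x : Vec R.Carrier (suc n)) → g (Vec.last x) S.≈ Vec.last (Vec.map g x)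
  map-last (a ∷ []) = S.refl
  map-last (a ∷ x@(_ ∷ _)) = map-last x

  open SetoidReasoning B-ring.setoid

  map-shift : ∀ x → Vec.map g (A.shift x) ∼ B.shift (Vec.map g x)
  map-shift x = begin
    Vec.map g (A.shift x)
      ≈⟨ map-⊕ (R.0# ∷ Vec.init x) _ ⟩
    Vec.map g (R.0# ∷ Vec.init x) B.⊕ Vec.map g (Vec.last x A.⊙ c)
      ≈⟨ B.⊕-cong (G.0#-homo ∷ map-init x)
           (B-ring.trans (map-⊙ (Vec.last x) c) (B.⊙-cong (map-last x) c↦d)) ⟩
    B.shift (Vec.map g x) ∎

  map-act : ∀ {n} (x : Vec R.Carrier n) y →
            Vec.map g (A.act x y) ∼ B.act (Vec.map g x) (Vec.map g y)
  map-act [] y = map-𝟎 (suc k)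
  map-act (a ∷ x) y = begin
    Vec.map g ((a A.⊙ y) A.⊕ A.shift (A.act x y))
      ≈⟨ map-⊕ (a A.⊙ y) _ ⟩
    Vec.map g (a A.⊙ y) B.⊕ Vec.map g (A.shift (A.act x y))
      ≈⟨ B.⊕-cong (map-⊙ a y)
           (B-ring.trans (map-shift (A.act x y)) (B.shift-cong (map-act x y))) ⟩
    B.act (Vec.map g (a ∷ x)) (Vec.map g y) ∎

  map-hom : Hom A.commutativeRing B.commutativeRing (Vec.map g)
  map-hom = mkHom A.commutativeRing B.commutativeRing (Vec.map g) map-cong map-⊕ map-act
    (G.1#-homo ∷ map-𝟎 k)

-- Binomial coefficients, powers and the Frobenius map.

prime∤! : ∀ {p} → Prime p → ∀ k → k < p → ¬ (p ∣ k !)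
prime∤! pr zero    k<p p∣ = case ∣.∣1⇒≡1 p∣ of λ { ≡.refl → ¬prime[1] pr }
prime∤! pr (suc k) k<p p∣ with euclidsLemma (suc k) (k !) pr p∣
... | inj₁ p∣k = >⇒∤ k<p p∣k
... | inj₂ p∣k! = prime∤! pr k (ℕₚ.<-trans (ℕₚ.n<1+n k) k<p) p∣k!

prime∣C : ∀ {p} → Prime p → ∀ k → 0 < k → k < p → p ∣ p Combinatorics.C k
prime∣C {p@(suc p-1)} pr k 0<k k<p
  with euclidsLemma (p Combinatorics.C k) (k ! ℕ.* (p ℕ.∸ k) !) pr (subst (p ∣_) (≡.sym eq) (m∣m*n (p-1 !)))
  where
  instance nz = k ℕₚ.!* (p ℕ.∸ k) !≢0
  eq : (p Combinatorics.C k) ℕ.* (k ! ℕ.* (p ℕ.∸ k) !) ≡ p !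
  eq = ≡.trans (cong (ℕ._* (k ! ℕ.* (p ℕ.∸ k) !)) (nCk≡n!/k![n-k]! (ℕₚ.<⇒≤ k<p)))
               (m/n*n≡m (k![n∸k]!∣n! (ℕₚ.<⇒≤ k<p)))
... | inj₁ d = d
... | inj₂ d with euclidsLemma (k !) ((p ℕ.∸ k) !) pr d
...   | inj₁ d′ = ⊥-elim (prime∤! pr k k<p d′)
...   | inj₂ d′ = ⊥-elim (prime∤! pr (p ℕ.∸ k) (ℕₚ.∸-monoʳ-< 0<k (ℕₚ.<⇒≤ k<p)) d′)

module Powers {a ℓ} (R : CommutativeRing a ℓ) where
  open CommutativeRing R
  open Exp semiring public
  open CommutativeExp commutativeSemiring public using (^-distrib-*)
  open SetoidReasoning setoid

  1^n≈1 : ∀ n → 1# ^ n ≈ 1#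
  1^n≈1 zero = refl
  1^n≈1 (suc n) = trans (*-identityˡ _) (1^n≈1 n)

  ^-order : ∀ {x n} → x ^ n ≈ 1# → ∀ q → x ^ (q ℕ.* n) ≈ 1#
  ^-order {x} {n} h q = begin
    x ^ (q ℕ.* n)  ≈⟨ ^-congʳ x (ℕₚ.*-comm q n) ⟩
    x ^ (n ℕ.* q)  ≈⟨ ^-assocʳ x n q ⟨
    (x ^ n) ^ q    ≈⟨ ^-congˡ q h ⟩
    1# ^ q         ≈⟨ 1^n≈1 q ⟩
    1#             ∎

  ^-% : ∀ {x n} .{{_ : NonZero n}} → x ^ n ≈ 1# → ∀ m → x ^ m ≈ x ^ (m % n)
  ^-% {x} {n} h m = begin
    x ^ m                            ≈⟨ ^-congʳ x (m≡m%n+[m/n]*n m n) ⟩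
    x ^ (m % n ℕ.+ m / n ℕ.* n)      ≈⟨ ^-homo-* x (m % n) _ ⟩
    x ^ (m % n) * x ^ (m / n ℕ.* n)  ≈⟨ *-congˡ (^-order h (m / n)) ⟩
    x ^ (m % n) * 1#                 ≈⟨ *-identityʳ _ ⟩
    x ^ (m % n)                      ∎

  ^-≡% : ∀ {x n} .{{_ : NonZero n}} → x ^ n ≈ 1# → ∀ {l m} → l % n ≡ m % n → x ^ l ≈ x ^ m
  ^-≡% {x} h {l} {m} eq =
    trans (^-% h l) (trans (^-congʳ x eq) (sym (^-% h m)))

  ^-comm : ∀ x m n → (x ^ m) ^ n ≈ (x ^ n) ^ m
  ^-comm x m n = trans (^-assocʳ x m n) (trans (^-congʳ x (ℕₚ.*-comm m n)) (sym (^-assocʳ x n m)))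

  unit-cancelˡ : ∀ {u v} → u * v ≈ 1# → ∀ {x y} → u * x ≈ u * y → x ≈ y
  unit-cancelˡ {u} {v} uv {x} {y} eq = begin
    x           ≈⟨ lemma x ⟨
    v * (u * x) ≈⟨ *-congˡ eq ⟩
    v * (u * y) ≈⟨ lemma y ⟩
    y           ∎
    where
    lemma : ∀ z → v * (u * z) ≈ z
    lemma z = trans (sym (*-assoc v u z))
      (trans (*-congʳ (trans (*-comm v u) uv)) (*-identityˡ z))

  ×≈×1* : ∀ n x → Mult._×_ semiring n x ≈ Mult._×_ semiring n 1# * x
  ×≈×1* n x = trans (Mult.×-congʳ semiring n (sym (*-identityˡ x))) (sym (Mult.×-assoc-* semiring n 1# x))

module HomPowers {a b ℓ ℓ′} (R : CommutativeRing a ℓ) (S : CommutativeRing b ℓ′)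
  {h : CommutativeRing.Carrier R → CommutativeRing.Carrier S} (h-hom : Hom R S h) where
  private
    module R = Powers R
    module S = Powers S
    module H = IsRingHomomorphism h-hom
  open CommutativeRing S

  ^-homo : ∀ x n → h (x R.^ n) ≈ h x S.^ n
  ^-homo x zero = H.1#-homo
  ^-homo x (suc n) = trans (H.*-homo _ _) (*-congˡ (^-homo x n))

module Characteristic {a ℓ} (R : CommutativeRing a ℓ) where
  open CommutativeRing R
  open Powers R
  open Mult semiring using () renaming (_×_ to _·_)
  open SetoidReasoning setoid

  module _ {p : ℕ} (p-prime : Prime p) (p≈0 : p · 1# ≈ 0#) where

    multiple≈0 : ∀ {n} → p ∣ n → ∀ x → n · x ≈ 0#
    multiple≈0 {n} (divides q eq) x = begin
      n · x               ≈⟨ MonoidMult.×-congˡ +-monoid {x} (≡.trans eq (ℕₚ.*-comm q p)) ⟩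
      (p ℕ.* q) · x       ≈⟨ MonoidMult.×-assocˡ +-monoid x p q ⟨
      p · (q · x)         ≈⟨ ×≈×1* p _ ⟩
      (p · 1#) * (q · x)  ≈⟨ trans (*-congʳ p≈0) (zeroˡ _) ⟩
      0#                  ∎

    frobenius-+ : ∀ x y → (x + y) ^ p ≈ x ^ p + y ^ p
    frobenius-+ x y = trans (Binomial.theorem commutativeSemiring p x y) (expand p ≡.refl)
      where
      open Binomial commutativeSemiring using (binomialTerm)
      open SemiringSum semiring using (sum; sum-init-last; sum-cong-≋; sum-replicate-zero)
      -- The upper index is generalised to q so that it can be exposed as a successor and both end
      -- terms split off, while p stays fixed in the terms.
      expand : ∀ q → q ≡ p → sum (binomialTerm x y q) ≈ x ^ p + y ^ p
      expand zero    ≡.refl = ⊥-elim (¬prime[0] p-prime)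
      expand (suc q) eq@≡.refl = begin
        binomialTerm x y p Fin.zero + sum (binomialTerm x y p ∘ Fin.suc)
          ≈⟨ +-congˡ (sum-init-last (binomialTerm x y p ∘ Fin.suc)) ⟩
        binomialTerm x y p Fin.zero + (sum (binomialTerm x y p ∘ Fin.suc ∘ Fin.inject₁) + binomialTerm x y p (Fin.suc (Fin.fromℕ q)))
          ≈⟨ +-cong first (+-cong middle last) ⟩
        y ^ p + (0# + x ^ p)
          ≈⟨ trans (+-congˡ (+-identityˡ _)) (+-comm _ _) ⟩
        x ^ p + y ^ p ∎
        where
        first : binomialTerm x y p Fin.zero ≈ y ^ p
        first = trans (MonoidMult.×-homo-1 +-monoid _) (*-identityˡ _)
        last : binomialTerm x y p (Fin.suc (Fin.fromℕ q)) ≈ x ^ p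
        last rewrite Finₚ.toℕ-fromℕ q | nCn≡1 (suc q) | ℕₚ.n∸n≡0 q =
          trans (MonoidMult.×-homo-1 +-monoid _) (*-identityʳ _)
        middle : sum (binomialTerm x y p ∘ Fin.suc ∘ Fin.inject₁) ≈ 0#
        middle = trans
          (sum-cong-≋ {q} (λ i → multiple≈0
            (prime∣C p-prime (suc (toℕ (Fin.inject₁ i))) (s≤s z≤n)
              (s≤s (subst (_< q) (≡.sym (Finₚ.toℕ-inject₁ i)) (Finₚ.toℕ<n i)))) _))
          (sum-replicate-zero q)

    frobenius-0 : 0# ^ p ≈ 0#
    frobenius-0 = lemma (prime⇒nonZero p-prime)
      where
      lemma : ∀ {n} → NonZero n → 0# ^ n ≈ 0#
      lemma {suc n} _ = zeroˡ _

    frobenius-neg : ∀ x → (- x) ^ p ≈ - (x ^ p)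
    frobenius-neg x = RingProperties.+-cancelˡ ring (x ^ p) _ _ (begin
      x ^ p + (- x) ^ p  ≈⟨ frobenius-+ x (- x) ⟨
      (x - x) ^ p        ≈⟨ ^-congˡ p (-‿inverseʳ x) ⟩
      0# ^ p             ≈⟨ frobenius-0 ⟩
      0#                 ≈⟨ -‿inverseʳ _ ⟨
      x ^ p - x ^ p      ∎)

    module _ {h : ℤ → Carrier} (h-hom : Hom ℤₚ.+-*-commutativeRing R h) where
      private module H = IsRingHomomorphism h-hom
      open Horner ℤₚ.+-*-commutativeRing R h-hom using (eval; eval-cong)

      fermat-natural : ∀ n → h (+ n) ^ p ≈ h (+ n)
      fermat-natural zero =
        trans (^-congˡ p H.0#-homo) (trans frobenius-0 (sym H.0#-homo))
      fermat-natural (suc n) = begin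
        h (+ suc n) ^ p        ≈⟨ ^-congˡ p (H.+-homo ℤ.1ℤ (+ n)) ⟩
        (h ℤ.1ℤ + h (+ n)) ^ p ≈⟨ frobenius-+ _ _ ⟩
        h ℤ.1ℤ ^ p + h (+ n) ^ p
          ≈⟨ +-cong (trans (^-congˡ p H.1#-homo) (trans (1^n≈1 p) (sym H.1#-homo)))
                    (fermat-natural n) ⟩
        h ℤ.1ℤ + h (+ n)       ≈⟨ H.+-homo ℤ.1ℤ (+ n) ⟨
        h (+ suc n)            ∎

      fermat-integer : ∀ i → h i ^ p ≈ h i
      fermat-integer (+ n) = fermat-natural n
      fermat-integer -[1+ n ] = begin
        h -[1+ n ] ^ p         ≈⟨ ^-congˡ p (H.-‿homo (+ suc n)) ⟩
        (- h (+ suc n)) ^ p    ≈⟨ frobenius-neg _ ⟩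
        - (h (+ suc n) ^ p)    ≈⟨ -‿cong (fermat-natural (suc n)) ⟩
        - h (+ suc n)          ≈⟨ H.-‿homo (+ suc n) ⟨
        h -[1+ n ]             ∎

      -- Integer coefficients are fixed by Fermat's little theorem, so Frobenius only moves the
      -- point of evaluation.
      eval-frobenius : ∀ {n} w (v : Vec ℤ n) → eval w v ^ p ≈ eval (w ^ p) v
      eval-frobenius w [] = frobenius-0
      eval-frobenius w (a ∷ v) = trans (frobenius-+ _ _)
        (+-cong (fermat-integer a)
                (trans (^-distrib-* w _ p) (*-congˡ (eval-frobenius w v))))

      eval-frobenius-iterate : ∀ {n} j w (v : Vec ℤ n) →
                               eval w v ^ (p ℕ.^ j) ≈ eval (w ^ (p ℕ.^ j)) v
      eval-frobenius-iterate zero w v =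
        trans (*-identityʳ _) (eval-cong {x = v} (sym (*-identityʳ w)) (Pointwise.refl ≡.refl))
      eval-frobenius-iterate (suc j) w v = begin
        eval w v ^ (p ℕ.* p ℕ.^ j)     ≈⟨ ^-assocʳ _ p _ ⟨
        (eval w v ^ p) ^ (p ℕ.^ j)     ≈⟨ ^-congˡ (p ℕ.^ j) (eval-frobenius w v) ⟩
        eval (w ^ p) v ^ (p ℕ.^ j)     ≈⟨ eval-frobenius-iterate j (w ^ p) v ⟩
        eval ((w ^ p) ^ (p ℕ.^ j)) v   ≈⟨ eval-cong {x = v} (^-assocʳ w p _) (Pointwise.refl ≡.refl) ⟩
        eval (w ^ (p ℕ.* p ℕ.^ j)) v   ∎

-- Finite sums, Gauss sums and Jacobi sums.

module Summation {a ℓ} (R : CommutativeRing a ℓ) where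
  open CommutativeRing R
  open SemiringSum semiring public
    using (sum; sum-cong-≋; *-distribˡ-sum; *-distribʳ-sum; ∑-comm)
  open SetoidReasoning setoid

  ∑ : ℕ → (ℕ → Carrier) → Carrier
  ∑ n f = sum {n} (λ i → f (toℕ i))

  ∑-cong : ∀ n {f g : ℕ → Carrier} → (∀ k → k < n → f k ≈ g k) → ∑ n f ≈ ∑ n g
  ∑-cong n h = sum-cong-≋ {n} (λ i → h (toℕ i) (Finₚ.toℕ<n i))

  ∑-step : ∀ n f → ∑ n (f ∘ suc) + f 0 ≈ ∑ n f + f n
  ∑-step zero f = refl
  ∑-step (suc n) f = begin
    (f 1 + ∑ n (f ∘ suc ∘ suc)) + f 0   ≈⟨ +-comm _ _ ⟩
    f 0 + (f 1 + ∑ n (f ∘ suc ∘ suc))   ≈⟨ +-congˡ (+-comm _ _) ⟩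
    f 0 + (∑ n (f ∘ suc ∘ suc) + f 1)   ≈⟨ +-congˡ (∑-step n (f ∘ suc)) ⟩
    f 0 + (∑ n (f ∘ suc) + f (suc n))   ≈⟨ +-assoc _ _ _ ⟨
    ∑ (suc n) f + f (suc n)             ∎

  -- Moving the window by one trades f 0 for f n, which are equal by periodicity.
  ∑-periodic : ∀ n f → (∀ k → f (k ℕ.+ n) ≈ f k) → ∀ m → ∑ n (λ k → f (m ℕ.+ k)) ≈ ∑ n f
  ∑-periodic n f period zero = refl
  ∑-periodic n f period (suc m) = trans
    (∑-periodic n (f ∘ suc) (period ∘ suc) m)
    (RingProperties.+-cancelʳ ring (f 0) _ _ (trans (∑-step n f) (+-congˡ (period 0))))

  listSum : List Carrier → Carrier
  listSum = List.foldr _+_ 0#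

  listSum-↭ : ∀ {ms ns} (f : ℕ → Carrier) → ms ↭ ns → listSum (List.map f ms) ≈ listSum (List.map f ns)
  listSum-↭ f Perm.refl = refl
  listSum-↭ f (Perm.prep x p) = +-congˡ (listSum-↭ f p)
  listSum-↭ f (Perm.swap x y p) =
    trans (+-congˡ (+-congˡ (listSum-↭ f p)))
      (CommutativeSemigroupProperties.x∙yz≈y∙xz +-commutativeSemigroup _ _ _)
  listSum-↭ f (Perm.trans p q) = trans (listSum-↭ f p) (listSum-↭ f q)

  ∑≡listSum : ∀ n (f : ℕ → Carrier) (g : ℕ → ℕ) → ∑ n (f ∘ g) ≡ listSum (List.map f (List.applyUpTo g n))
  ∑≡listSum zero f g = ≡.refl
  ∑≡listSum (suc n) f g = cong (λ s → f (g 0) + s) (∑≡listSum n f (g ∘ suc))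

*-≡% : ∀ n .{{_ : NonZero n}} a {b c} → b % n ≡ c % n → (a ℕ.* b) % n ≡ (a ℕ.* c) % n
*-≡% n a {b} {c} eq = ≡.trans (%-distribˡ-* a b n)
  (≡.trans (cong (λ t → ((a % n) ℕ.* t) % n) eq) (≡.sym (%-distribˡ-* a c n)))

-- For a primitive root γ modulo a prime ℓ = suc (suc N), the Gauss sum of the
-- character γᵏ ↦ zᵏ is Σₖ zᵏ x^γᵏ.
module GaussSum {a b} (R : CommutativeRing a b)
  (ℓ : ℕ) .{{_ : NonZero ℓ}} (N : ℕ) (γ : ℕ) (γ^N : (γ ℕ.^ suc N) % ℓ ≡ 1 % ℓ)
  (x : CommutativeRing.Carrier R)
  (x^ℓ≈1 : CommutativeRing._≈_ R (Exp._^_ (CommutativeRing.semiring R) x ℓ) (CommutativeRing.1# R)) where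

  open CommutativeRing R
  open Powers R
  open Summation R
  open SetoidReasoning setoid

  term : Carrier → ℕ → ℕ → Carrier
  term z e k = z ^ k * x ^ (γ ℕ.^ k ℕ.* e)

  twisted : Carrier → ℕ → Carrier
  twisted z e = ∑ (suc N) (term z e)

  gauss : Carrier → Carrier
  gauss z = twisted z 1

  geometric : Carrier → Carrier
  geometric z = ∑ (suc N) (z ^_)

  term-≡% : ∀ z {e e′} → e % ℓ ≡ e′ % ℓ → ∀ k → term z e k ≈ term z e′ k
  term-≡% z eq k = *-congˡ (^-≡% x^ℓ≈1 (*-≡% ℓ (γ ℕ.^ k) eq))

  twisted-≡% : ∀ z {e e′} → e % ℓ ≡ e′ % ℓ → twisted z e ≈ twisted z e′
  twisted-≡% z eq = ∑-cong (suc N) (λ k _ → term-≡% z eq k)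

  module _ {z : Carrier} (z^N : z ^ suc N ≈ 1#) where

    term-periodic : ∀ e k → term z e (k ℕ.+ suc N) ≈ term z e k
    term-periodic e k = *-cong
      (trans (^-homo-* z k (suc N)) (trans (*-congˡ z^N) (*-identityʳ _)))
      (^-≡% x^ℓ≈1 (≡.trans (cong (_% ℓ) lemma) (≡.trans (*-≡% ℓ (γ ℕ.^ k ℕ.* e) γ^N)
        (cong (_% ℓ) (ℕₚ.*-identityʳ (γ ℕ.^ k ℕ.* e))))))
      where
      lemma : γ ℕ.^ (k ℕ.+ suc N) ℕ.* e ≡ γ ℕ.^ k ℕ.* e ℕ.* γ ℕ.^ suc N
      lemma = ≡.trans (cong (ℕ._* e) (ℕₚ.^-distribˡ-+-* γ k (suc N)))
        (solve 3 (λ a b e → a :* b :* e := a :* e :* b) ≡.refl (γ ℕ.^ k) (γ ℕ.^ suc N) e)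
        where open +-*-Solver

    -- Replacing x by its γᵐ-th power moves the summation index by m over a full period; the
    -- character values then differ by the common factor zᵐ.
    twisted-shift : ∀ m e → z ^ m * twisted z (γ ℕ.^ m ℕ.* e) ≈ twisted z e
    twisted-shift m e = begin
      z ^ m * ∑ (suc N) (term z (γ ℕ.^ m ℕ.* e))
        ≈⟨ *-distribˡ-sum {suc N} (z ^ m) (λ i → term z (γ ℕ.^ m ℕ.* e) (toℕ i)) ⟩
      ∑ (suc N) (λ k → z ^ m * term z (γ ℕ.^ m ℕ.* e) k)
        ≈⟨ ∑-cong (suc N) (λ k _ → trans (sym (*-assoc _ _ _))
             (*-cong (sym (^-homo-* z m k)) (^-congʳ x (lemma k)))) ⟩
      ∑ (suc N) (λ k → term z e (m ℕ.+ k))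
        ≈⟨ ∑-periodic (suc N) (term z e) (term-periodic e) m ⟩
      twisted z e ∎
      where
      lemma : ∀ k → γ ℕ.^ k ℕ.* (γ ℕ.^ m ℕ.* e) ≡ γ ℕ.^ (m ℕ.+ k) ℕ.* e
      lemma k = ≡.trans
        (solve 3 (λ a b e → a :* (b :* e) := b :* a :* e) ≡.refl (γ ℕ.^ k) (γ ℕ.^ m) e)
        (cong (ℕ._* e) (≡.sym (ℕₚ.^-distribˡ-+-* γ m k)))
        where open +-*-Solver

    -- Since zᵖ = z, Frobenius acts on the sum only by x ↦ xᵖ. This is the substitution x ↦ x^γᵐ
    -- because p ≡ γᵐ modulo ℓ, and `twisted-shift` undoes it.
    gauss-frobenius : ∀ {p} (p-prime : Prime p) → Mult._×_ semiring p 1# ≈ 0# →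
      z ^ p ≈ z → ∀ {m} → p % ℓ ≡ (γ ℕ.^ m) % ℓ → z ^ m * gauss z ^ p ≈ gauss z
    gauss-frobenius {p} p-prime p≈0 z^p≈z {m} p≡γ^m =
      trans (*-congˡ (begin
        gauss z ^ p
          ≈⟨ frobenius-∑ (suc N) (term z 1) ⟩
        ∑ (suc N) (λ k → term z 1 k ^ p)
          ≈⟨ ∑-cong (suc N) (λ k _ → lemma k) ⟩
        ∑ (suc N) (term z p)
          ≈⟨ twisted-≡% z (≡.trans p≡γ^m (cong (_% ℓ) (≡.sym (ℕₚ.*-identityʳ _)))) ⟩
        twisted z (γ ℕ.^ m ℕ.* 1) ∎)) (twisted-shift m 1)
      where
      open Characteristic R
      lemma : ∀ k → term z 1 k ^ p ≈ term z p k
      lemma k = begin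
        (z ^ k * x ^ (γ ℕ.^ k ℕ.* 1)) ^ p       ≈⟨ ^-distrib-* _ _ p ⟩
        (z ^ k) ^ p * (x ^ (γ ℕ.^ k ℕ.* 1)) ^ p
          ≈⟨ *-cong (trans (^-comm z k p) (^-congˡ k z^p≈z))
                    (trans (^-assocʳ x (γ ℕ.^ k ℕ.* 1) p)
                      (^-congʳ x (cong (ℕ._* p) (ℕₚ.*-identityʳ (γ ℕ.^ k))))) ⟩
        z ^ k * x ^ (γ ℕ.^ k ℕ.* p)             ∎

      frobenius-∑ : ∀ n f → ∑ n f ^ p ≈ ∑ n (λ k → f k ^ p)
      frobenius-∑ zero f = frobenius-0 p-prime p≈0
      frobenius-∑ (suc n) f = trans (frobenius-+ p-prime p≈0 _ _) (+-congˡ (frobenius-∑ n (f ∘ suc)))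

  -- Here `o` is the logarithm of -1, so 1 + γᵒ⁺ᵗ is zero modulo ℓ at t = 0. For the other values t
  -- = s + 1 it is invertible, and `e s` is the logarithm of its inverse.
  module Jacobi (o : ℕ) (γ^o≡-1 : (1 ℕ.+ γ ℕ.^ o) % ℓ ≡ 0 % ℓ) (e : ℕ → ℕ)
    (γ^e-inverse : ∀ s → s < N → (γ ℕ.^ e s ℕ.* (1 ℕ.+ γ ℕ.^ (o ℕ.+ suc s))) % ℓ ≡ 1 % ℓ) where

    -- The Jacobi sum of the characters with values y and z at γ, as a
    -- function of z and u = yz.
    jacobi : Carrier → Carrier → Carrier
    jacobi z u = ∑ N (λ s → z ^ (o ℕ.+ suc s) * u ^ e s)

    -- Write the index of the second sum as o + k + t; the exponents of x then add up to γᵏ(1 +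
    -- γᵒ⁺ᵗ). For t = 0 the power of x is 1 and the sum over k is geometric. For every other t the
    -- sum over k is a twist of the Gauss sum of yz, and the twisting factors form the Jacobi sum.
    -- The geometric sum is kept, to be evaluated separately for each character.
    gauss-* : ∀ {y z} → y ^ suc N ≈ 1# → z ^ suc N ≈ 1# →
      gauss y * gauss z ≈ jacobi z (y * z) * gauss (y * z) + z ^ o * geometric (y * z)
    gauss-* {y} {z} y^N z^N = begin
      gauss y * gauss z
        ≈⟨ *-distribʳ-sum {suc N} (gauss z) (λ i → term y 1 (toℕ i)) ⟩
      ∑ (suc N) (λ k → term y 1 k * gauss z)
        -- The inner sum is started at o + k, so that t measures the ratio of the two arguments
        -- relative to -1.
        ≈⟨ ∑-cong (suc N) (λ k _ → *-congˡ {term y 1 k} (∑-periodic (suc N) (term z 1) (term-periodic z^N 1) (o ℕ.+ k))) ⟨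
      ∑ (suc N) (λ k → term y 1 k * ∑ (suc N) (λ t → term z 1 (o ℕ.+ k ℕ.+ t)))
        ≈⟨ ∑-cong (suc N) (λ k _ → *-distribˡ-sum {suc N} (term y 1 k) (λ i → term z 1 (o ℕ.+ k ℕ.+ toℕ i))) ⟩
      ∑ (suc N) (λ k → ∑ (suc N) (λ t → term y 1 k * term z 1 (o ℕ.+ k ℕ.+ t)))
        ≈⟨ ∑-comm {suc N} {suc N} (λ i j → term y 1 (toℕ i) * term z 1 (o ℕ.+ toℕ i ℕ.+ toℕ j)) ⟩
      ∑ (suc N) (λ t → ∑ (suc N) (λ k → term y 1 k * term z 1 (o ℕ.+ k ℕ.+ t)))
        ≈⟨ ∑-cong (suc N) (λ t _ → trans (∑-cong (suc N) (λ k _ → product k t))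
             (sym (*-distribˡ-sum {suc N} (z ^ (o ℕ.+ t)) (λ i → term u (1 ℕ.+ γ ℕ.^ (o ℕ.+ t)) (toℕ i))))) ⟩
      ∑ (suc N) (λ t → z ^ (o ℕ.+ t) * twisted u (1 ℕ.+ γ ℕ.^ (o ℕ.+ t)))
        ≈⟨ +-comm _ _ ⟩
      ∑ N (λ s → z ^ (o ℕ.+ suc s) * twisted u (1 ℕ.+ γ ℕ.^ (o ℕ.+ suc s)))
        + z ^ (o ℕ.+ 0) * twisted u (1 ℕ.+ γ ℕ.^ (o ℕ.+ 0))
        ≈⟨ +-cong
             (trans (∑-cong N (λ s s<N → trans (*-congˡ {z ^ (o ℕ.+ suc s)} (nonzero s s<N)) (sym (*-assoc _ _ (gauss u)))))
               (sym (*-distribʳ-sum {N} (gauss u) (λ i → z ^ (o ℕ.+ suc (toℕ i)) * u ^ e (toℕ i)))))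
             (*-cong (^-congʳ z (ℕₚ.+-identityʳ o)) vanishing) ⟩
      jacobi z u * gauss u + z ^ o * geometric u ∎
      where
      u = y * z
      u^N : u ^ suc N ≈ 1#
      u^N = trans (^-distrib-* y z (suc N)) (trans (*-cong y^N z^N) (*-identityʳ 1#))
      open CommutativeSemigroupProperties *-commutativeSemigroup using (interchange)

      product : ∀ k t → term y 1 k * term z 1 (o ℕ.+ k ℕ.+ t) ≈
                        z ^ (o ℕ.+ t) * term u (1 ℕ.+ γ ℕ.^ (o ℕ.+ t)) k
      product k t = begin
        (y ^ k * x ^ (γ ℕ.^ k ℕ.* 1)) * (z ^ (o ℕ.+ k ℕ.+ t) * x ^ (γ ℕ.^ (o ℕ.+ k ℕ.+ t) ℕ.* 1))
          ≈⟨ interchange _ _ _ _ ⟩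
        (y ^ k * z ^ (o ℕ.+ k ℕ.+ t)) * (x ^ (γ ℕ.^ k ℕ.* 1) * x ^ (γ ℕ.^ (o ℕ.+ k ℕ.+ t) ℕ.* 1))
          ≈⟨ *-cong (trans (*-congˡ (trans (^-congʳ z exponent) (^-homo-* z (o ℕ.+ t) k)))
                (x∙yz≈y∙xz _ _ _))
               (trans (sym (^-homo-* x (γ ℕ.^ k ℕ.* 1) _)) (^-congʳ x exponent′)) ⟩
        (z ^ (o ℕ.+ t) * (y ^ k * z ^ k)) * x ^ (γ ℕ.^ k ℕ.* (1 ℕ.+ γ ℕ.^ (o ℕ.+ t)))
          ≈⟨ trans (*-assoc _ _ _) (*-congˡ (*-congʳ (sym (^-distrib-* y z k)))) ⟩
        z ^ (o ℕ.+ t) * term u (1 ℕ.+ γ ℕ.^ (o ℕ.+ t)) k ∎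
        where
        open CommutativeSemigroupProperties *-commutativeSemigroup using (x∙yz≈y∙xz)
        open +-*-Solver
        exponent : o ℕ.+ k ℕ.+ t ≡ o ℕ.+ t ℕ.+ k
        exponent = solve 3 (λ o k t → o :+ k :+ t := o :+ t :+ k) ≡.refl o k t
        exponent′ : γ ℕ.^ k ℕ.* 1 ℕ.+ γ ℕ.^ (o ℕ.+ k ℕ.+ t) ℕ.* 1 ≡
                    γ ℕ.^ k ℕ.* (1 ℕ.+ γ ℕ.^ (o ℕ.+ t))
        exponent′ = ≡.trans
          (cong (λ w → γ ℕ.^ k ℕ.* 1 ℕ.+ w ℕ.* 1)
            (≡.trans (cong (γ ℕ.^_) exponent) (ℕₚ.^-distribˡ-+-* γ (o ℕ.+ t) k)))
          (solve 2 (λ a b → a :* con 1 :+ (b :* a) :* con 1 := a :* (con 1 :+ b)) ≡.refl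
            (γ ℕ.^ k) (γ ℕ.^ (o ℕ.+ t)))

      nonzero : ∀ s → s < N → twisted u (1 ℕ.+ γ ℕ.^ (o ℕ.+ suc s)) ≈ u ^ e s * gauss u
      nonzero s s<N = trans (sym (twisted-shift u^N (e s) _)) (*-congˡ (twisted-≡% u (γ^e-inverse s s<N)))

      vanishing : twisted u (1 ℕ.+ γ ℕ.^ (o ℕ.+ 0)) ≈ geometric u
      vanishing = ∑-cong (suc N) {g = u ^_} (λ k _ → trans
        (*-congˡ {u ^ k} (^-≡% x^ℓ≈1 {γ ℕ.^ k ℕ.* (1 ℕ.+ γ ℕ.^ (o ℕ.+ 0))} {0}
          (≡.trans (*-≡% ℓ (γ ℕ.^ k) (≡.trans (cong (λ t → (1 ℕ.+ γ ℕ.^ t) % ℓ) (ℕₚ.+-identityʳ o)) γ^o≡-1))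
                   (cong (_% ℓ) (ℕₚ.*-zeroʳ (γ ℕ.^ k))))))
        (*-identityʳ _))

-- Explicit computations in ℤ[ζ].

module Z34 where
  alternatingℤ : ∀ n → ℤ → Vec ℤ n
  alternatingℤ zero    i = []
  alternatingℤ (suc n) i = i ∷ alternatingℤ n (ℤ.- i)

  module ℤζ = Adjoin ℤₚ.+-*-commutativeRing 15 (alternatingℤ 16 ℤ.-1ℤ)

  ℤ[ζ] : CommutativeRing _ _
  ℤ[ζ] = ℤζ.commutativeRing

  module ℤζ-Powers = Powers ℤ[ζ]

  infix 4 _≟_
  _≟_ : DecidableEquality (Vec ℤ 16)
  _≟_ = Vecₚ.≡-dec ℤₚ._≟_

  infixr 8 _^_
  _^_ : Vec ℤ 16 → ℕ → Vec ℤ 16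
  _^_ = ℤζ-Powers._^_

  infixl 7 _*_
  _*_ : Vec ℤ 16 → Vec ℤ 16 → Vec ℤ 16
  _*_ = ℤζ._⊛_

  zeta : ℕ → Vec ℤ 16
  zeta zero    = ℤζ.𝟏
  zeta (suc n) = ℤζ.shift (zeta n)

  σℤ : ℕ → Vec ℤ 16 → Vec ℤ 16
  σℤ c = Horner.eval ℤₚ.+-*-commutativeRing ℤ[ζ] ℤζ.constant-hom (zeta c)

  productℤ : List (Vec ℤ 16) → Vec ℤ 16
  productℤ = List.foldr _*_ ℤζ.𝟏

  open Summation ℤ[ζ] using (∑)

  -- The discrete logarithms to base 86 of the inverses of 1 + 86⁵²⁺ˢ modulo 103.
  logTable : List ℕ
  logTable = 58 ∷ 89 ∷ 9 ∷ 66 ∷ 57 ∷ 35 ∷ 72 ∷ 44 ∷ 39 ∷ 6 ∷ 45 ∷ 24 ∷ 100 ∷ 64 ∷ 12 ∷ 77 ∷ 17 ∷ 55 ∷ 36 ∷ 65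
    ∷ 53 ∷ 47 ∷ 49 ∷ 15 ∷ 86 ∷ 73 ∷ 38 ∷ 30 ∷ 76 ∷ 95 ∷ 70 ∷ 71 ∷ 61 ∷ 37 ∷ 10 ∷ 98 ∷ 82 ∷ 88 ∷ 3 ∷ 13
    ∷ 69 ∷ 25 ∷ 41 ∷ 101 ∷ 97 ∷ 56 ∷ 84 ∷ 29 ∷ 81 ∷ 32 ∷ 46 ∷ 31 ∷ 79 ∷ 26 ∷ 80 ∷ 51 ∷ 91 ∷ 94 ∷ 33 ∷ 16
    ∷ 59 ∷ 2 ∷ 93 ∷ 75 ∷ 68 ∷ 83 ∷ 96 ∷ 20 ∷ 43 ∷ 52 ∷ 50 ∷ 74 ∷ 54 ∷ 7 ∷ 14 ∷ 48 ∷ 60 ∷ 90 ∷ 21 ∷ 18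
    ∷ 23 ∷ 34 ∷ 4 ∷ 22 ∷ 85 ∷ 42 ∷ 78 ∷ 27 ∷ 62 ∷ 87 ∷ 5 ∷ 67 ∷ 99 ∷ 1 ∷ 28 ∷ 92 ∷ 11 ∷ 19 ∷ 63 ∷ 40
    ∷ 8 ∷ []

  lookupOr0 : List ℕ → ℕ → ℕ
  lookupOr0 []       _       = 0
  lookupOr0 (a ∷ as) zero    = a
  lookupOr0 (a ∷ as) (suc n) = lookupOr0 as n

  jacobiExponent : ℕ → ℕ
  jacobiExponent = lookupOr0 logTable

  jacobiExponent-correct : ∀ {s} → s < 101 →
    (86 ℕ.^ jacobiExponent s ℕ.* (1 ℕ.+ 86 ℕ.^ (51 ℕ.+ suc s))) % 103 ≡ 1 % 103
  jacobiExponent-correct = from-yes (ℕₚ.allUpTo?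
    (λ s → (86 ℕ.^ jacobiExponent s ℕ.* (1 ℕ.+ 86 ℕ.^ (51 ℕ.+ suc s))) % 103 ℕₚ.≟ 1 % 103) 101)

  -- The second parameter is the exponent of the product: the two characters take the values ζᶜ⁻ᵇ
  -- and ζᵇ at 86. The offset 51 is the logarithm of -1, half of 102.
  jacobiℤ : ℕ → ℕ → Vec ℤ 16
  jacobiℤ b c = ∑ 101 (λ s → zeta ((b ℕ.* (51 ℕ.+ suc s) ℕ.+ c ℕ.* jacobiExponent s) % 34))

  geometricℤ : ℕ → Vec ℤ 16
  geometricℤ c = ∑ 102 (λ k → zeta ((c ℕ.* k) % 34))

  sq : Vec ℤ 16 → Vec ℤ 16
  sq x = x * x

  -- For a Gauss sum G(χ) with Jacobi sums given by G(χᵏ)² = jₖ G(χ²ᵏ), k = 1, 2, 4, 8,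
  -- and G(χ)G(χ¹⁶) = j₁₆ G(χ¹⁷), this is G(χ)³⁴; the constant is G(χ¹⁷)² = -103.
  gaussPower : (j₁ j₂ j₄ j₈ j₁₆ : Vec ℤ 16) → Vec ℤ 16
  gaussPower j₁ j₂ j₄ j₈ j₁₆ =
    sq (sq (sq (sq j₁ * j₂) * j₄) * j₈ * j₁₆) * ℤζ.constant -[1+ 102 ]

  -- The coefficients of 103¹⁵ α.
  α-coefficients : Vec ℤ 16
  α-coefficients = + 204918670121565729246942211148
    ∷ -[1+ 42370443109969870636435601363 ]
    ∷ -[1+ 209428278388851617831853330131 ]
    ∷ -[1+ 23471552736896389176733641731 ]
    ∷ + 503161705102118249261460607312
    ∷ + 448302472349578590260919420332
    ∷ -[1+ 138164666622795886857627766119 ]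
    ∷ -[1+ 279058454086448776611810314771 ]
    ∷ -[1+ 701406211909286462511512191555 ]
    ∷ -[1+ 91368773602553150478285799931 ]
    ∷ -[1+ 281429722861833089803826508182 ]
    ∷ -[1+ 132330805859052672417904474931 ]
    ∷ -[1+ 254866683790006167459524258155 ]
    ∷ + 122302662722439716238646033764
    ∷ -[1+ 944773899320493700633818958599 ]
    ∷ + 662894914117474089440581287700 ∷ []

  -- ζ₁₇ is ζ², so the exponents 2 and 9 of `π` are doubled.
  πℤ : Vec ℤ 16
  πℤ = zeta 0 ℤζ.⊕ zeta 4 ℤζ.⊕ zeta 18

  abstract
    -- Sealed, so that everything later rests on the identities decided in this block and never
    -- expands these large vectors.
    αℤ Dℤ ᾱℤ Bℤ B̄ℤ J₁ J₂ J₄ J₈ J₁₆ : Vec ℤ 16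
    αℤ = α-coefficients
    ᾱℤ = σℤ 33 αℤ
    Bℤ = productℤ (List.map (λ c → σℤ c πℤ) (9 ∷ 13 ∷ 15 ∷ 3 ∷ 11 ∷ 27 ∷ 29 ∷ 33 ∷ []))
    B̄ℤ = σℤ 33 Bℤ
    J₁ = jacobiℤ 1 2
    J₂ = jacobiℤ 2 4
    J₄ = jacobiℤ 4 8
    J₈ = jacobiℤ 8 16
    J₁₆ = jacobiℤ 1 17

    -- The exponent 15 is the largest coefficient in `τ`: the denominator of α is a product of
    -- distinct conjugates of π with exponents at most 15, and all conjugates of π together multiply
    -- to 103.
    D : ℕ
    D = 103 ℕ.^ 15

    D-def : D ≡ 103 ℕ.^ 15
    D-def = ≡.refl

    Dℤ = ℤζ.constant (+ D)

    Dℤ-def : Dℤ ≡ ℤζ.constant (+ D)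
    Dℤ-def = from-yes (Dℤ ≟ ℤζ.constant (+ D))

    αℤ-def : α-coefficients ≡ αℤ
    αℤ-def = from-yes (α-coefficients ≟ αℤ)

    conj-α : σℤ 33 αℤ ≡ ᾱℤ
    conj-α = from-yes (σℤ 33 αℤ ≟ ᾱℤ)

    J₁-def : J₁ ≡ jacobiℤ 1 2
    J₁-def = from-yes (J₁ ≟ jacobiℤ 1 2)

    J₂-def : J₂ ≡ jacobiℤ 2 4
    J₂-def = from-yes (J₂ ≟ jacobiℤ 2 4)

    J₄-def : J₄ ≡ jacobiℤ 4 8
    J₄-def = from-yes (J₄ ≟ jacobiℤ 4 8)

    J₈-def : J₈ ≡ jacobiℤ 8 16
    J₈-def = from-yes (J₈ ≟ jacobiℤ 8 16)

    J₁₆-def : J₁₆ ≡ jacobiℤ 1 17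
    J₁₆-def = from-yes (J₁₆ ≟ jacobiℤ 1 17)

    α-ᾱ : αℤ * ᾱℤ ≡ Dℤ * Dℤ
    α-ᾱ = from-yes (αℤ * ᾱℤ ≟ Dℤ * Dℤ)

    B-B̄ : Bℤ * B̄ℤ ≡ ℤζ.constant (+ 103)
    B-B̄ = from-yes (Bℤ * B̄ℤ ≟ ℤζ.constant (+ 103))

    -- Stickelberger's factorisation of G³⁴ with its root of unity made explicit, after clearing the
    -- denominator of α.
    α-gauss : αℤ * Bℤ ^ 34 ≡ Dℤ * (zeta 21 * gaussPower J₁ J₂ J₄ J₈ J₁₆)
    α-gauss = from-yes (αℤ * Bℤ ^ 34 ≟ Dℤ * (zeta 21 * gaussPower J₁ J₂ J₄ J₈ J₁₆))

  -- The equation that lets ζ ↦ ζᶜ extend to an endomorphism. Among the indices checked below, 3 to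
  -- 15 give the conjugates in the statement and 33 is complex conjugation.
  record Root (c : ℕ) : Set where
    constructor is-root
    field equation : zeta c ^ 16 ≡ σℤ c (alternatingℤ 16 ℤ.-1ℤ)

  abstract
    roots : All Root (3 ∷ 5 ∷ 7 ∷ 9 ∷ 11 ∷ 13 ∷ 15 ∷ 33 ∷ [])
    roots = All.map is-root (from-yes (All.all? (λ c → zeta c ^ 16 ≟ σℤ c (alternatingℤ 16 ℤ.-1ℤ))
      (3 ∷ 5 ∷ 7 ∷ 9 ∷ 11 ∷ 13 ∷ 15 ∷ 33 ∷ [])))

  zeta-34 : zeta 34 ≡ ℤζ.𝟏
  zeta-34 = ≡.refl

  -- The 102 terms run three times through all powers of a 34th root of unity other than 1, so the
  -- correction term of `gauss-*` disappears for these characters.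
  geometric-vanishes : All (λ c → geometricℤ c ≡ ℤζ.𝟎) (2 ∷ 4 ∷ 8 ∷ 16 ∷ 17 ∷ [])
  geometric-vanishes = from-yes (All.all? (λ c → geometricℤ c ≟ ℤζ.𝟎) (2 ∷ 4 ∷ 8 ∷ 16 ∷ 17 ∷ []))

  -- As 3 generates the units modulo 34, the sum is the trace of ζᵉ.
  trace-rational : ∀ {e} → e < 34 → ∑ 16 (λ i → zeta ((3 ℕ.^ i ℕ.* e) % 34)) ≡
    ℤζ.constant (Vec.head (∑ 16 (λ i → zeta ((3 ℕ.^ i ℕ.* e) % 34))))
  trace-rational = from-yes (ℕₚ.allUpTo? (λ e → ∑ 16 (λ i → zeta ((3 ℕ.^ i ℕ.* e) % 34)) ≟
    ℤζ.constant (Vec.head (∑ 16 (λ i → zeta ((3 ℕ.^ i ℕ.* e) % 34))))) 34)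

  -- ζᶜⁿ + ζ⁻ᶜⁿ for the indices c of the statement.
  conjugates : ℕ → List (Vec ℤ 16)
  conjugates n = List.map (λ c → zeta ((c ℕ.* n) % 34) ℤζ.⊕ zeta ((c ℕ.* (33 ℕ.* n)) % 34))
    (1 ∷ 3 ∷ 5 ∷ 7 ∷ 9 ∷ 11 ∷ 13 ∷ 15 ∷ [])

  -- Multiplication of a generating polynomial by 1 + xT. The coefficient `e` preceding the list is
  -- carried along, which is why `esyms` starts with the first symmetric function and leaves the
  -- constant coefficient 1 implicit.
  multiplyLinear : Vec ℤ 16 → Vec ℤ 16 → List (Vec ℤ 16) → List (Vec ℤ 16)
  multiplyLinear x e []       = x * e ∷ []
  multiplyLinear x e (f ∷ fs) = (x * e ℤζ.⊕ f) ∷ multiplyLinear x f fs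

  esyms : List (Vec ℤ 16) → List (Vec ℤ 16)
  esyms []       = []
  esyms (x ∷ xs) = multiplyLinear x ℤζ.𝟏 (esyms xs)

  infix 4 _≟s_
  _≟s_ : DecidableEquality (List (Vec ℤ 16))
  _≟s_ = Listₚ.≡-dec _≟_

  -- The residues of M modulo 103 in condition (i) are 86⁶⁴ and 86⁸⁸; the exponents
  -- in esyms-odd belong to condition (ii).
  esyms-even : All (λ n → esyms (conjugates n) ≡ List.map ℤζ.constant
    (-[1+ 0 ] ∷ -[1+ 6 ] ∷ + 6 ∷ + 15 ∷ -[1+ 9 ] ∷ -[1+ 9 ] ∷ + 4 ∷ + 1 ∷ [])) (64 ∷ 88 ∷ [])
  esyms-even = from-yes (All.all? (λ n → esyms (conjugates n) ≟s List.map ℤζ.constant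
    (-[1+ 0 ] ∷ -[1+ 6 ] ∷ + 6 ∷ + 15 ∷ -[1+ 9 ] ∷ -[1+ 9 ] ∷ + 4 ∷ + 1 ∷ [])) (64 ∷ 88 ∷ []))

  esyms-odd : All (λ n → esyms (conjugates n) ≡ List.map ℤζ.constant
    (+ 1 ∷ -[1+ 6 ] ∷ -[1+ 5 ] ∷ + 15 ∷ + 10 ∷ -[1+ 9 ] ∷ -[1+ 3 ] ∷ + 1 ∷ [])) (11 ∷ 9 ∷ 5 ∷ 39 ∷ 99 ∷ 93 ∷ [])
  esyms-odd = from-yes (All.all? (λ n → esyms (conjugates n) ≟s List.map ℤζ.constant
    (+ 1 ∷ -[1+ 6 ] ∷ -[1+ 5 ] ∷ + 15 ∷ + 10 ∷ -[1+ 9 ] ∷ -[1+ 3 ] ∷ + 1 ∷ [])) (11 ∷ 9 ∷ 5 ∷ 39 ∷ 99 ∷ 93 ∷ []))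

  -- The square of the Gauss sum of the quadratic character, whose Jacobi sum
  -- multiplies the trivial Gauss sum -1.
  quadratic-gauss : (ℤζ.⊝ jacobiℤ 17 0) ℤζ.⊕ (zeta 17 * geometricℤ 0) ≡ ℤζ.constant -[1+ 102 ]
  quadratic-gauss = from-yes ((ℤζ.⊝ jacobiℤ 17 0) ℤζ.⊕ (zeta 17 * geometricℤ 0) ≟ ℤζ.constant -[1+ 102 ])

open Z34 using (ℤ[ζ]; zeta; σℤ; module ℤζ)

-- Localisation and reduction modulo p.

coprime-* : ∀ {d e p} → Coprime d p → Coprime e p → Coprime (d ℕ.* e) p
coprime-* {d} {e} {p} d⊥p e⊥p {k} (k∣de , k∣p) = e⊥p (Coprimality.coprime-divisor k⊥d k∣de , k∣p)
  where
  k⊥d : Coprime k d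
  k⊥d (i∣k , i∣d) = d⊥p (i∣d , ∣.∣-trans i∣k k∣p)

-- The ring {x ∈ R | d x ∈ ψ(A) for some d prime to p}, modulo p.
module Localised {a b ℓ ℓ′} (A : CommutativeRing a ℓ) (R : CommutativeRing b ℓ′)
  {ψ : CommutativeRing.Carrier A → CommutativeRing.Carrier R} (ψ-hom : Hom A R ψ) (p : ℕ) where
  private
    module A = CommutativeRing A
    module ψ = IsRingHomomorphism ψ-hom
  open CommutativeRing R
  open Mult semiring using () renaming (_×_ to _·_)
  open Mult A.semiring using () renaming (_×_ to _·ᴬ_)
  open Powers R using (×≈×1*)
  open RingProperties ring using (-‿distribʳ-*)
  open SetoidReasoning setoid

  ψ-· : ∀ n v → ψ (n ·ᴬ v) ≈ n · ψ v
  ψ-· zero v = ψ.0#-homo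
  ψ-· (suc n) v = trans (ψ.+-homo v _) (+-congˡ (ψ-· n v))

  Integral : Carrier → Set _
  Integral x = ∃[ d ] Coprime d p × ∃[ v ] d · x ≈ ψ v

  integral-resp : ∀ {x y} → x ≈ y → Integral x → Integral y
  integral-resp x≈y (d , d⊥p , v , eq) = d , d⊥p , v , trans (Mult.×-congʳ semiring d (sym x≈y)) eq

  private
    ·-* : ∀ d e x y → (d ℕ.* e) · (x * y) ≈ (d · x) * (e · y)
    ·-* d e x y = begin
      (d ℕ.* e) · (x * y)  ≈⟨ MonoidMult.×-assocˡ +-monoid (x * y) d e ⟨
      d · (e · (x * y))    ≈⟨ Mult.×-congʳ semiring d (Mult.×-comm-* semiring e x y) ⟨
      d · (x * (e · y))    ≈⟨ Mult.×-assoc-* semiring d x (e · y) ⟨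
      (d · x) * (e · y)    ∎

    ·-swap : ∀ d e x → (d ℕ.* e) · x ≈ e · (d · x)
    ·-swap d e x = trans (reflexive (≡.cong (_· x) (ℕₚ.*-comm d e))) (sym (MonoidMult.×-assocˡ +-monoid x e d))

    ·-neg : ∀ n x → n · (- x) ≈ - (n · x)
    ·-neg n x = begin
      n · (- x)          ≈⟨ ×≈×1* n (- x) ⟩
      (n · 1#) * (- x)   ≈⟨ -‿distribʳ-* _ x ⟨
      - ((n · 1#) * x)   ≈⟨ -‿cong (×≈×1* n x) ⟨
      - (n · x)          ∎

  integral-ψ : ∀ v → Integral (ψ v)
  integral-ψ v = 1 , Coprimality.1-coprimeTo p , v , MonoidMult.×-homo-1 +-monoid (ψ v)

  integral-0 : Integral 0#
  integral-0 = integral-resp ψ.0#-homo (integral-ψ A.0#)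

  integral-1 : Integral 1#
  integral-1 = integral-resp ψ.1#-homo (integral-ψ A.1#)

  integral-+ : ∀ {x y} → Integral x → Integral y → Integral (x + y)
  integral-+ {x} {y} (d , d⊥p , v , dx) (e , e⊥p , w , ey) =
    d ℕ.* e , coprime-* d⊥p e⊥p , (e ·ᴬ v) A.+ (d ·ᴬ w) , (begin
      (d ℕ.* e) · (x + y)
        ≈⟨ CommutativeMult.×-distrib-+ +-commutativeMonoid x y (d ℕ.* e) ⟩
      (d ℕ.* e) · x + (d ℕ.* e) · y
        ≈⟨ +-cong (·-swap d e x) (sym (MonoidMult.×-assocˡ +-monoid y d e)) ⟩
      e · (d · x) + d · (e · y)
        ≈⟨ +-cong (Mult.×-congʳ semiring e dx) (Mult.×-congʳ semiring d ey) ⟩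
      e · ψ v + d · ψ w
        ≈⟨ +-cong (ψ-· e v) (ψ-· d w) ⟨
      ψ (e ·ᴬ v) + ψ (d ·ᴬ w)
        ≈⟨ ψ.+-homo _ _ ⟨
      ψ ((e ·ᴬ v) A.+ (d ·ᴬ w)) ∎)

  integral-* : ∀ {x y} → Integral x → Integral y → Integral (x * y)
  integral-* {x} {y} (d , d⊥p , v , dx) (e , e⊥p , w , ey) =
    d ℕ.* e , coprime-* d⊥p e⊥p , v A.* w ,
    trans (·-* d e x y) (trans (*-cong dx ey) (sym (ψ.*-homo v w)))

  integral-neg : ∀ {x} → Integral x → Integral (- x)
  integral-neg {x} (d , d⊥p , v , dx) =
    d , d⊥p , A.- v , trans (·-neg d x) (trans (-‿cong dx) (sym (ψ.-‿homo v)))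

  Element : Set _
  Element = Σ[ x ∈ Carrier ] Integral x

  infix 4 _≋_
  -- In a field of characteristic zero every element is a multiple of p; the relation has content
  -- because the quotient must itself have a denominator prime to p.
  record _≋_ (x y : Element) : Set (a Level.⊔ b Level.⊔ ℓ′) where
    constructor difference
    field
      quotient : Carrier
      integral : Integral quotient
      equation : proj₁ x ≈ proj₁ y + p · quotient

  private
    p·0 : p · 0# ≈ 0#
    p·0 = trans (×≈×1* p 0#) (zeroʳ _)

    ·-+ : ∀ x y → p · (x + y) ≈ p · x + p · y
    ·-+ x y = CommutativeMult.×-distrib-+ +-commutativeMonoid x y p

  ≈⇒≋ : ∀ {x y : Element} → proj₁ x ≈ proj₁ y → x ≋ y
  ≈⇒≋ {x , _} {y , _} x≈y = difference 0# integral-0 (trans x≈y (trans (sym (+-identityʳ y)) (+-congˡ (sym p·0))))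

  ≋-sym : ∀ {x y} → x ≋ y → y ≋ x
  ≋-sym {x , _} {y , _} (difference t it eq) = difference (- t) (integral-neg it) (begin
    y                        ≈⟨ +-identityʳ y ⟨
    y + 0#                   ≈⟨ +-congˡ (-‿inverseʳ (p · t)) ⟨
    y + (p · t - p · t)      ≈⟨ +-assoc y _ _ ⟨
    (y + p · t) - p · t      ≈⟨ +-cong (sym eq) (sym (·-neg p t)) ⟩
    x + p · (- t)            ∎)

  ≋-trans : ∀ {x y z} → x ≋ y → y ≋ z → x ≋ z
  ≋-trans {x , _} {y , _} {z , _} (difference t it eq) (difference s is eq′) = difference (s + t) (integral-+ is it) (begin
    x                        ≈⟨ trans eq (+-congʳ eq′) ⟩
    (z + p · s) + p · t      ≈⟨ +-assoc z _ _ ⟩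
    z + (p · s + p · t)      ≈⟨ +-congˡ (·-+ s t) ⟨
    z + p · (s + t)          ∎)

  localised : CommutativeRing _ _
  localised = record
    { Carrier = Element
    ; _≈_ = _≋_
    ; _+_ = λ (x , ix) (y , iy) → x + y , integral-+ ix iy
    ; _*_ = λ (x , ix) (y , iy) → x * y , integral-* ix iy
    ; -_ = λ (x , ix) → - x , integral-neg ix
    ; 0# = 0# , integral-0
    ; 1# = 1# , integral-1
    ; isCommutativeRing = record
      { isRing = record
        { +-isAbelianGroup = record
          { isGroup = record
            { isMonoid = record
              { isSemigroup = record
                { isMagma = record
                  { isEquivalence = record
                    { refl = ≈⇒≋ refl
                    ; sym = λ {x} {y} → ≋-sym {x} {y}
                    ; trans = λ {x} {y} {z} → ≋-trans {x} {y} {z} }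
                  ; ∙-cong = λ {x} {y} {u} {v} → plus-cong {x} {y} {u} {v} }
                ; assoc = λ _ _ _ → ≈⇒≋ (+-assoc _ _ _) }
              ; identity = (λ _ → ≈⇒≋ (+-identityˡ _)) , (λ _ → ≈⇒≋ (+-identityʳ _)) }
            ; inverse = (λ _ → ≈⇒≋ (-‿inverseˡ _)) , (λ _ → ≈⇒≋ (-‿inverseʳ _))
            ; ⁻¹-cong = λ {x} {y} → neg-cong {x} {y} }
          ; comm = λ _ _ → ≈⇒≋ (+-comm _ _) }
        ; *-cong = λ {x} {y} {u} {v} → times-cong {x} {y} {u} {v}
        ; *-assoc = λ _ _ _ → ≈⇒≋ (*-assoc _ _ _)
        ; *-identity = (λ _ → ≈⇒≋ (*-identityˡ _)) , (λ _ → ≈⇒≋ (*-identityʳ _))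
        ; distrib = (λ _ _ _ → ≈⇒≋ (distribˡ _ _ _)) , (λ _ _ _ → ≈⇒≋ (distribʳ _ _ _)) }
      ; *-comm = λ _ _ → ≈⇒≋ (*-comm _ _) }
    }
    where
    plus-cong : ∀ {x y u v : Element} → x ≋ y → u ≋ v →
      (proj₁ x + proj₁ u , integral-+ (proj₂ x) (proj₂ u)) ≋ (proj₁ y + proj₁ v , integral-+ (proj₂ y) (proj₂ v))
    plus-cong {x , _} {y , _} {u , _} {v , _} (difference t it eq) (difference s is eq′) = difference (t + s) (integral-+ it is) (begin
      x + u                        ≈⟨ +-cong eq eq′ ⟩
      (y + p · t) + (v + p · s)    ≈⟨ interchange _ _ _ _ ⟩
      (y + v) + (p · t + p · s)    ≈⟨ +-congˡ (·-+ t s) ⟨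
      (y + v) + p · (t + s)        ∎)
      where open CommutativeSemigroupProperties +-commutativeSemigroup using (interchange)
    neg-cong : ∀ {x y : Element} → x ≋ y →
      (- proj₁ x , integral-neg (proj₂ x)) ≋ (- proj₁ y , integral-neg (proj₂ y))
    neg-cong {x , _} {y , _} (difference t it eq) = difference (- t) (integral-neg it) (begin
      - x              ≈⟨ -‿cong eq ⟩
      - (y + p · t)    ≈⟨ AbelianGroupProperties.⁻¹-∙-comm +-abelianGroup y _ ⟨
      - y - p · t      ≈⟨ +-congˡ (·-neg p t) ⟨
      - y + p · (- t)  ∎)
    times-cong : ∀ {x y u v : Element} → x ≋ y → u ≋ v →
      (proj₁ x * proj₁ u , integral-* (proj₂ x) (proj₂ u)) ≋ (proj₁ y * proj₁ v , integral-* (proj₂ y) (proj₂ v))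
    times-cong {x , _} {y , iy} {u , iu} {v , _} (difference t it eq) (difference s is eq′) =
      difference (y * s + t * u) (integral-+ (integral-* iy is) (integral-* it iu)) (begin
      x * u                                ≈⟨ *-congʳ eq ⟩
      (y + p · t) * u                      ≈⟨ distribʳ u _ _ ⟩
      y * u + (p · t) * u                  ≈⟨ +-cong (trans (*-congˡ eq′) (distribˡ y v _)) (Mult.×-assoc-* semiring p t u) ⟩
      (y * v + y * (p · s)) + p · (t * u)  ≈⟨ +-congʳ (+-congˡ (Mult.×-comm-* semiring p y s)) ⟩
      (y * v + p · (y * s)) + p · (t * u)  ≈⟨ +-assoc _ _ _ ⟩
      y * v + (p · (y * s) + p · (t * u))  ≈⟨ +-congˡ (·-+ _ _) ⟨
      y * v + p · (y * s + t * u)          ∎)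

  private module L = CommutativeRing localised
  open Mult L.semiring using () renaming (_×_ to _·ᴸ_)

  ψᴸ : A.Carrier → Element
  ψᴸ v = ψ v , integral-ψ v

  ψᴸ-hom : Hom A localised ψᴸ
  ψᴸ-hom = mkHom A localised ψᴸ (λ eq → ≈⇒≋ (ψ.⟦⟧-cong eq))
    (λ v w → ≈⇒≋ (ψ.+-homo v w)) (λ v w → ≈⇒≋ (ψ.*-homo v w)) (≈⇒≋ ψ.1#-homo)

  ·ᴸ-proj₁ : ∀ n x → proj₁ (n ·ᴸ x) ≈ n · proj₁ x
  ·ᴸ-proj₁ zero x = refl
  ·ᴸ-proj₁ (suc n) x = +-congˡ (·ᴸ-proj₁ n x)

  characteristic : p ·ᴸ L.1# ≋ L.0#
  characteristic = difference 1# integral-1 (trans (·ᴸ-proj₁ p L.1#) (sym (+-identityˡ _)))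

  open Powers localised using () renaming (_^_ to _^ᴸ_)
  open Powers R using (_^_)

  ^ᴸ-proj₁ : ∀ x n → proj₁ (x ^ᴸ n) ≈ proj₁ x ^ n
  ^ᴸ-proj₁ x zero = refl
  ^ᴸ-proj₁ x (suc n) = *-congˡ (^ᴸ-proj₁ x n)

-- The cyclotomic polynomial Φ₁₇ and the minimal polynomial of ζ₁₇ + ζ₁₇⁻¹.

module Cyclotomic {a ℓ} (R : CommutativeRing a ℓ) where
  open CommutativeRing R
  open Powers R using (_^_; ^-congˡ)
  open OptimisedMult semiring using () renaming (_×_ to _·_)
  open RingProperties ring using (+-cancelˡ; +-cancelʳ)
  open NaturalCoefficients commutativeSemiring using (solve; _:=_; _:+_; _:*_; _:^_; con; Polynomial)
  open SetoidReasoning setoid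

  private
    n̂ : ℕ → Carrier
    n̂ n = n · 1#

    evenₚ oddₚ Φ₁₇ₚ : ∀ {n} → Polynomial n → Polynomial n
    evenₚ y = con 1 :+ y :^ 2 :+ y :^ 4 :+ y :^ 6 :+ y :^ 8 :+ y :^ 10 :+ y :^ 12 :+ y :^ 14 :+ y :^ 16
    oddₚ y = y :+ y :^ 3 :+ y :^ 5 :+ y :^ 7 :+ y :^ 9 :+ y :^ 11 :+ y :^ 13 :+ y :^ 15
    Φ₁₇ₚ y = evenₚ y :+ oddₚ y

  -- The split by parity treats Φ₁₇(y) and Φ₁₇(-y) = Φ₃₄(y) together: they are the sum and the
  -- difference of the two parts. Signs are avoided throughout, negative terms standing on the other
  -- side, because the identities are normalised over commutative semirings.
  even odd Φ₁₇ : Carrier → Carrier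
  even y = n̂ 1 + y ^ 2 + y ^ 4 + y ^ 6 + y ^ 8 + y ^ 10 + y ^ 12 + y ^ 14 + y ^ 16
  odd y = y + y ^ 3 + y ^ 5 + y ^ 7 + y ^ 9 + y ^ 11 + y ^ 13 + y ^ 15
  Φ₁₇ y = even y + odd y

  -- This is Φ₁₇(y)Φ₁₇(-y) = Φ₁₇(y²) with the square of the odd part moved across.
  even²≈ : ∀ y → even y * even y ≈ Φ₁₇ (y ^ 2) + odd y * odd y
  even²≈ = solve 1 (λ y → evenₚ y :* evenₚ y := Φ₁₇ₚ (y :^ 2) :+ oddₚ y :* oddₚ y) refl

  Φ₁₇-^17 : ∀ {z} → Φ₁₇ z ≈ 0# → z ^ 17 ≈ 1#
  Φ₁₇-^17 {z} eq = +-cancelˡ (Φ₁₇ z) _ _ (begin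
    Φ₁₇ z + z ^ 17     ≈⟨ solve 1 (λ z → Φ₁₇ₚ z :+ z :^ 17 := z :* Φ₁₇ₚ z :+ con 1) refl z ⟩
    z * Φ₁₇ z + n̂ 1    ≈⟨ +-congʳ (trans (*-congˡ eq) (trans (zeroʳ z) (sym eq))) ⟩
    Φ₁₇ z + 1#         ∎)

  Φ₁₇-1 : ∀ {z} → z ≈ 1# → Φ₁₇ z ≈ n̂ 17
  Φ₁₇-1 {z} eq = trans (Φ-cong eq) (solve 0 (Φ₁₇ₚ (con 1) := con 17) refl)
    where
    Φ-cong : ∀ {y z} → y ≈ z → Φ₁₇ y ≈ Φ₁₇ z
    Φ-cong p = +-cong
      (+-cong (+-cong (+-cong (+-cong (+-cong (+-cong (+-cong (+-congˡ (^-congˡ 2 p)) (^-congˡ 4 p)) (^-congˡ 6 p))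
        (^-congˡ 8 p)) (^-congˡ 10 p)) (^-congˡ 12 p)) (^-congˡ 14 p)) (^-congˡ 16 p))
      (+-cong (+-cong (+-cong (+-cong (+-cong (+-cong (+-cong p (^-congˡ 3 p)) (^-congˡ 5 p)) (^-congˡ 7 p))
        (^-congˡ 9 p)) (^-congˡ 11 p)) (^-congˡ 13 p)) (^-congˡ 15 p))

  -- The odd and even parts of ∏ (x - xᵢ) for x = x₁, with aⱼ the elementary
  -- symmetric functions of x₂, …, x₈.
  vieta : ∀ x a₁ a₂ a₃ a₄ a₅ a₆ a₇ →
    x ^ 8 + (x * a₁ + a₂) * x ^ 6 + (x * a₃ + a₄) * x ^ 4 + (x * a₅ + a₆) * x ^ 2 + x * a₇ ≈
    (x + a₁) * x ^ 7 + (x * a₂ + a₃) * x ^ 5 + (x * a₄ + a₅) * x ^ 3 + (x * a₆ + a₇) * x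
  vieta = solve 8 (λ x a₁ a₂ a₃ a₄ a₅ a₆ a₇ →
    x :^ 8 :+ (x :* a₁ :+ a₂) :* x :^ 6 :+ (x :* a₃ :+ a₄) :* x :^ 4 :+ (x :* a₅ :+ a₆) :* x :^ 2 :+ x :* a₇ :=
    (x :+ a₁) :* x :^ 7 :+ (x :* a₂ :+ a₃) :* x :^ 5 :+ (x :* a₄ :+ a₅) :* x :^ 3 :+ (x :* a₆ :+ a₇) :* x) refl

  module _ {x e₁ e₂ e₃ e₄ e₅ e₆ e₇ e₈ : Carrier}
    (root : x ^ 8 + e₂ * x ^ 6 + e₄ * x ^ 4 + e₆ * x ^ 2 + e₈ ≈ e₁ * x ^ 7 + e₃ * x ^ 5 + e₅ * x ^ 3 + e₇ * x)
    (e₂≈ : e₂ + n̂ 7 ≈ 0#) (e₄≈ : e₄ ≈ n̂ 15) (e₆≈ : e₆ + n̂ 10 ≈ 0#) (e₈≈ : e₈ ≈ n̂ 1) where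

    -- Inserting the values of condition (i) turns the relation into the vanishing at x of x⁸ + x⁷ -
    -- 7x⁶ - 6x⁵ + 15x⁴ + 10x³ - 10x² - 4x + 1, the minimal polynomial of ζ₁₇ + ζ₁₇⁻¹.
    minimal⁺ : e₁ + n̂ 1 ≈ 0# → e₃ ≈ n̂ 6 → e₅ + n̂ 10 ≈ 0# → e₇ ≈ n̂ 4 →
      x ^ 8 + x ^ 7 + n̂ 15 * x ^ 4 + n̂ 10 * x ^ 3 + n̂ 1 ≈ n̂ 7 * x ^ 6 + n̂ 6 * x ^ 5 + n̂ 10 * x ^ 2 + n̂ 4 * x
    minimal⁺ e₁≈ e₃≈ e₅≈ e₇≈ = begin
      x ^ 8 + x ^ 7 + n̂ 15 * x ^ 4 + n̂ 10 * x ^ 3 + n̂ 1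
        ≈⟨ +-identityʳ _ ⟨
      (x ^ 8 + x ^ 7 + n̂ 15 * x ^ 4 + n̂ 10 * x ^ 3 + n̂ 1) + 0#
        ≈⟨ +-cong (+-cong (+-congʳ (+-congˡ (*-congʳ (sym e₄≈)))) (sym e₈≈))
             (sym (trans (+-cong (trans (*-congʳ e₂≈) (zeroˡ _)) (trans (*-congʳ e₆≈) (zeroˡ _))) (+-identityˡ 0#))) ⟩
      (x ^ 8 + x ^ 7 + e₄ * x ^ 4 + n̂ 10 * x ^ 3 + e₈) + ((e₂ + n̂ 7) * x ^ 6 + (e₆ + n̂ 10) * x ^ 2)
        ≈⟨ solve 5 (λ x e₂ e₄ e₆ e₈ →
             (x :^ 8 :+ x :^ 7 :+ e₄ :* x :^ 4 :+ con 10 :* x :^ 3 :+ e₈) :+ ((e₂ :+ con 7) :* x :^ 6 :+ (e₆ :+ con 10) :* x :^ 2) :=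
             (x :^ 8 :+ e₂ :* x :^ 6 :+ e₄ :* x :^ 4 :+ e₆ :* x :^ 2 :+ e₈) :+ (x :^ 7 :+ con 10 :* x :^ 3 :+ con 7 :* x :^ 6 :+ con 10 :* x :^ 2))
             refl x e₂ e₄ e₆ e₈ ⟩
      (x ^ 8 + e₂ * x ^ 6 + e₄ * x ^ 4 + e₆ * x ^ 2 + e₈) + (x ^ 7 + n̂ 10 * x ^ 3 + n̂ 7 * x ^ 6 + n̂ 10 * x ^ 2)
        ≈⟨ +-congʳ root ⟩
      (e₁ * x ^ 7 + e₃ * x ^ 5 + e₅ * x ^ 3 + e₇ * x) + (x ^ 7 + n̂ 10 * x ^ 3 + n̂ 7 * x ^ 6 + n̂ 10 * x ^ 2)
        ≈⟨ solve 5 (λ x e₁ e₃ e₅ e₇ →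
             (e₁ :* x :^ 7 :+ e₃ :* x :^ 5 :+ e₅ :* x :^ 3 :+ e₇ :* x) :+ (x :^ 7 :+ con 10 :* x :^ 3 :+ con 7 :* x :^ 6 :+ con 10 :* x :^ 2) :=
             (con 7 :* x :^ 6 :+ e₃ :* x :^ 5 :+ con 10 :* x :^ 2 :+ e₇ :* x) :+ ((e₁ :+ con 1) :* x :^ 7 :+ (e₅ :+ con 10) :* x :^ 3))
             refl x e₁ e₃ e₅ e₇ ⟩
      (n̂ 7 * x ^ 6 + e₃ * x ^ 5 + n̂ 10 * x ^ 2 + e₇ * x) + ((e₁ + n̂ 1) * x ^ 7 + (e₅ + n̂ 10) * x ^ 3)
        ≈⟨ +-cong (+-cong (+-congʳ (+-congˡ (*-congʳ e₃≈))) (*-congʳ e₇≈))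
             (trans (+-cong (trans (*-congʳ e₁≈) (zeroˡ _)) (trans (*-congʳ e₅≈) (zeroˡ _))) (+-identityˡ 0#)) ⟩
      (n̂ 7 * x ^ 6 + n̂ 6 * x ^ 5 + n̂ 10 * x ^ 2 + n̂ 4 * x) + 0#
        ≈⟨ +-identityʳ _ ⟩
      n̂ 7 * x ^ 6 + n̂ 6 * x ^ 5 + n̂ 10 * x ^ 2 + n̂ 4 * x ∎

    -- The values of condition (ii) give the same polynomial at -x, that is, the minimal polynomial
    -- of ζ₃₄ + ζ₃₄⁻¹.
    minimal⁻ : e₁ ≈ n̂ 1 → e₃ + n̂ 6 ≈ 0# → e₅ ≈ n̂ 10 → e₇ + n̂ 4 ≈ 0# →
      x ^ 8 + n̂ 6 * x ^ 5 + n̂ 15 * x ^ 4 + n̂ 4 * x + n̂ 1 ≈ x ^ 7 + n̂ 7 * x ^ 6 + n̂ 10 * x ^ 3 + n̂ 10 * x ^ 2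
    minimal⁻ e₁≈ e₃≈ e₅≈ e₇≈ = begin
      x ^ 8 + n̂ 6 * x ^ 5 + n̂ 15 * x ^ 4 + n̂ 4 * x + n̂ 1
        ≈⟨ +-identityʳ _ ⟨
      (x ^ 8 + n̂ 6 * x ^ 5 + n̂ 15 * x ^ 4 + n̂ 4 * x + n̂ 1) + 0#
        ≈⟨ +-cong (+-cong (+-congʳ (+-congˡ (*-congʳ (sym e₄≈)))) (sym e₈≈))
             (sym (trans (+-cong (trans (*-congʳ e₂≈) (zeroˡ _)) (trans (*-congʳ e₆≈) (zeroˡ _))) (+-identityˡ 0#))) ⟩
      (x ^ 8 + n̂ 6 * x ^ 5 + e₄ * x ^ 4 + n̂ 4 * x + e₈) + ((e₂ + n̂ 7) * x ^ 6 + (e₆ + n̂ 10) * x ^ 2)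
        ≈⟨ solve 5 (λ x e₂ e₄ e₆ e₈ →
             (x :^ 8 :+ con 6 :* x :^ 5 :+ e₄ :* x :^ 4 :+ con 4 :* x :+ e₈) :+ ((e₂ :+ con 7) :* x :^ 6 :+ (e₆ :+ con 10) :* x :^ 2) :=
             (x :^ 8 :+ e₂ :* x :^ 6 :+ e₄ :* x :^ 4 :+ e₆ :* x :^ 2 :+ e₈) :+ (con 6 :* x :^ 5 :+ con 4 :* x :+ con 7 :* x :^ 6 :+ con 10 :* x :^ 2))
             refl x e₂ e₄ e₆ e₈ ⟩
      (x ^ 8 + e₂ * x ^ 6 + e₄ * x ^ 4 + e₆ * x ^ 2 + e₈) + (n̂ 6 * x ^ 5 + n̂ 4 * x + n̂ 7 * x ^ 6 + n̂ 10 * x ^ 2)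
        ≈⟨ +-congʳ root ⟩
      (e₁ * x ^ 7 + e₃ * x ^ 5 + e₅ * x ^ 3 + e₇ * x) + (n̂ 6 * x ^ 5 + n̂ 4 * x + n̂ 7 * x ^ 6 + n̂ 10 * x ^ 2)
        ≈⟨ solve 5 (λ x e₁ e₃ e₅ e₇ →
             (e₁ :* x :^ 7 :+ e₃ :* x :^ 5 :+ e₅ :* x :^ 3 :+ e₇ :* x) :+ (con 6 :* x :^ 5 :+ con 4 :* x :+ con 7 :* x :^ 6 :+ con 10 :* x :^ 2) :=
             (e₁ :* x :^ 7 :+ con 7 :* x :^ 6 :+ e₅ :* x :^ 3 :+ con 10 :* x :^ 2) :+ ((e₃ :+ con 6) :* x :^ 5 :+ (e₇ :+ con 4) :* x))
             refl x e₁ e₃ e₅ e₇ ⟩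
      (e₁ * x ^ 7 + n̂ 7 * x ^ 6 + e₅ * x ^ 3 + n̂ 10 * x ^ 2) + ((e₃ + n̂ 6) * x ^ 5 + (e₇ + n̂ 4) * x)
        ≈⟨ +-cong (+-congʳ (+-cong (+-congʳ (trans (*-congʳ e₁≈) (*-identityˡ _))) (*-congʳ e₅≈)))
             (trans (+-cong (trans (*-congʳ e₃≈) (zeroˡ _)) (trans (*-congʳ e₇≈) (zeroˡ _))) (+-identityˡ 0#)) ⟩
      (x ^ 7 + n̂ 7 * x ^ 6 + n̂ 10 * x ^ 3 + n̂ 10 * x ^ 2) + 0#
        ≈⟨ +-identityʳ _ ⟩
      x ^ 7 + n̂ 7 * x ^ 6 + n̂ 10 * x ^ 3 + n̂ 10 * x ^ 2 ∎

  module _ {y y′ : Carrier} (yy′ : y * y′ ≈ 1#) where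

    private
      x = y + y′

      yx : y * x ≈ y * y + n̂ 1
      yx = trans (distribˡ y y y′) (+-congˡ yy′)

      -- y⁸ times a polynomial in y + y⁻¹ is a polynomial in y and y(y + y⁻¹) = y² + 1.
      pos⁺ neg⁺ pos⁻ neg⁻ : Carrier → Carrier → Carrier
      pos⁺ y v = v ^ 8 + y * v ^ 7 + n̂ 15 * (y ^ 4 * v ^ 4) + n̂ 10 * (y ^ 5 * v ^ 3) + y ^ 8
      neg⁺ y v = n̂ 7 * (y ^ 2 * v ^ 6) + n̂ 6 * (y ^ 3 * v ^ 5) + n̂ 10 * (y ^ 6 * v ^ 2) + n̂ 4 * (y ^ 7 * v)
      pos⁻ y v = v ^ 8 + n̂ 6 * (y ^ 3 * v ^ 5) + n̂ 15 * (y ^ 4 * v ^ 4) + n̂ 4 * (y ^ 7 * v) + y ^ 8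
      neg⁻ y v = y * v ^ 7 + n̂ 7 * (y ^ 2 * v ^ 6) + n̂ 10 * (y ^ 5 * v ^ 3) + n̂ 10 * (y ^ 6 * v ^ 2)

      pos⁺ₚ neg⁺ₚ pos⁻ₚ neg⁻ₚ : ∀ {n} → Polynomial n → Polynomial n → Polynomial n
      pos⁺ₚ y v = v :^ 8 :+ y :* v :^ 7 :+ con 15 :* (y :^ 4 :* v :^ 4) :+ con 10 :* (y :^ 5 :* v :^ 3) :+ y :^ 8
      neg⁺ₚ y v = con 7 :* (y :^ 2 :* v :^ 6) :+ con 6 :* (y :^ 3 :* v :^ 5) :+ con 10 :* (y :^ 6 :* v :^ 2) :+ con 4 :* (y :^ 7 :* v)
      pos⁻ₚ y v = v :^ 8 :+ con 6 :* (y :^ 3 :* v :^ 5) :+ con 15 :* (y :^ 4 :* v :^ 4) :+ con 4 :* (y :^ 7 :* v) :+ y :^ 8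
      neg⁻ₚ y v = y :* v :^ 7 :+ con 7 :* (y :^ 2 :* v :^ 6) :+ con 10 :* (y :^ 5 :* v :^ 3) :+ con 10 :* (y :^ 6 :* v :^ 2)

      even≈0∓odd⇒Φ₁₇ : even y * even y ≈ odd y * odd y → Φ₁₇ (y ^ 2) ≈ 0#
      even≈0∓odd⇒Φ₁₇ eq = +-cancelʳ (odd y * odd y) _ _
        (trans (sym (even²≈ y)) (trans eq (sym (+-identityˡ _))))

    -- With x = y + y⁻¹, y⁸ times the polynomial is Φ₁₇(y). If it vanishes, the even part is minus
    -- the odd part, so their squares agree and `even²≈` applies.
    minimal⁺⇒Φ₁₇ :
      x ^ 8 + x ^ 7 + n̂ 15 * x ^ 4 + n̂ 10 * x ^ 3 + n̂ 1 ≈ n̂ 7 * x ^ 6 + n̂ 6 * x ^ 5 + n̂ 10 * x ^ 2 + n̂ 4 * x →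
      Φ₁₇ (y ^ 2) ≈ 0#
    minimal⁺⇒Φ₁₇ eq = even≈0∓odd⇒Φ₁₇ (+-cancelʳ (even y * odd y) _ _ (begin
      even y * even y + even y * odd y  ≈⟨ distribˡ _ _ _ ⟨
      even y * (even y + odd y)         ≈⟨ trans (*-congˡ Φ≈0) (zeroʳ _) ⟩
      0#                                ≈⟨ trans (*-congˡ Φ≈0) (zeroʳ _) ⟨
      odd y * (even y + odd y)          ≈⟨ distribˡ _ _ _ ⟩
      odd y * even y + odd y * odd y    ≈⟨ trans (+-comm _ _) (+-congˡ (*-comm _ _)) ⟩
      odd y * odd y + even y * odd y    ∎))
      where
      Φ≈0 : Φ₁₇ y ≈ 0#
      Φ≈0 = +-cancelʳ (neg⁺ y (y * x)) _ _ (begin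
        Φ₁₇ y + neg⁺ y (y * x)            ≈⟨ +-congˡ (neg-cong yx) ⟩
        Φ₁₇ y + neg⁺ y (y * y + n̂ 1)
          ≈⟨ solve 1 (λ y → Φ₁₇ₚ y :+ neg⁺ₚ y (y :* y :+ con 1) := pos⁺ₚ y (y :* y :+ con 1)) refl y ⟩
        pos⁺ y (y * y + n̂ 1)              ≈⟨ pos-cong (sym yx) ⟩
        pos⁺ y (y * x)
          ≈⟨ solve 2 (λ y x → pos⁺ₚ y (y :* x) := y :^ 8 :* (x :^ 8 :+ x :^ 7 :+ con 15 :* x :^ 4 :+ con 10 :* x :^ 3 :+ con 1)) refl y x ⟩
        y ^ 8 * (x ^ 8 + x ^ 7 + n̂ 15 * x ^ 4 + n̂ 10 * x ^ 3 + n̂ 1)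
          ≈⟨ *-congˡ eq ⟩
        y ^ 8 * (n̂ 7 * x ^ 6 + n̂ 6 * x ^ 5 + n̂ 10 * x ^ 2 + n̂ 4 * x)
          ≈⟨ solve 2 (λ y x → neg⁺ₚ y (y :* x) := y :^ 8 :* (con 7 :* x :^ 6 :+ con 6 :* x :^ 5 :+ con 10 :* x :^ 2 :+ con 4 :* x)) refl y x ⟨
        neg⁺ y (y * x)                    ≈⟨ +-identityˡ _ ⟨
        0# + neg⁺ y (y * x)               ∎)
        where
        pos-cong : ∀ {v w} → v ≈ w → pos⁺ y v ≈ pos⁺ y w
        pos-cong p = +-congʳ (+-cong (+-cong (+-cong (^-congˡ 8 p) (*-congˡ (^-congˡ 7 p)))
          (*-congˡ (*-congˡ (^-congˡ 4 p)))) (*-congˡ (*-congˡ (^-congˡ 3 p))))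
        neg-cong : ∀ {v w} → v ≈ w → neg⁺ y v ≈ neg⁺ y w
        neg-cong p = +-cong (+-cong (+-cong (*-congˡ (*-congˡ (^-congˡ 6 p))) (*-congˡ (*-congˡ (^-congˡ 5 p))))
          (*-congˡ (*-congˡ (^-congˡ 2 p)))) (*-congˡ (*-congˡ p))

    -- Here y⁸ times the polynomial is Φ₁₇(-y), the even part minus the odd part, so the two parts
    -- coincide.
    minimal⁻⇒Φ₁₇ :
      x ^ 8 + n̂ 6 * x ^ 5 + n̂ 15 * x ^ 4 + n̂ 4 * x + n̂ 1 ≈ x ^ 7 + n̂ 7 * x ^ 6 + n̂ 10 * x ^ 3 + n̂ 10 * x ^ 2 →
      Φ₁₇ (y ^ 2) ≈ 0#
    minimal⁻⇒Φ₁₇ eq = even≈0∓odd⇒Φ₁₇ (*-cong even≈odd even≈odd)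
      where
      even≈odd : even y ≈ odd y
      even≈odd = +-cancelʳ (neg⁻ y (y * x)) _ _ (begin
        even y + neg⁻ y (y * x)            ≈⟨ +-congˡ (neg-cong yx) ⟩
        even y + neg⁻ y (y * y + n̂ 1)
          ≈⟨ solve 1 (λ y → evenₚ y :+ neg⁻ₚ y (y :* y :+ con 1) := oddₚ y :+ pos⁻ₚ y (y :* y :+ con 1)) refl y ⟩
        odd y + pos⁻ y (y * y + n̂ 1)       ≈⟨ +-congˡ (pos-cong (sym yx)) ⟩
        odd y + pos⁻ y (y * x)
          ≈⟨ +-congˡ (solve 2 (λ y x → pos⁻ₚ y (y :* x) := y :^ 8 :* (x :^ 8 :+ con 6 :* x :^ 5 :+ con 15 :* x :^ 4 :+ con 4 :* x :+ con 1)) refl y x) ⟩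
        odd y + y ^ 8 * (x ^ 8 + n̂ 6 * x ^ 5 + n̂ 15 * x ^ 4 + n̂ 4 * x + n̂ 1)
          ≈⟨ +-congˡ (*-congˡ eq) ⟩
        odd y + y ^ 8 * (x ^ 7 + n̂ 7 * x ^ 6 + n̂ 10 * x ^ 3 + n̂ 10 * x ^ 2)
          ≈⟨ +-congˡ (solve 2 (λ y x → neg⁻ₚ y (y :* x) := y :^ 8 :* (x :^ 7 :+ con 7 :* x :^ 6 :+ con 10 :* x :^ 3 :+ con 10 :* x :^ 2)) refl y x) ⟨
        odd y + neg⁻ y (y * x)             ∎)
        where
        pos-cong : ∀ {v w} → v ≈ w → pos⁻ y v ≈ pos⁻ y w
        pos-cong p = +-congʳ (+-cong (+-cong (+-cong (^-congˡ 8 p) (*-congˡ (*-congˡ (^-congˡ 5 p))))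
          (*-congˡ (*-congˡ (^-congˡ 4 p)))) (*-congˡ (*-congˡ p)))
        neg-cong : ∀ {v w} → v ≈ w → neg⁻ y v ≈ neg⁻ y w
        neg-cong p = +-cong (+-cong (+-cong (*-congˡ (^-congˡ 7 p)) (*-congˡ (*-congˡ (^-congˡ 6 p))))
          (*-congˡ (*-congˡ (^-congˡ 3 p)))) (*-congˡ (*-congˡ (^-congˡ 2 p)))

-- Powers of 17 and multiplicative orders.

prime∤⇒coprime : ∀ {p n} → Prime p → ¬ (p ∣ n) → Coprime n p
prime∤⇒coprime pr p∤n (i∣n , i∣p) with prime⇒irreducible pr i∣p
... | inj₁ i≡1 = i≡1
... | inj₂ ≡.refl = ⊥-elim (p∤n i∣n)

coprime-^ : ∀ {d p} → Coprime d p → ∀ k → Coprime (d ℕ.^ k) p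
coprime-^ {p = p} c zero = Coprimality.1-coprimeTo p
coprime-^ c (suc k) = coprime-* c (coprime-^ c k)

-- Look at the cofactor of d: either it absorbs one factor p, or it is prime to p and, dividing a
-- power of p, equals 1.
proper-divisor-^ : ∀ {p d} → Prime p → ∀ k → d ∣ p ℕ.^ suc k → d ≢ p ℕ.^ suc k → d ∣ p ℕ.^ k
proper-divisor-^ {p} {d} pr k (divides c eq) d≢ with p ∣? c
... | yes (divides c′ eq′) = divides c′ (ℕₚ.*-cancelˡ-≡ _ _ p (≡.trans eq
        (≡.trans (cong (ℕ._* d) (≡.trans eq′ (ℕₚ.*-comm c′ p))) (ℕₚ.*-assoc p c′ d))))
  where instance _ = prime⇒nonZero pr
... | no p∤c = ⊥-elim (d≢ (≡.sym (≡.trans eq (≡.trans (cong (ℕ._* d) c≡1) (ℕₚ.*-identityˡ d)))))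
  where
  c≡1 : c ≡ 1
  c≡1 = coprime-^ (Coprimality.sym (prime∤⇒coprime pr p∤c)) (suc k)
    (divides d (≡.trans eq (ℕₚ.*-comm c d)) , ∣.∣-refl)

^-distribʳ-* : ∀ m n k → (m ℕ.* n) ℕ.^ k ≡ m ℕ.^ k ℕ.* n ℕ.^ k
^-distribʳ-* m n zero = ≡.refl
^-distribʳ-* m n (suc k) = ≡.trans (cong (m ℕ.* n ℕ.*_) (^-distribʳ-* m n k))
  (solve 4 (λ m n a b → m :* n :* (a :* b) := m :* a :* (n :* b)) ≡.refl m n (m ℕ.^ k) (n ℕ.^ k))
  where open +-*-Solver

-- Puts 17ʳ above the square root of M, so that a composite M has a prime divisor in the range
-- covered by the hypothesis.
34^R<289^R : ∀ R → 34 ℕ.^ suc R ℕ.+ 1 ℕ.< 17 ℕ.^ suc R ℕ.* 17 ℕ.^ suc R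
34^R<289^R R = subst (34 ℕ.^ suc R ℕ.+ 1 <_) (^-distribʳ-* 17 17 (suc R)) (lemma R)
  where
  open ℕₚ.≤-Reasoning
  lemma : ∀ R → 34 ℕ.^ suc R ℕ.+ 1 ℕ.< 289 ℕ.^ suc R
  lemma zero = from-yes (35 ℕₚ.<? 289)
  lemma (suc R) = begin-strict
    34 ℕ.* 34 ℕ.^ suc R ℕ.+ 1          ≤⟨ ℕₚ.+-monoʳ-≤ (34 ℕ.* 34 ℕ.^ suc R) (ℕ.s≤s ℕ.z≤n) ⟩
    34 ℕ.* 34 ℕ.^ suc R ℕ.+ 34 ℕ.* 1   ≡⟨ ℕₚ.*-distribˡ-+ 34 (34 ℕ.^ suc R) 1 ⟨
    34 ℕ.* (34 ℕ.^ suc R ℕ.+ 1)        <⟨ ℕₚ.*-monoʳ-< 34 (lemma R) ⟩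
    34 ℕ.* 289 ℕ.^ suc R               ≤⟨ ℕₚ.*-monoˡ-≤ (289 ℕ.^ suc R) (from-yes (34 ℕₚ.≤? 289)) ⟩
    289 ℕ.* 289 ℕ.^ suc R              ∎

prime-17 : Prime 17
prime-17 = from-yes (prime? 17)

module Orders {a ℓ} (R : CommutativeRing a ℓ) where
  open CommutativeRing R
  open Powers R
  open Mult semiring using () renaming (_×_ to _·_)
  open RingProperties ring using (+-cancelʳ)
  open SetoidReasoning setoid

  ^-∣ : ∀ {x m n} → m ∣ n → x ^ m ≈ 1# → x ^ n ≈ 1#
  ^-∣ {x} (divides q eq) h = trans (^-congʳ x eq) (^-order h q)

  -- Bézout's identity in the form gcd + jn = im keeps all exponents natural numbers.
  ^-bézout : ∀ {x} d {m n} → d ℕ.+ n ≡ m → x ^ m ≈ 1# → x ^ n ≈ 1# → x ^ d ≈ 1#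
  ^-bézout {x} d {m} {n} eq xm xn = begin
    x ^ d            ≈⟨ *-identityʳ _ ⟨
    x ^ d * 1#       ≈⟨ *-congˡ xn ⟨
    x ^ d * x ^ n    ≈⟨ ^-homo-* x d n ⟨
    x ^ (d ℕ.+ n)    ≈⟨ trans (^-congʳ x eq) xm ⟩
    1#               ∎

  ^-gcd : ∀ {x m n} → x ^ m ≈ 1# → x ^ n ≈ 1# → x ^ gcd m n ≈ 1#
  ^-gcd {x} {m} {n} xm xn with Bézout.identity (gcd-GCD m n)
  ... | Bézout.Identity.+- i j eq = ^-bézout (gcd m n) eq (^-order xm i) (^-order xn j)
  ... | Bézout.Identity.-+ i j eq = ^-bézout (gcd m n) eq (^-order xn j) (^-order xm i)

  ·-bézout : ∀ d {m n} → d ℕ.+ n ≡ m → m · 1# ≈ 0# → n · 1# ≈ 0# → d · 1# ≈ 0#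
  ·-bézout d {m} {n} eq hm hn = begin
    d · 1#            ≈⟨ +-identityʳ _ ⟨
    d · 1# + 0#       ≈⟨ +-congˡ hn ⟨
    d · 1# + n · 1#   ≈⟨ MonoidMult.×-homo-+ +-monoid 1# d n ⟨
    (d ℕ.+ n) · 1#    ≈⟨ trans (reflexive (cong (_· 1#) eq)) hm ⟩
    0#                ∎

  ·-multiple : ∀ {m} → m · 1# ≈ 0# → ∀ i → (i ℕ.* m) · 1# ≈ 0#
  ·-multiple {m} h i = trans (sym (MonoidMult.×-assocˡ +-monoid 1# i m))
    (trans (MonoidMult.×-congʳ +-monoid i h) (lemma i))
    where
    lemma : ∀ i → i · 0# ≈ 0#
    lemma zero = refl
    lemma (suc i) = trans (+-identityˡ _) (lemma i)

  coprime-characteristics : ∀ {m n} → Coprime m n → m · 1# ≈ 0# → n · 1# ≈ 0# → 1# ≈ 0#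
  coprime-characteristics {m} {n} c hm hn =
    trans (sym (MonoidMult.×-homo-1 +-monoid 1#)) (lemma (Coprimality.coprime-Bézout c))
    where
    lemma : Bézout.Identity 1 m n → 1 · 1# ≈ 0#
    lemma (Bézout.Identity.+- i j eq) = ·-bézout 1 eq (·-multiple hm i) (·-multiple hn j)
    lemma (Bézout.Identity.-+ i j eq) = ·-bézout 1 eq (·-multiple hn j) (·-multiple hm i)

  open Cyclotomic R using (Φ₁₇; Φ₁₇-^17; Φ₁₇-1)

  -- The order of a is divisible by 17ᵏ⁺¹, because a^(2 34ᵏ) is a root of Φ₁₇.
  order-divisible : ∀ {q} → Coprime 17 q → q · 1# ≈ 0# → ¬ (1# ≈ 0#) →
    ∀ {x n} k → x ^ n ≈ 1# → Φ₁₇ ((x ^ (34 ℕ.^ k)) ^ 2) ≈ 0# → 17 ℕ.^ suc k ∣ n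
  order-divisible {q} 17⊥q q≈0 1≉0 {x} {n} k xn Φ with 17 ℕ.^ suc k ∣? n
  ... | yes d = d
  ... | no ∤n = ⊥-elim (1≉0 (coprime-characteristics 17⊥q 17≈0 q≈0))
    where
    w z : Carrier
    -- The factor 2ᵏ⁺¹ strips the 2-part of the exponent: w to the power 17ᵏ is the square of
    -- x^(34ᵏ), the known root of Φ₁₇.
    w = x ^ (2 ℕ.^ suc k)
    z = (x ^ (34 ℕ.^ k)) ^ 2
    exponent : 34 ℕ.^ k ℕ.* 2 ≡ 2 ℕ.^ suc k ℕ.* 17 ℕ.^ k
    exponent = ≡.trans (ℕₚ.*-comm (34 ℕ.^ k) 2) (≡.trans (cong (2 ℕ.*_) (^-distribʳ-* 2 17 k)) (≡.sym (ℕₚ.*-assoc 2 (2 ℕ.^ k) (17 ℕ.^ k))))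
    w^17^k : w ^ (17 ℕ.^ k) ≈ z
    w^17^k = trans (^-assocʳ x (2 ℕ.^ suc k) (17 ℕ.^ k))
      (trans (^-congʳ x (≡.sym exponent)) (sym (^-assocʳ x (34 ℕ.^ k) 2)))
    w^17^1+k : w ^ (17 ℕ.^ suc k) ≈ 1#
    w^17^1+k = trans (^-congʳ w (ℕₚ.*-comm 17 (17 ℕ.^ k))) (trans (sym (^-assocʳ w (17 ℕ.^ k) 17))
      (trans (^-congˡ 17 w^17^k) (Φ₁₇-^17 Φ)))
    w^n : w ^ n ≈ 1#
    w^n = trans (^-comm x (2 ℕ.^ suc k) n) (trans (^-congˡ (2 ℕ.^ suc k) xn) (1^n≈1 (2 ℕ.^ suc k)))
    -- If 17ᵏ⁺¹ does not divide n, the gcd already divides 17ᵏ, which forces z = 1. Then 0 = Φ₁₇(1)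
    -- = 17, impossible in a nonzero ring where q = 0 with q prime to 17.
    gcd∣ : gcd n (17 ℕ.^ suc k) ∣ 17 ℕ.^ k
    gcd∣ = proper-divisor-^ prime-17 k (gcd[m,n]∣n n _)
      (λ eq → ∤n (subst (_∣ n) eq (gcd[m,n]∣m n (17 ℕ.^ suc k))))
    z≈1 : z ≈ 1#
    z≈1 = trans (sym w^17^k) (^-∣ gcd∣ (^-gcd {m = n} w^n w^17^1+k))
    17≈0 : 17 · 1# ≈ 0#
    17≈0 = trans (OptimisedMonoidMult.×ᵤ≈× +-monoid 17 1#) (trans (sym (Φ₁₇-1 z≈1)) Φ)

-- Adjoining a root of unity of prime order.

module HomSum {a b ℓ ℓ′} (R : CommutativeRing a ℓ) (S : CommutativeRing b ℓ′)
  {h : CommutativeRing.Carrier R → CommutativeRing.Carrier S} (h-hom : Hom R S h) where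
  private
    module R = Summation R
    module S = Summation S
    module H = IsRingHomomorphism h-hom
  open CommutativeRing S

  ∑-homo : ∀ n f → h (R.∑ n f) ≈ S.∑ n (h ∘ f)
  ∑-homo zero f = H.0#-homo
  ∑-homo (suc n) f = trans (H.+-homo _ _) (+-congˡ (∑-homo n (f ∘ suc)))

  ·-homo : ∀ n x → h (Mult._×_ (CommutativeRing.semiring R) n x) ≈ Mult._×_ semiring n (h x)
  ·-homo zero x = H.0#-homo
  ·-homo (suc n) x = trans (H.+-homo _ _) (+-congˡ (·-homo n x))

-- R[x]/(1 + x + ⋯ + xᴺ⁺¹).
module RootOfUnity {a ℓ′} (R : CommutativeRing a ℓ′) (N ℓ : ℕ) .{{_ : NonZero ℓ}} (ℓ≡ : ℓ ≡ suc (suc N)) where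
  private module R = CommutativeRing R

  module A = Adjoin R N (Vec.replicate (suc N) (R.- R.1#))
  open CommutativeRing A.commutativeRing
  open Powers A.commutativeRing using (_^_; ^-congʳ)
  open Summation A.commutativeRing
  open SetoidReasoning setoid
  private module H = IsRingHomomorphism A.constant-hom

  x : Carrier
  x = A.⟨x⟩

  private
    open Horner R A.commutativeRing A.constant-hom using (eval)

    eval-minus-one : ∀ n w → eval w (Vec.replicate n (R.- R.1#)) ≈ - ∑ n (w ^_)
    eval-minus-one zero w = sym (RingProperties.-0#≈0# ring)
    eval-minus-one (suc n) w = begin
      A.constant (R.- R.1#) + w * eval w (Vec.replicate n (R.- R.1#))
        ≈⟨ +-cong (trans (H.-‿homo R.1#) (-‿cong H.1#-homo)) (*-congˡ {w} (eval-minus-one n w)) ⟩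
      - 1# + w * - ∑ n (w ^_)
        ≈⟨ +-congˡ { - 1#} (RingProperties.-‿distribʳ-* ring w (∑ n (w ^_))) ⟨
      - 1# + - (w * ∑ n (w ^_))
        ≈⟨ AbelianGroupProperties.⁻¹-∙-comm +-abelianGroup 1# (w * ∑ n (w ^_)) ⟩
      - (1# + w * ∑ n (w ^_))
        ≈⟨ -‿cong (+-congˡ {1#} (*-distribˡ-sum {n} w (λ i → w ^ toℕ i))) ⟩
      - ∑ (suc n) (w ^_) ∎

  geometric≈0 : ∑ (suc (suc N)) (x ^_) ≈ 0#
  geometric≈0 = begin
    ∑ (suc (suc N)) (x ^_)
      ≈⟨ +-comm 1# (∑ (suc N) (λ k → x ^ suc k)) ⟩
    ∑ (suc N) (λ k → x ^ suc k) + 1#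
      ≈⟨ ∑-step (suc N) (x ^_) ⟩
    ∑ (suc N) (x ^_) + x ^ suc N
      ≈⟨ +-congˡ {∑ (suc N) (x ^_)} (trans (AdjoinRoot.power-root R N (Vec.replicate (suc N) (R.- R.1#)))
           (eval-minus-one (suc N) x)) ⟩
    ∑ (suc N) (x ^_) - ∑ (suc N) (x ^_)
      ≈⟨ -‿inverseʳ (∑ (suc N) (x ^_)) ⟩
    0# ∎

  x^ℓ≈1 : x ^ ℓ ≈ 1#
  x^ℓ≈1 = trans (^-congʳ x ℓ≡) (RingProperties.+-cancelˡ ring (∑ (suc (suc N)) (x ^_)) (x ^ suc (suc N)) 1# (begin
    ∑ (suc (suc N)) (x ^_) + x ^ suc (suc N)
      ≈⟨ ∑-step (suc (suc N)) (x ^_) ⟨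
    ∑ (suc (suc N)) (λ k → x ^ suc k) + 1#
      ≈⟨ +-congʳ {1#} (begin
           ∑ (suc (suc N)) (λ k → x ^ suc k)  ≈⟨ *-distribˡ-sum {suc (suc N)} x (λ i → x ^ toℕ i) ⟨
           x * ∑ (suc (suc N)) (x ^_)         ≈⟨ trans (*-congˡ {x} geometric≈0) (zeroʳ x) ⟩
           0#                                 ≈⟨ geometric≈0 ⟨
           ∑ (suc (suc N)) (x ^_)             ∎) ⟩
    ∑ (suc (suc N)) (x ^_) + 1# ∎))

  module _ (γ : ℕ) (γ^N : (γ ℕ.^ suc N) % ℓ ≡ 1 % ℓ)
    (generates : List.applyUpTo (λ k → (γ ℕ.^ k) % ℓ) (suc N) ↭ List.applyUpTo suc (suc N)) where
    open GaussSum A.commutativeRing ℓ N γ γ^N x x^ℓ≈1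
    open Powers A.commutativeRing using (^-≡%; 1^n≈1)

    -- The powers of γ run through all nonzero classes modulo ℓ, so the trivial Gauss sum is x + x²
    -- + ⋯ + xᴺ⁺¹, which is -1 by the defining relation.
    gauss-1 : gauss 1# ≈ - 1#
    gauss-1 = RingProperties.+-cancelˡ ring 1# (gauss 1#) (- 1#) (begin
      1# + gauss 1#
        ≈⟨ +-congˡ {1#} (∑-cong (suc N) {g = λ k → x ^ ((γ ℕ.^ k) % ℓ)} (λ k _ → trans (*-congʳ {x ^ (γ ℕ.^ k ℕ.* 1)} (1^n≈1 k))
             (trans (*-identityˡ (x ^ (γ ℕ.^ k ℕ.* 1))) (^-≡% {x} x^ℓ≈1 {γ ℕ.^ k ℕ.* 1} {(γ ℕ.^ k) % ℓ} (≡.trans (cong (_% ℓ) (ℕₚ.*-identityʳ (γ ℕ.^ k)))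
               (≡.sym (m%n%n≡m%n (γ ℕ.^ k) ℓ))))))) ⟩
      1# + ∑ (suc N) (λ k → x ^ ((γ ℕ.^ k) % ℓ))
        ≈⟨ +-congˡ {1#} (reflexive (∑≡listSum (suc N) (x ^_) (λ k → (γ ℕ.^ k) % ℓ))) ⟩
      1# + listSum (List.map (x ^_) (List.applyUpTo (λ k → (γ ℕ.^ k) % ℓ) (suc N)))
        ≈⟨ +-congˡ {1#} (listSum-↭ (x ^_) generates) ⟩
      1# + listSum (List.map (x ^_) (List.applyUpTo suc (suc N)))
        ≈⟨ +-congˡ {1#} (reflexive (∑≡listSum (suc N) (x ^_) suc)) ⟨
      ∑ (suc (suc N)) (x ^_)
        ≈⟨ geometric≈0 ⟩
      0#
        ≈⟨ -‿inverseʳ 1# ⟨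
      1# - 1# ∎)

-- All that is used of the extension containing G. Injectivity of the embedding brings congruences
-- free of G back down to K.
record GaussExtension {a b} (K : CommutativeRing a b) (N ℓ : ℕ) .{{_ : NonZero ℓ}} (γ : ℕ)
                      (γ^N : (γ ℕ.^ suc N) % ℓ ≡ 1 % ℓ) : Set (Level.suc (a Level.⊔ b)) where
  field
    L : CommutativeRing a (a Level.⊔ b)
    embed : CommutativeRing.Carrier K → CommutativeRing.Carrier L
    embed-hom : Hom K L embed
    embed-injective : ∀ x y → CommutativeRing._≈_ L (embed x) (embed y) → CommutativeRing._≈_ K x y
    x : CommutativeRing.Carrier L
    x^ℓ≈1 : CommutativeRing._≈_ L (Powers._^_ L x ℓ) (CommutativeRing.1# L)
    gauss-1 : CommutativeRing._≈_ L (GaussSum.gauss L ℓ N γ γ^N x x^ℓ≈1 (CommutativeRing.1# L))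
                (CommutativeRing.-_ L (CommutativeRing.1# L))

gaussExtension : ∀ {a b} (K : CommutativeRing a b) N ℓ .{{_ : NonZero ℓ}} → ℓ ≡ suc (suc N) → ∀ γ γ^N →
  List.applyUpTo (λ k → (γ ℕ.^ k) % ℓ) (suc N) ↭ List.applyUpTo suc (suc N) → GaussExtension K N ℓ γ γ^N
gaussExtension K N ℓ ℓ≡ γ γ^N generates = record
  { L = A.commutativeRing
  ; embed = A.constant
  ; embed-hom = A.constant-hom
  ; embed-injective = λ _ _ → A.constant-injective
  ; x = x
  ; x^ℓ≈1 = x^ℓ≈1
  ; gauss-1 = gauss-1 γ γ^N generates
  }
  where open RootOfUnity K N ℓ ℓ≡

open SortingAlgorithm insertionSort using (sort; sort-↭)

sorted⇒↭ : ∀ {ms ns} → sort ms ≡ ns → ms ↭ ns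
sorted⇒↭ {ms} eq = Perm.↭-trans (Perm.↭-sym (sort-↭ ms)) (Perm.↭-reflexive eq)

generates-86 : List.applyUpTo (λ k → (86 ℕ.^ k) % 103) 102 ↭ List.applyUpTo suc 102
generates-86 = sorted⇒↭ (from-yes (Listₚ.≡-dec ℕₚ._≟_
  (sort (List.applyUpTo (λ k → (86 ℕ.^ k) % 103) 102)) (List.applyUpTo suc 102)))

-- The 34th power of the Gauss sum, and its behaviour under Frobenius.

module SquaringChain {a ℓ} (R : CommutativeRing a ℓ) where
  open CommutativeRing R
  open Powers R

  sq : Carrier → Carrier
  sq y = y * y

  sq-cong : ∀ {a b} → a ≈ b → sq a ≈ sq b
  sq-cong p = *-cong p p

  sq-* : ∀ a b → sq (a * b) ≈ sq a * sq b
  sq-* a b = CommutativeSemigroupProperties.interchange *-commutativeSemigroup a b a b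

  sq-^ : ∀ y n → sq (y ^ n) ≈ y ^ (n ℕ.* 2)
  sq-^ y n = trans (*-congˡ (sym (*-identityʳ (y ^ n)))) (^-assocʳ y n 2)

  sq-step : ∀ {a j g g′ j′} → a ≈ j * g → g * g ≈ j′ * g′ → sq a ≈ (sq j * j′) * g′
  sq-step {a} {j} {g} p q = trans (*-cong p p) (trans (sq-* j g) (trans (*-congˡ q) (sym (*-assoc _ _ _))))

  chain : (j₁ j₂ j₄ j₈ j₁₆ c : Carrier) → Carrier
  chain j₁ j₂ j₄ j₈ j₁₆ c = sq (sq (sq (sq j₁ * j₂) * j₄) * j₈ * j₁₆) * c

  ^34≈ : ∀ g → g ^ 34 ≈ sq (sq (sq (sq (sq g))) * g)
  ^34≈ g = sym (trans (sq-cong (trans (*-comm (sq (sq (sq (sq g)))) g) (*-congˡ sq⁴))) (sq-^ g 17))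
    where
    sq⁴ : sq (sq (sq (sq g))) ≈ g ^ 16
    sq⁴ = trans (sq-cong (trans (sq-cong (trans (sq-cong (*-congˡ (sym (*-identityʳ g)))) (sq-^ g 2))) (sq-^ g 4))) (sq-^ g 8)

  -- 34 = 2(16 + 1): four squarings lead from χ to χ¹⁶, a multiplication by the Gauss sum of χ leads
  -- to χ¹⁷, and the last squaring meets the quadratic Gauss sum.
  square-chain : ∀ g₁ g₂ g₄ g₈ g₁₆ g₁₇ j₁ j₂ j₄ j₈ j₁₆ c →
    g₁ * g₁ ≈ j₁ * g₂ → g₂ * g₂ ≈ j₂ * g₄ → g₄ * g₄ ≈ j₄ * g₈ → g₈ * g₈ ≈ j₈ * g₁₆ →
    g₁₆ * g₁ ≈ j₁₆ * g₁₇ → g₁₇ * g₁₇ ≈ c → g₁ ^ 34 ≈ chain j₁ j₂ j₄ j₈ j₁₆ c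
  square-chain g₁ g₂ g₄ g₈ g₁₆ g₁₇ j₁ j₂ j₄ j₈ j₁₆ c p₁ p₂ p₄ p₈ p₁₆ p₁₇ =
    trans (^34≈ g₁) (trans (sq-cong
      (trans (*-congʳ (sq-step (sq-step (sq-step p₁ p₂) p₄) p₈))
        (trans (*-assoc _ g₁₆ g₁) (trans (*-congˡ p₁₆) (sym (*-assoc _ j₁₆ g₁₇))))))
      (trans (sq-* _ g₁₇) (*-congˡ p₁₇)))

module UnitPowers {a ℓ} (R : CommutativeRing a ℓ) where
  open CommutativeRing R
  open Powers R
  open SetoidReasoning setoid
  open CommutativeSemigroupProperties *-commutativeSemigroup using (interchange; x∙yz≈y∙xz)

  unit-* : ∀ {x x′ y y′} → x * x′ ≈ 1# → y * y′ ≈ 1# → (x * y) * (x′ * y′) ≈ 1#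
  unit-* p q = trans (interchange _ _ _ _) (trans (*-cong p q) (*-identityʳ 1#))

  unit-^ : ∀ {x x′} → x * x′ ≈ 1# → ∀ n → x ^ n * x′ ^ n ≈ 1#
  unit-^ p n = trans (sym (^-distrib-* _ _ n)) (trans (^-congˡ n p) (1^n≈1 n))

  -- If a = w c b⁻ⁿ, then aᵏ = cᵏ as soon as wᵏ = 1 and bⁿᵏ = 1.
  power-of-quotient : ∀ {δ δ′ u u′ a A Ā b b̄ w c t} n k →
    δ * δ′ ≈ 1# → u * u′ ≈ 1# → δ * a ≈ A → A * Ā ≈ δ * δ → b * b̄ ≈ u →
    A * b ^ n ≈ δ * (w * c) → w ^ k ≈ 1# → b ^ suc (n ℕ.* k) ≈ b → t * c ^ suc k ≈ c →
    t * a ^ k ≈ 1#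
  power-of-quotient {δ} {δ′} {u} {u′} {a} {A} {Ā} {b} {b̄} {w} {c} {t} n k δδ′ uu′ δa AĀ bb̄ Ab w^k b^p tc =
    trans (*-congˡ a^k≈c^k) (unit-cancelˡ c-unit (begin
      c * (t * c ^ k)    ≈⟨ x∙yz≈y∙xz c t (c ^ k) ⟩
      t * c ^ suc k      ≈⟨ tc ⟩
      c                  ≈⟨ *-identityʳ c ⟨
      c * 1#             ∎))
    where
    -- The ring may have zero divisors, so inverses are exhibited: a and b from their conjugates
    -- through A Ā = δ² and b b̄ = u, and then c from a bⁿ = w c.
    a-unit : a * (Ā * δ′) ≈ 1#
    a-unit = trans (sym (*-assoc a Ā δ′)) (trans (*-congʳ (unit-cancelˡ δδ′
      (trans (sym (*-assoc δ a Ā)) (trans (*-congʳ δa) AĀ)))) δδ′)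
    b-unit : b * (b̄ * u′) ≈ 1#
    b-unit = trans (sym (*-assoc b b̄ u′)) (trans (*-congʳ bb̄) uu′)
    ab≈wc : a * b ^ n ≈ w * c
    ab≈wc = unit-cancelˡ δδ′ (trans (sym (*-assoc δ a _)) (trans (*-congʳ δa) Ab))
    c-unit : c * (w * ((Ā * δ′) * (b̄ * u′) ^ n)) ≈ 1#
    c-unit = trans (sym (*-assoc c w _)) (trans (*-congʳ (trans (*-comm c w) (sym ab≈wc)))
      (unit-* a-unit (unit-^ b-unit n)))
    b^nk : (b ^ n) ^ k ≈ 1#
    b^nk = trans (^-assocʳ b n k) (unit-cancelˡ b-unit (trans b^p (sym (*-identityʳ b))))
    a^k≈c^k : a ^ k ≈ c ^ k
    a^k≈c^k = begin
      a ^ k                ≈⟨ *-identityʳ _ ⟨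
      a ^ k * 1#           ≈⟨ *-congˡ b^nk ⟨
      a ^ k * (b ^ n) ^ k  ≈⟨ ^-distrib-* a (b ^ n) k ⟨
      (a * b ^ n) ^ k      ≈⟨ ^-congˡ k ab≈wc ⟩
      (w * c) ^ k          ≈⟨ ^-distrib-* w c k ⟩
      w ^ k * c ^ k        ≈⟨ trans (*-congʳ w^k) (*-identityˡ _) ⟩
      c ^ k                ∎

module Image {a ℓ} (K : CommutativeRing a ℓ) {ψ : Vec ℤ 16 → CommutativeRing.Carrier K}
             (ψ-hom : Hom ℤ[ζ] K ψ) where
  open CommutativeRing K
  open Powers K
  open Mult semiring using () renaming (_×_ to _·_)
  open SetoidReasoning setoid
  module ψ = IsRingHomomorphism ψ-hom
  module ℤζᴿ = CommutativeRing ℤ[ζ]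

  h : ℤ → Carrier
  h i = ψ (ℤζ.constant i)

  h-hom : Hom ℤₚ.+-*-commutativeRing K h
  h-hom = mkHom ℤₚ.+-*-commutativeRing K h (λ p → ψ.⟦⟧-cong (C.⟦⟧-cong p))
    (λ i j → trans (ψ.⟦⟧-cong (C.+-homo i j)) (ψ.+-homo _ _))
    (λ i j → trans (ψ.⟦⟧-cong (C.*-homo i j)) (ψ.*-homo (ℤζ.constant i) (ℤζ.constant j)))
    (trans (ψ.⟦⟧-cong C.1#-homo) ψ.1#-homo)
    where module C = IsRingHomomorphism ℤζ.constant-hom
  module h = IsRingHomomorphism h-hom

  h-ℕ : ∀ n → h (+ n) ≈ n · 1#
  h-ℕ zero = h.0#-homo
  h-ℕ (suc n) = trans (h.+-homo ℤ.1ℤ (+ n)) (+-cong h.1#-homo (h-ℕ n))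

  z : Carrier
  z = ψ ℤζ.⟨x⟩

  ψ-zeta : ∀ n → ψ (zeta n) ≈ z ^ n
  ψ-zeta zero = ψ.1#-homo
  ψ-zeta (suc n) = trans (ψ.⟦⟧-cong (ℤζ.shift≈⟨x⟩⊛ (zeta n)))
    (trans (ψ.*-homo ℤζ.⟨x⟩ (zeta n)) (*-congˡ (ψ-zeta n)))

  z^34≈1 : z ^ 34 ≈ 1#
  z^34≈1 = trans (sym (ψ-zeta 34)) (trans (reflexive (cong ψ Z34.zeta-34)) ψ.1#-homo)

  ψ-zeta-% : ∀ n → ψ (zeta (n % 34)) ≈ z ^ n
  ψ-zeta-% n = trans (ψ-zeta (n % 34)) (sym (^-% z^34≈1 n))

  open Horner ℤₚ.+-*-commutativeRing K h-hom using (eval; eval-cong)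
  private module ℤH = Horner ℤₚ.+-*-commutativeRing ℤ[ζ] ℤζ.constant-hom

  ψ≈eval : ∀ v → ψ v ≈ eval z v
  ψ≈eval v = trans (ψ.⟦⟧-cong (ℤζᴿ.sym {x = ℤH.eval ℤζ.⟨x⟩ v} (AdjoinRoot.eval-⟨x⟩ ℤₚ.+-*-commutativeRing 15 (Z34.alternatingℤ 16 ℤ.-1ℤ) v)))
    (ℤH.eval-natural K ψ-hom ℤζ.⟨x⟩ v)

  module _ {p} (p-prime : Prime p) (p≈0 : p · 1# ≈ 0#) where
    open Characteristic K using (eval-frobenius-iterate)

    -- Frobenius acts on the image of ℤ[ζ] by ζ ↦ ζᵖ, and its j-th iterate fixes ζ when pʲ ≡ 1
    -- modulo 34.
    ψ-frobenius : ∀ j → (p ℕ.^ j) % 34 ≡ 1 % 34 → ∀ v → ψ v ^ (p ℕ.^ j) ≈ ψ v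
    ψ-frobenius j p^j≡1 v = begin
      ψ v ^ (p ℕ.^ j)           ≈⟨ ^-congˡ (p ℕ.^ j) (ψ≈eval v) ⟩
      eval z v ^ (p ℕ.^ j)      ≈⟨ eval-frobenius-iterate p-prime p≈0 h-hom j z v ⟩
      eval (z ^ (p ℕ.^ j)) v    ≈⟨ eval-cong {x = v} (trans (^-≡% z^34≈1 {p ℕ.^ j} {1} p^j≡1) (*-identityʳ z)) (Pointwise.refl ≡.refl) ⟩
      eval z v                  ≈⟨ ψ≈eval v ⟨
      ψ v                       ∎

  module GaussChain (x : Carrier) (x^103≈1 : x ^ 103 ≈ 1#)
    (gauss-1≈-1 : GaussSum.gauss K 103 101 86 ≡.refl x x^103≈1 1# ≈ - 1#) where
    open GaussSum K 103 101 86 ≡.refl x x^103≈1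
    open Jacobi 51 ≡.refl Z34.jacobiExponent (λ s s<101 → Z34.jacobiExponent-correct s<101)
    open Summation K using (∑; ∑-cong)
    open HomSum ℤ[ζ] K ψ-hom using (∑-homo)

    G : ℕ → Carrier
    G a = gauss (z ^ a)

    z^a-order : ∀ a → (z ^ a) ^ 102 ≈ 1#
    z^a-order a = trans (^-comm z a 102) (trans (^-congˡ a (^-order {z} {34} z^34≈1 3)) (1^n≈1 a))

    gauss-cong : ∀ {u v} → u ≈ v → gauss u ≈ gauss v
    gauss-cong {u} {v} p = ∑-cong 102 {term u 1} {term v 1} (λ k _ → *-congʳ {x ^ (86 ℕ.^ k ℕ.* 1)} (^-congˡ k p))

    jacobi-congʳ : ∀ y {u v} → u ≈ v → jacobi y u ≈ jacobi y v
    jacobi-congʳ y {u} {v} p = ∑-cong 101 {λ s → y ^ (51 ℕ.+ suc s) * u ^ Z34.jacobiExponent s} {λ s → y ^ (51 ℕ.+ suc s) * v ^ Z34.jacobiExponent s}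
      (λ s _ → *-congˡ {y ^ (51 ℕ.+ suc s)} (^-congˡ (Z34.jacobiExponent s) p))

    geometric-cong : ∀ {u v} → u ≈ v → geometric u ≈ geometric v
    geometric-cong {u} {v} p = ∑-cong 102 {u ^_} {v ^_} (λ k _ → ^-congˡ k p)

    jacobi≈ψ : ∀ b c → jacobi (z ^ b) (z ^ c) ≈ ψ (Z34.jacobiℤ b c)
    jacobi≈ψ b c = trans
      (∑-cong 101 {λ s → (z ^ b) ^ (51 ℕ.+ suc s) * (z ^ c) ^ Z34.jacobiExponent s} {λ s → ψ (zeta (exponent s % 34))}
        (λ s _ → trans (*-cong (^-assocʳ z b (51 ℕ.+ suc s)) (^-assocʳ z c (Z34.jacobiExponent s)))
          (trans (sym (^-homo-* z (b ℕ.* (51 ℕ.+ suc s)) (c ℕ.* Z34.jacobiExponent s))) (sym (ψ-zeta-% (exponent s))))))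
      (sym (∑-homo 101 (λ s → zeta (exponent s % 34))))
      where
      exponent : ℕ → ℕ
      exponent s = b ℕ.* (51 ℕ.+ suc s) ℕ.+ c ℕ.* Z34.jacobiExponent s

    geometric≈ψ : ∀ c → geometric (z ^ c) ≈ ψ (Z34.geometricℤ c)
    geometric≈ψ c = trans
      (∑-cong 102 {(z ^ c) ^_} {λ k → ψ (zeta ((c ℕ.* k) % 34))}
        (λ k _ → trans (^-assocʳ z c k) (sym (ψ-zeta-% (c ℕ.* k)))))
      (sym (∑-homo 102 (λ k → zeta ((c ℕ.* k) % 34))))

    -- The exponent c matters only modulo 34; this admits a = b = 17 with c = 0, where the product
    -- is the trivial character.
    G-* : ∀ a b c → z ^ a * z ^ b ≈ z ^ c →
      G a * G b ≈ ψ (Z34.jacobiℤ b c) * G c + (z ^ b) ^ 51 * ψ (Z34.geometricℤ c)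
    G-* a b c p = trans (gauss-* (z^a-order a) (z^a-order b))
      (+-cong (*-cong (trans (jacobi-congʳ (z ^ b) p) (jacobi≈ψ b c)) (gauss-cong p))
              (*-congˡ {(z ^ b) ^ 51} (trans (geometric-cong p) (geometric≈ψ c))))

    G-*-J : ∀ a b c J → a ℕ.+ b ≡ c → Z34.geometricℤ c ≡ ℤζ.𝟎 → J ≡ Z34.jacobiℤ b c →
      G a * G b ≈ ψ J * G c
    G-*-J a b c J sum vanish eq = trans (G-* a b c (trans (sym (^-homo-* z a b)) (^-congʳ z sum)))
      (trans (+-cong (*-congʳ (reflexive (cong ψ (≡.sym eq))))
               (trans (*-congˡ (trans (reflexive (cong ψ vanish)) ψ.0#-homo)) (zeroʳ _)))
             (+-identityʳ _))

    -- The quadratic character squares to the trivial one, so both terms of `G-*` contribute: the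
    -- trivial Gauss sum is -1, and the geometric sum now consists of ones. Its sign is the value
    -- ζ¹⁷ of the quadratic character at -1, as 17 · 51 ≡ 17 modulo 34.
    G-17 : G 17 * G 17 ≈ ψ (ℤζ.constant -[1+ 102 ])
    G-17 = begin
      G 17 * G 17
        ≈⟨ G-* 17 17 0 (trans (sym (^-homo-* z 17 17)) z^34≈1) ⟩
      ψ (Z34.jacobiℤ 17 0) * gauss 1# + (z ^ 17) ^ 51 * ψ (Z34.geometricℤ 0)
        ≈⟨ +-cong (trans (*-congˡ gauss-1≈-1) (x*-1≈-x (ψ (Z34.jacobiℤ 17 0))))
             (*-congʳ (trans (^-assocʳ z 17 51) (trans (^-≡% {z} {34} z^34≈1 {17 ℕ.* 51} {17} ≡.refl) (sym (ψ-zeta 17))))) ⟩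
      - ψ (Z34.jacobiℤ 17 0) + ψ (zeta 17) * ψ (Z34.geometricℤ 0)
        ≈⟨ +-cong (ψ.-‿homo (Z34.jacobiℤ 17 0)) (ψ.*-homo (zeta 17) (Z34.geometricℤ 0)) ⟨
      ψ (ℤζ.⊝ Z34.jacobiℤ 17 0) + ψ (zeta 17 Z34.* Z34.geometricℤ 0)
        ≈⟨ ψ.+-homo (ℤζ.⊝ Z34.jacobiℤ 17 0) (zeta 17 Z34.* Z34.geometricℤ 0) ⟨
      ψ ((ℤζ.⊝ Z34.jacobiℤ 17 0) ℤζ.⊕ (zeta 17 Z34.* Z34.geometricℤ 0))
        ≈⟨ reflexive (cong ψ Z34.quadratic-gauss) ⟩
      ψ (ℤζ.constant -[1+ 102 ]) ∎
      where
      x*-1≈-x : ∀ y → y * - 1# ≈ - y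
      x*-1≈-x y = trans (sym (RingProperties.-‿distribʳ-* ring y 1#)) (-‿cong (*-identityʳ y))

    open SquaringChain K

    ψ-gaussPower : ∀ j₁ j₂ j₄ j₈ j₁₆ →
      ψ (Z34.gaussPower j₁ j₂ j₄ j₈ j₁₆) ≈ chain (ψ j₁) (ψ j₂) (ψ j₄) (ψ j₈) (ψ j₁₆) (h -[1+ 102 ])
    ψ-gaussPower j₁ j₂ j₄ j₈ j₁₆ =
      trans (ψ.*-homo (Z34.sq s₁₆) (ℤζ.constant -[1+ 102 ])) (*-congʳ (trans (ψ-sq s₁₆) (sq-cong eq₁₆)))
      where
      ψ-sq : ∀ v → ψ (Z34.sq v) ≈ sq (ψ v)
      ψ-sq v = ψ.*-homo v v
      s₂ s₄ s₁₆ : Vec ℤ 16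
      s₂ = Z34.sq j₁ Z34.* j₂
      s₄ = Z34.sq s₂ Z34.* j₄
      s₁₆ = Z34.sq s₄ Z34.* j₈ Z34.* j₁₆
      eq₂ : ψ s₂ ≈ sq (ψ j₁) * ψ j₂
      eq₂ = trans (ψ.*-homo (Z34.sq j₁) j₂) (*-congʳ (ψ-sq j₁))
      eq₄ : ψ s₄ ≈ sq (sq (ψ j₁) * ψ j₂) * ψ j₄
      eq₄ = trans (ψ.*-homo (Z34.sq s₂) j₄) (*-congʳ (trans (ψ-sq s₂) (sq-cong eq₂)))
      eq₁₆ : ψ s₁₆ ≈ sq (sq (sq (ψ j₁) * ψ j₂) * ψ j₄) * ψ j₈ * ψ j₁₆
      eq₁₆ = trans (ψ.*-homo (Z34.sq s₄ Z34.* j₈) j₁₆)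
        (*-congʳ (trans (ψ.*-homo (Z34.sq s₄) j₈) (*-congʳ (trans (ψ-sq s₄) (sq-cong eq₄)))))

    C : Carrier
    C = ψ (Z34.gaussPower Z34.J₁ Z34.J₂ Z34.J₄ Z34.J₈ Z34.J₁₆)

    G^34 : G 1 ^ 34 ≈ C
    G^34 = lemma Z34.geometric-vanishes
      where
      lemma : All (λ c → Z34.geometricℤ c ≡ ℤζ.𝟎) (2 ∷ 4 ∷ 8 ∷ 16 ∷ 17 ∷ []) → G 1 ^ 34 ≈ C
      lemma (v₂ ∷ v₄ ∷ v₈ ∷ v₁₆ ∷ v₁₇ ∷ []) = trans
        (square-chain (G 1) (G 2) (G 4) (G 8) (G 16) (G 17)
          (ψ Z34.J₁) (ψ Z34.J₂) (ψ Z34.J₄) (ψ Z34.J₈) (ψ Z34.J₁₆) (h -[1+ 102 ])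
          (G-*-J 1 1 2 Z34.J₁ ≡.refl v₂ Z34.J₁-def) (G-*-J 2 2 4 Z34.J₂ ≡.refl v₄ Z34.J₂-def)
          (G-*-J 4 4 8 Z34.J₄ ≡.refl v₈ Z34.J₄-def) (G-*-J 8 8 16 Z34.J₈ ≡.refl v₁₆ Z34.J₈-def)
          (G-*-J 16 1 17 Z34.J₁₆ ≡.refl v₁₇ Z34.J₁₆-def) G-17)
        (sym (ψ-gaussPower Z34.J₁ Z34.J₂ Z34.J₄ Z34.J₈ Z34.J₁₆))

    -- 34(k + 1) = p + 33, so Cᵏ⁺¹ = Gᵖ G³³, and Frobenius replaces zᵐ Gᵖ by G. Keeping the factor
    -- G³³ restores C = G³⁴ without dividing by G.
    gauss-power-frobenius : ∀ {p} → Prime p → p · 1# ≈ 0# → ∀ {m} → p % 103 ≡ (86 ℕ.^ m) % 103 →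
      ∀ k → p ≡ suc (34 ℕ.* k) → z ^ m * C ^ suc k ≈ C
    gauss-power-frobenius {p} p-prime p≈0 {m} p≡86^m k p≡1+34k = begin
      z ^ m * C ^ suc k
        ≈⟨ *-congˡ (trans (^-congˡ (suc k) (sym G^34)) (trans (^-assocʳ (G 1) 34 (suc k))
             (trans (^-congʳ (G 1) exponent) (^-homo-* (G 1) p 33)))) ⟩
      z ^ m * (G 1 ^ p * G 1 ^ 33)
        ≈⟨ *-assoc (z ^ m) _ _ ⟨
      (z ^ m * G 1 ^ p) * G 1 ^ 33
        ≈⟨ *-congʳ (trans (*-congʳ (^-congˡ m (sym (*-identityʳ z))))
             (gauss-frobenius (z^a-order 1) p-prime p≈0 z^p≈z {m} p≡86^m)) ⟩
      G 1 ^ 34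
        ≈⟨ G^34 ⟩
      C ∎
      where
      exponent : 34 ℕ.* suc k ≡ p ℕ.+ 33
      exponent = ≡.trans (solve 1 (λ k → con 34 :* (con 1 :+ k) := con 1 :+ con 34 :* k :+ con 33) ≡.refl k)
        (cong (ℕ._+ 33) (≡.sym p≡1+34k))
        where open +-*-Solver
      z^p≈z : (z ^ 1) ^ p ≈ z ^ 1
      z^p≈z = trans (^-comm z 1 p) (^-congˡ 1 (trans (^-congʳ z (≡.trans p≡1+34k (cong suc (ℕₚ.*-comm 34 k))))
        (trans (*-congˡ (^-order z^34≈1 k)) (*-identityʳ z))))

module Reciprocity {a ℓ} (K : CommutativeRing a ℓ) {ψ : Vec ℤ 16 → CommutativeRing.Carrier K}
                   (ψ-hom : Hom ℤ[ζ] K ψ) where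
  open CommutativeRing K
  open Powers K
  open Mult semiring using () renaming (_×_ to _·_)
  open Image K ψ-hom
  C : Carrier
  C = ψ (Z34.gaussPower Z34.J₁ Z34.J₂ Z34.J₄ Z34.J₈ Z34.J₁₆)

  module _ {p} (p-prime : Prime p) (p≈0 : p · 1# ≈ 0#) where

    -- The relation involves only C and z, which come from K, so it descends from the extension.
    gauss-reciprocity-in : GaussExtension K 101 103 86 ≡.refl → ∀ {m} → p % 103 ≡ (86 ℕ.^ m) % 103 →
      ∀ k → p ≡ suc (34 ℕ.* k) → z ^ m * C ^ suc k ≈ C
    gauss-reciprocity-in E {m} p≡86^m k p≡1+34k = embed-injective (z ^ m * C ^ suc k) C
      (L.trans (ι.*-homo (z ^ m) (C ^ suc k)) (L.trans
        (L.*-cong (^-homo z m) (^-homo C (suc k)))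
        (G.gauss-power-frobenius p-prime p≈0ᴸ {m} p≡86^m k p≡1+34k)))
      where
      open GaussExtension E
      module L = CommutativeRing L
      module ι = IsRingHomomorphism embed-hom
      open HomPowers K L embed-hom using (^-homo)

      θ : Vec ℤ 16 → L.Carrier
      θ v = embed (ψ v)

      θ-hom : Hom ℤ[ζ] L θ
      θ-hom = mkHom ℤ[ζ] L θ (λ p → ι.⟦⟧-cong (ψ.⟦⟧-cong p))
        (λ v w → L.trans (ι.⟦⟧-cong (ψ.+-homo v w)) (ι.+-homo (ψ v) (ψ w)))
        (λ v w → L.trans (ι.⟦⟧-cong (ψ.*-homo v w)) (ι.*-homo (ψ v) (ψ w)))
        (L.trans (ι.⟦⟧-cong ψ.1#-homo) ι.1#-homo)

      module G = Image.GaussChain L θ-hom x x^ℓ≈1 gauss-1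

      p≈0ᴸ : Mult._×_ L.semiring p L.1# L.≈ L.0#
      p≈0ᴸ = L.trans (L.sym (L.trans (HomSum.·-homo K L embed-hom p 1#) (MonoidMult.×-congʳ L.+-monoid p ι.1#-homo)))
        (L.trans (ι.⟦⟧-cong p≈0) ι.0#-homo)

    gauss-reciprocity : ∀ {m} → p % 103 ≡ (86 ℕ.^ m) % 103 →
      ∀ k → p ≡ suc (34 ℕ.* k) → z ^ m * C ^ suc k ≈ C
    gauss-reciprocity {m} = gauss-reciprocity-in (gaussExtension K 101 103 ≡.refl 86 ≡.refl generates-86) {m}

    -- From α B³⁴ = ζ²¹ C, raised to the power 34k = (p - 1)/34: the factor 34 in this exponent
    -- kills ζ²¹, and p ≡ 1 modulo 34 makes Frobenius fix B, so the power of B disappears as well.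
    power-α : ∀ {m} → p % 103 ≡ (86 ℕ.^ m) % 103 → ∀ k → p ≡ suc (34 ℕ.* (34 ℕ.* k)) →
      ∀ {w} → w ≡ ℤζ.constant (+ 103) → ∀ {a δ′ u′} → ψ Z34.Dℤ * δ′ ≈ 1# → ψ w * u′ ≈ 1# → ψ Z34.Dℤ * a ≈ ψ Z34.αℤ →
      z ^ m * a ^ (34 ℕ.* k) ≈ 1#
    power-α {m} p≡86^m k p≡1+34k {w} w≡103 {a} {δ′} {u′} δδ′ uu′ δa =
      power-of-quotient {ψ Z34.Dℤ} {δ′} {ψ w} {u′} {a} {ψ Z34.αℤ} {ψ Z34.ᾱℤ} {ψ Z34.Bℤ} {ψ Z34.B̄ℤ} {ψ (zeta 21)} {C} {z ^ m}
        34 (34 ℕ.* k) δδ′ uu′ δa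
        (ψ-*≡ Z34.αℤ Z34.ᾱℤ Z34.Dℤ Z34.Dℤ Z34.α-ᾱ)
        (trans (sym (ψ.*-homo Z34.Bℤ Z34.B̄ℤ)) (reflexive (cong ψ (≡.trans Z34.B-B̄ (≡.sym w≡103)))))
        α-gauss
        (trans (^-congˡ (34 ℕ.* k) (ψ-zeta 21)) (trans (^-comm z 21 (34 ℕ.* k))
          (trans (^-congˡ 21 (trans (^-congʳ z (ℕₚ.*-comm 34 k)) (^-order {z} {34} z^34≈1 k))) (1^n≈1 21))))
        (trans (^-congʳ (ψ Z34.Bℤ) (≡.trans (≡.sym p≡1+34k) (≡.sym (ℕₚ.*-identityʳ p))))
          (ψ-frobenius p-prime p≈0 1 (≡.trans (cong (_% 34) (ℕₚ.*-identityʳ p)) p%34) Z34.Bℤ))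
        (gauss-reciprocity {m} p≡86^m (34 ℕ.* k) p≡1+34k)
      where
      open UnitPowers K using (power-of-quotient)
      ψ-*≡ : ∀ v w v′ w′ → v Z34.* w ≡ v′ Z34.* w′ → ψ v * ψ w ≈ ψ v′ * ψ w′
      ψ-*≡ v w v′ w′ eq = trans (sym (ψ.*-homo v w)) (trans (reflexive (cong ψ eq)) (ψ.*-homo v′ w′))
      α-gauss : ψ Z34.αℤ * ψ Z34.Bℤ ^ 34 ≈ ψ Z34.Dℤ * (ψ (zeta 21) * C)
      α-gauss = trans (*-congˡ (sym (HomPowers.^-homo ℤ[ζ] K ψ-hom Z34.Bℤ 34)))
        (trans (ψ-*≡ Z34.αℤ (Z34.Bℤ Z34.^ 34) Z34.Dℤ _ Z34.α-gauss)
               (*-congˡ (ψ.*-homo (zeta 21) (Z34.gaussPower Z34.J₁ Z34.J₂ Z34.J₄ Z34.J₈ Z34.J₁₆))))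
      p%34 : p % 34 ≡ 1 % 34
      p%34 = ≡.trans (cong (_% 34) (≡.trans p≡1+34k (cong suc (ℕₚ.*-comm 34 (34 ℕ.* k)))))
        ([m+kn]%n≡m%n 1 (34 ℕ.* k) 34)

-- Elementary symmetric functions of the conjugates in a residue ring.

nth : List (Vec ℤ 16) → ℕ → Vec ℤ 16
nth []       j       = ℤζ.𝟎
nth (v ∷ vs) zero    = v
nth (v ∷ vs) (suc j) = nth vs j

module ElementarySymmetric {a ℓ} (R : CommutativeRing a ℓ) where
  open CommutativeRing R
  open Powers R using (_^_)
  open OptimisedMult semiring using () renaming (_×_ to _·_)

  E : ℕ → List Carrier → Carrier
  E zero    xs       = 1#
  E (suc j) []       = 0#
  E (suc j) (x ∷ xs) = x * E j xs + E (suc j) xs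

  E-cong : ∀ j {xs ys} → Pointwiseᴸ _≈_ xs ys → E j xs ≈ E j ys
  E-cong zero p = refl
  E-cong (suc j) [] = refl
  E-cong (suc j) (p ∷ ps) = +-cong (*-cong p (E-cong j ps)) (E-cong (suc j) ps)

  E-overflow : ∀ j xs → List.length xs < j → E j xs ≈ 0#
  E-overflow (suc j) [] l = refl
  E-overflow (suc j) (x ∷ xs) (s≤s l) = trans
    (+-cong (trans (*-congˡ (E-overflow j xs l)) (zeroʳ x)) (E-overflow (suc j) xs (ℕₚ.m≤n⇒m≤1+n l)))
    (+-identityˡ 0#)

  -- x is a root of the product of T - xᵢ over x and the seven elements of `ys`; the eighth
  -- symmetric function of seven elements is zero.
  vieta : ∀ x ys → List.length ys ≡ 7 → let e = λ j → E j (x ∷ ys) in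
    x ^ 8 + e 2 * x ^ 6 + e 4 * x ^ 4 + e 6 * x ^ 2 + e 8 ≈ e 1 * x ^ 7 + e 3 * x ^ 5 + e 5 * x ^ 3 + e 7 * x
  vieta x ys length = trans (+-congˡ (trans (+-congˡ (E-overflow 8 ys (s≤s (ℕₚ.≤-reflexive length)))) (+-identityʳ _)))
    (trans (Cyclotomic.vieta R x (E 1 ys) (E 2 ys) (E 3 ys) (E 4 ys) (E 5 ys) (E 6 ys) (E 7 ys))
      (+-congʳ (+-congʳ (+-congʳ (*-congʳ (+-congʳ (sym (*-identityʳ x))))))))

  module _ {ψ : Vec ℤ 16 → Carrier} (ψ-hom : Hom ℤ[ζ] R ψ) where
    private module ψ = IsRingHomomorphism ψ-hom

    nth-multiplyLinear-zero : ∀ x e es → ψ (nth (Z34.multiplyLinear x e es) 0) ≈ ψ x * ψ e + ψ (nth es 0)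
    nth-multiplyLinear-zero x e [] = trans (ψ.*-homo x e) (sym (trans (+-congˡ ψ.0#-homo) (+-identityʳ _)))
    nth-multiplyLinear-zero x e (f ∷ fs) = trans (ψ.+-homo (x Z34.* e) f) (+-congʳ (ψ.*-homo x e))

    nth-multiplyLinear-suc : ∀ x e es j →
      ψ (nth (Z34.multiplyLinear x e es) (suc j)) ≈ ψ x * ψ (nth es j) + ψ (nth es (suc j))
    nth-multiplyLinear-suc x e [] j = trans ψ.0#-homo (sym (trans (+-cong (trans (*-congˡ ψ.0#-homo) (zeroʳ _)) ψ.0#-homo) (+-identityʳ 0#)))
    nth-multiplyLinear-suc x e (f ∷ fs) zero = nth-multiplyLinear-zero x f fs
    nth-multiplyLinear-suc x e (f ∷ fs) (suc j) = nth-multiplyLinear-suc x f fs j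

    E-ψ : ∀ j vs → E (suc j) (List.map ψ vs) ≈ ψ (nth (Z34.esyms vs) j)
    E-ψ j [] = sym ψ.0#-homo
    E-ψ zero (v ∷ vs) = trans (+-cong (*-congˡ (sym ψ.1#-homo)) (E-ψ 0 vs))
      (sym (nth-multiplyLinear-zero v ℤζ.𝟏 (Z34.esyms vs)))
    E-ψ (suc j) (v ∷ vs) = trans (+-cong (*-congˡ (E-ψ j vs)) (E-ψ (suc j) vs))
      (sym (nth-multiplyLinear-suc v ℤζ.𝟏 (Z34.esyms vs) j))

module ConjugateInverse {a ℓ} (R : CommutativeRing a ℓ) where
  open CommutativeRing R
  open Powers R using (unit-cancelˡ)
  open CommutativeSemigroupProperties *-commutativeSemigroup using (x∙yz≈y∙xz)

  conjugate-inverse : ∀ {δ δ′ a a′ A A′} → δ * δ′ ≈ 1# → δ * a ≈ A → δ * a′ ≈ A′ → A * A′ ≈ δ * δ → a * a′ ≈ 1#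
  conjugate-inverse {δ} {δ′} {a} {a′} δδ′ δa δa′ AA′ = unit-cancelˡ δδ′ (unit-cancelˡ δδ′
    (trans (*-congˡ (sym (*-assoc δ a a′)))
    (trans (x∙yz≈y∙xz δ (δ * a) a′) (trans (*-cong δa δa′) (trans AA′ (*-congˡ (sym (*-identityʳ δ))))))))

values⁺ values⁻ : List ℤ
values⁺ = -[1+ 0 ] ∷ -[1+ 6 ] ∷ + 6 ∷ + 15 ∷ -[1+ 9 ] ∷ -[1+ 9 ] ∷ + 4 ∷ + 1 ∷ []
values⁻ = + 1 ∷ -[1+ 6 ] ∷ -[1+ 5 ] ∷ + 15 ∷ + 10 ∷ -[1+ 9 ] ∷ -[1+ 3 ] ∷ + 1 ∷ []

nthℤ : List ℤ → ℕ → ℤ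
nthℤ []       j       = + 0
nthℤ (i ∷ is) zero    = i
nthℤ (i ∷ is) (suc j) = nthℤ is j

module Residues {a ℓ} (K : CommutativeRing a ℓ) {ψ : Vec ℤ 16 → CommutativeRing.Carrier K} (ψ-hom : Hom ℤ[ζ] K ψ) where
  open CommutativeRing K
  open Powers K
  open Image K ψ-hom
  open ElementarySymmetric K
  open Cyclotomic K hiding (vieta)
  open Mult semiring using () renaming (_×_ to _·_)
  open OptimisedMult semiring using () renaming (_×_ to _·′_)
  open SetoidReasoning setoid

  private
    h≈ : ∀ {e} n → e ≈ h (+ n) → e ≈ n ·′ 1#
    h≈ n eq = trans eq (trans (h-ℕ n) (OptimisedMonoidMult.×ᵤ≈× +-monoid n 1#))

    h-neg≈ : ∀ {e} n → e ≈ h -[1+ n ] → e + suc n ·′ 1# ≈ 0#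
    h-neg≈ {e} n eq = trans (+-cong (trans eq (h.-‿homo (+ suc n))) (sym (h≈ (suc n) refl))) (-‿inverseˡ _)

    below8 : ∀ j {_ : T (j ℕ.<ᵇ 8)} → j ℕ.< 8
    below8 j {t} = ℕₚ.<ᵇ⇒< j 8 t

  Φ₁₇-root : ∀ {y y′} ys → List.length ys ≡ 7 → y * y′ ≈ 1# →
    (∀ j → j ℕ.< 8 → E (suc j) ((y + y′) ∷ ys) ≈ h (nthℤ values⁺ j)) ⊎
    (∀ j → j ℕ.< 8 → E (suc j) ((y + y′) ∷ ys) ≈ h (nthℤ values⁻ j)) → Φ₁₇ (y ^ 2) ≈ 0#
  Φ₁₇-root {y} {y′} ys len yy′ (inj₁ e) = minimal⁺⇒Φ₁₇ yy′ (minimal⁺ (vieta (y + y′) ys len)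
    (h-neg≈ 6 (e 1 (below8 1))) (h≈ 15 (e 3 (below8 3))) (h-neg≈ 9 (e 5 (below8 5))) (h≈ 1 (e 7 (below8 7)))
    (h-neg≈ 0 (e 0 (below8 0))) (h≈ 6 (e 2 (below8 2))) (h-neg≈ 9 (e 4 (below8 4))) (h≈ 4 (e 6 (below8 6))))
  Φ₁₇-root {y} {y′} ys len yy′ (inj₂ e) = minimal⁻⇒Φ₁₇ yy′ (minimal⁻ (vieta (y + y′) ys len)
    (h-neg≈ 6 (e 1 (below8 1))) (h≈ 15 (e 3 (below8 3))) (h-neg≈ 9 (e 5 (below8 5))) (h≈ 1 (e 7 (below8 7)))
    (h≈ 1 (e 0 (below8 0))) (h-neg≈ 5 (e 2 (below8 2))) (h≈ 10 (e 4 (below8 4))) (h-neg≈ 3 (e 6 (below8 6))))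

  -- The element b is the fraction ψ w / ψ v, and the sixteenth iterate of Frobenius fixes numerator
  -- and denominator. Cancelling one factor b leaves the exponent q¹⁶ - 1.
  frobenius-order : ∀ {q} → Prime q → q · 1# ≈ 0# → (q ℕ.^ 16) % 34 ≡ 1 % 34 →
    ∀ v w {v′ b b′ N} → ψ v * v′ ≈ 1# → ψ v * b ≈ ψ w → b * b′ ≈ 1# → q ℕ.^ 16 ≡ suc N → b ^ N ≈ 1#
  frobenius-order {q} q-prime q≈0 q^16 v w {v′} {b} {b′} {N} vv′ vb bb′ eq = unit-cancelˡ bb′ (begin
    b * b ^ N          ≈⟨ ^-congʳ b eq ⟨
    b ^ (q ℕ.^ 16)     ≈⟨ unit-cancelˡ vv′ (begin
        ψ v * b ^ (q ℕ.^ 16)                  ≈⟨ *-congʳ (ψ-frobenius q-prime q≈0 16 q^16 v) ⟨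
        ψ v ^ (q ℕ.^ 16) * b ^ (q ℕ.^ 16)     ≈⟨ ^-distrib-* (ψ v) b (q ℕ.^ 16) ⟨
        (ψ v * b) ^ (q ℕ.^ 16)                ≈⟨ ^-congˡ (q ℕ.^ 16) vb ⟩
        ψ w ^ (q ℕ.^ 16)                      ≈⟨ ψ-frobenius q-prime q≈0 16 q^16 w ⟩
        ψ w                                   ≈⟨ vb ⟨
        ψ v * b                               ∎) ⟩
    b                  ≈⟨ *-identityʳ b ⟨
    b * 1#             ∎)

  power-inverse : ∀ {x x′} → x * x′ ≈ 1# → ∀ n → x ^ n * x′ ^ n ≈ 1#
  power-inverse p n = trans (sym (^-distrib-* _ _ n)) (trans (^-congˡ n p) (1^n≈1 n))

  -- A is z⁻ᵐ, written as z³³ᵐ because z³⁴ = 1, and its inverse A′ is zᵐ.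
  power-sum : ∀ m {A A′} → z ^ m * A ≈ 1# → A * A′ ≈ 1# → A + A′ ≈ ψ (zeta m ℤζ.⊕ zeta (33 ℕ.* m))
  power-sum m {A} {A′} zA AA′ = begin
    A + A′                             ≈⟨ +-comm A A′ ⟩
    A′ + A                             ≈⟨ +-cong A′≈ A≈ ⟩
    z ^ m + z ^ (33 ℕ.* m)             ≈⟨ +-cong (ψ-zeta m) (ψ-zeta (33 ℕ.* m)) ⟨
    ψ (zeta m) + ψ (zeta (33 ℕ.* m))   ≈⟨ ψ.+-homo (zeta m) (zeta (33 ℕ.* m)) ⟨
    ψ (zeta m ℤζ.⊕ zeta (33 ℕ.* m))    ∎
    where
    A′≈ : A′ ≈ z ^ m
    A′≈ = unit-cancelˡ AA′ (trans AA′ (trans (sym zA) (*-comm (z ^ m) A)))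
    A≈ : A ≈ z ^ (33 ℕ.* m)
    A≈ = unit-cancelˡ zA′ (trans zA (sym zA′))
      where
      zA′ : z ^ m * z ^ (33 ℕ.* m) ≈ 1#
      zA′ = trans (sym (^-homo-* z m (33 ℕ.* m))) (trans (^-congʳ z (ℕₚ.*-comm 34 m)) (^-order {z} {34} z^34≈1 m))

  order-divisible : ∀ {q} → Prime q → q · 1# ≈ 0# → ¬ (1# ≈ 0#) → Coprime 17 q → (q ℕ.^ 16) % 34 ≡ 1 % 34 →
    ∀ {N} → q ℕ.^ 16 ≡ suc N → ∀ v w {v′ b b′} → ψ v * v′ ≈ 1# → ψ v * b ≈ ψ w → b * b′ ≈ 1# →
    ∀ k ys → List.length ys ≡ 7 →
    (∀ j → j ℕ.< 8 → E (suc j) ((b ^ (34 ℕ.^ k) + b′ ^ (34 ℕ.^ k)) ∷ ys) ≈ h (nthℤ values⁺ j)) ⊎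
    (∀ j → j ℕ.< 8 → E (suc j) ((b ^ (34 ℕ.^ k) + b′ ^ (34 ℕ.^ k)) ∷ ys) ≈ h (nthℤ values⁻ j)) →
    17 ℕ.^ suc k ∣ N
  order-divisible q-prime q≈0 1≉0 17⊥q q^16 {N} q^16≡ v w vv′ vb bb′ k ys len values =
    Orders.order-divisible K 17⊥q q≈0 1≉0 k (frobenius-order q-prime q≈0 q^16 v w {N = N} vv′ vb bb′ q^16≡)
      (Φ₁₇-root ys len (power-inverse bb′ (34 ℕ.^ k)) values)

  conjugate-sum : ∀ {p} → Prime p → p · 1# ≈ 0# → ∀ m → p % 103 ≡ (86 ℕ.^ m) % 103 → ∀ k → p ≡ suc (34 ℕ.* (34 ℕ.* k)) →
    ∀ {w} → w ≡ ℤζ.constant (+ 103) → ∀ {b b′ δ′ u′} → ψ Z34.Dℤ * δ′ ≈ 1# → ψ w * u′ ≈ 1# →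
    ψ Z34.Dℤ * b ≈ ψ Z34.αℤ → b * b′ ≈ 1# →
    b ^ (34 ℕ.* k) + b′ ^ (34 ℕ.* k) ≈ ψ (zeta m ℤζ.⊕ zeta (33 ℕ.* m))
  conjugate-sum p-prime p≈0 m p≡86^m k p≡ w≡103 δδ′ uu′ δb bb′ = power-sum m
    (Reciprocity.power-α K ψ-hom p-prime p≈0 {m} p≡86^m k p≡ w≡103 δδ′ uu′ δb) (power-inverse bb′ (34 ℕ.* k))

  symmetric-values : ∀ {xs ys} vs cs → Pointwiseᴸ _≈_ xs ys → Pointwiseᴸ _≈_ ys (List.map ψ vs) →
    Z34.esyms vs ≡ List.map ℤζ.constant cs → ∀ j → E (suc j) xs ≈ h (nthℤ cs j)
  symmetric-values vs cs p q eq j = trans (E-cong (suc j) p) (trans (E-cong (suc j) q) (trans (E-ψ ψ-hom j vs)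
    (reflexive (cong ψ (≡.trans (cong (λ es → nth es j) eq) (nth-constant cs j))))))
    where
    nth-constant : ∀ cs j → nth (List.map ℤζ.constant cs) j ≡ ℤζ.constant (nthℤ cs j)
    nth-constant [] j = ≡.refl
    nth-constant (c ∷ cs) zero = ≡.refl
    nth-constant (c ∷ cs) (suc j) = nth-constant cs j

-- The field ℚ(ζ₃₄) as a ring, and the embedding of ℤ[ζ].

open import Defs
open Z34 using (Root; roots)
open import Data.Nat.Base using (_≥_; _∸_; NonTrivial) renaming (_^_ to _^ᴺ_)
open import Data.Integer.Base using (-_; 1ℤ; _%ℕ_; _/ℕ_) renaming (_<_ to _<ᶻ_; _^_ to _^ᶻ_)
open ≡ using (refl; sym; trans; subst₂; module ≡-Reasoning)
open ≡-Reasoning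

-- The literal is 103¹⁵, the denominator called `D` above.
α-value : α ≡ Vec.map (λ i → i ℚ./ 1557967416600764580522382952407) Z34.α-coefficients
α-value = from-yes (Vecₚ.≡-dec ℚₚ._≟_ α (Vec.map (λ i → i ℚ./ 1557967416600764580522382952407) Z34.α-coefficients))

module ℚζ = Adjoin ℚₚ.+-*-commutativeRing 15 ζ₃₄¹⁶

strict : {x y : ℚζ₃₄} → Pointwise _≡_ x y → x ≡ y
strict = Pointwise-≡⇒≡

ℚζ-ring : CommutativeRing _ _
ℚζ-ring = record
  { Carrier = ℚζ₃₄
  ; _≈_ = _≡_
  ; _+_ = _+_
  ; _*_ = _*_
  ; -_ = neg
  ; 0# = 0#
  ; 1# = 1#
  ; isCommutativeRing = strictRing ℚζ.commutativeRing strict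
  }

module F = CommutativeRing ℚζ-ring
open Powers ℚζ-ring using (^-assocʳ; ^-≡%)
open Summation ℚζ-ring using (∑; ∑-cong; *-distribˡ-sum)

ι-hom : Hom ℚₚ.+-*-commutativeRing ℚζ-ring ι
ι-hom = mkHom ℚₚ.+-*-commutativeRing ℚζ-ring ι (cong ι)
  (λ p q → strict (H.+-homo p q))
  (λ p q → strict (H.*-homo p q)) refl
  where module H = IsRingHomomorphism ℚζ.constant-hom

fromℤ : ℤ → ℚ
fromℤ i = i ℚ./ 1

toℚᵘ-fromℤ : ∀ i → ℚ.toℚᵘ (fromℤ i) ℚᵘ.≃ ℚᵘ.mkℚᵘ i 0
toℚᵘ-fromℤ i = ℚₚ.toℚᵘ-fromℚᵘ (ℚᵘ.mkℚᵘ i 0)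

fromℤ-hom : Hom ℤₚ.+-*-commutativeRing ℚₚ.+-*-commutativeRing fromℤ
fromℤ-hom = mkHom ℤₚ.+-*-commutativeRing ℚₚ.+-*-commutativeRing fromℤ (cong fromℤ)
  (λ i j → sym (homo {ℚ._+_} {ℚᵘ._+_} ℚᵘₚ.+-cong ℚₚ.toℚᵘ-homo-+ i j (i ℤ.+ j) (ℚᵘ.*≡* (trans (ℤₚ.*-identityʳ _) (trans (cong₂ ℤ._+_ (ℤₚ.*-identityʳ i) (ℤₚ.*-identityʳ j)) (sym (ℤₚ.*-identityʳ _)))))))
  (λ i j → sym (homo {ℚ._*_} {ℚᵘ._*_} ℚᵘₚ.*-cong ℚₚ.toℚᵘ-homo-* i j (i ℤ.* j) (ℚᵘ.*≡* refl)))
  refl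
  where
  homo : ∀ {_∙_ : ℚ → ℚ → ℚ} {_∘_ : ℚᵘ.ℚᵘ → ℚᵘ.ℚᵘ → ℚᵘ.ℚᵘ} →
    (∀ {p q r s} → p ℚᵘ.≃ q → r ℚᵘ.≃ s → (p ∘ r) ℚᵘ.≃ (q ∘ s)) →
    (∀ p q → ℚ.toℚᵘ (p ∙ q) ℚᵘ.≃ (ℚ.toℚᵘ p ∘ ℚ.toℚᵘ q)) →
    ∀ i j k → (ℚᵘ.mkℚᵘ i 0 ∘ ℚᵘ.mkℚᵘ j 0) ℚᵘ.≃ ℚᵘ.mkℚᵘ k 0 →
    (fromℤ i ∙ fromℤ j) ≡ fromℤ k
  homo ∘-cong toℚᵘ-homo i j k eq = ℚₚ.toℚᵘ-injective
    (ℚᵘₚ.≃-trans (toℚᵘ-homo (fromℤ i) (fromℤ j))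
      (ℚᵘₚ.≃-trans (∘-cong (toℚᵘ-fromℤ i) (toℚᵘ-fromℤ j))
        (ℚᵘₚ.≃-trans eq (ℚᵘₚ.≃-sym (toℚᵘ-fromℤ k)))))

module φ-map = CoefficientMap ℤₚ.+-*-commutativeRing ℚₚ.+-*-commutativeRing fromℤ-hom
  15 (Z34.alternatingℤ 16 ℤ.-1ℤ) ζ₃₄¹⁶ (≡⇒Pointwise-≡ refl)

φ : Vec ℤ 16 → ℚζ₃₄
φ = Vec.map fromℤ

φ-hom : Hom ℤ[ζ] ℚζ-ring φ
φ-hom = mkHom ℤ[ζ] ℚζ-ring φ (λ p → strict (H.⟦⟧-cong p))
  (λ x y → strict (H.+-homo x y)) (λ x y → strict (H.*-homo x y)) refl
  where module H = IsRingHomomorphism φ-map.map-hom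

module φ = IsRingHomomorphism φ-hom

φ-constant : ∀ i → φ (ℤζ.constant i) ≡ ι (fromℤ i)
φ-constant i = refl

^-suc : ∀ z n → z ^ suc n ≡ z * z ^ n
^-suc z n = refl

shift-⟨x⟩ : ∀ z → z ≡ ℚζ.⟨x⟩ → ∀ y → ζ₃₄* y ≡ z * y
shift-⟨x⟩ z eq y = strict (ℚζ.shift≈root⊛ (≡⇒Pointwise-≡ eq) y)

ζ₃₄≡⟨x⟩ : ζ₃₄ ≡ ℚζ.⟨x⟩
ζ₃₄≡⟨x⟩ = refl

ζ₃₄*≡ : ∀ y → ζ₃₄* y ≡ ζ₃₄ * y
ζ₃₄*≡ = shift-⟨x⟩ ζ₃₄ ζ₃₄≡⟨x⟩

φ-zeta : ∀ n → φ (zeta n) ≡ ζ₃₄ ^ n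
φ-zeta zero = refl
φ-zeta (suc n) = begin
  φ (ℤζ.shift (zeta n))   ≡⟨ strict (φ-map.map-shift (zeta n)) ⟩
  ζ₃₄* φ (zeta n)         ≡⟨ cong ζ₃₄*_ (φ-zeta n) ⟩
  ζ₃₄* (ζ₃₄ ^ n)          ≡⟨ ζ₃₄*≡ (ζ₃₄ ^ n) ⟩
  ζ₃₄ * (ζ₃₄ ^ n)         ≡⟨ ^-suc ζ₃₄ n ⟨
  ζ₃₄ ^ suc n             ∎

φ-^ : ∀ v n → φ (v Z34.^ n) ≡ φ v ^ n
φ-^ = HomPowers.^-homo ℤ[ζ] ℚζ-ring φ-hom

module Substitute = Horner ℚₚ.+-*-commutativeRing ℚζ-ring ι-hom
module Eval = Horner ℤₚ.+-*-commutativeRing ℤ[ζ] ℤζ.constant-hom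

substitute-φ : ∀ w v → substitute (φ w) (φ v) ≡ φ (Eval.eval w v)
substitute-φ w v = trans (Substitute.eval-map fromℤ (φ w) v)
  (sym (Eval.eval-natural ℚζ-ring φ-hom w v))

Φ₃₄-root : ∀ c → Root c → (ζ₃₄ ^ c) ^ 16 ≡ substitute (ζ₃₄ ^ c) ζ₃₄¹⁶
Φ₃₄-root c root = subst (λ w → w ^ 16 ≡ substitute w ζ₃₄¹⁶) (φ-zeta c) (begin
  φ (zeta c) ^ 16        ≡⟨ φ-^ (zeta c) 16 ⟨
  φ (zeta c Z34.^ 16)    ≡⟨ cong φ (Root.equation root) ⟩
  φ (σℤ c ζ¹⁶)           ≡⟨ substitute-φ (zeta c) ζ¹⁶ ⟨
  substitute (φ (zeta c)) (φ ζ¹⁶) ≡⟨ cong (substitute (φ (zeta c))) φ-ζ¹⁶ ⟩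
  substitute (φ (zeta c)) ζ₃₄¹⁶ ∎)
  where
  ζ¹⁶ : Vec ℤ 16
  ζ¹⁶ = Z34.alternatingℤ 16 ℤ.-1ℤ
  φ-ζ¹⁶ : φ ζ¹⁶ ≡ ζ₃₄¹⁶
  φ-ζ¹⁶ = refl

ζ₃₄^34 : ζ₃₄ ^ 34 ≡ 1#
ζ₃₄^34 = trans (sym (φ-zeta 34)) (cong φ Z34.zeta-34)

infixr 8 _×F_
_×F_ : ℕ → ℚζ₃₄ → ℚζ₃₄
_×F_ = Mult._×_ F.semiring

×F-lookup : ∀ n x → n ×F x ≡ Vec.map (fromℤ (+ n) ℚ.*_) x
×F-lookup zero x = sym (lemma x)
  where
  lemma : ∀ {m} (x : Vec ℚ m) → Vec.map (0ℚ ℚ.*_) x ≡ Vec.replicate m 0ℚ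
  lemma [] = refl
  lemma (a ∷ x) = cong₂ _∷_ (ℚₚ.*-zeroˡ a) (lemma x)
×F-lookup (suc n) x = trans (cong (λ y → x + y) (×F-lookup n x)) (lemma x)
  where
  step : ∀ a → a ℚ.+ fromℤ (+ n) ℚ.* a ≡ fromℤ (+ suc n) ℚ.* a
  step a = begin
    a ℚ.+ fromℤ (+ n) ℚ.* a            ≡⟨ cong (ℚ._+ fromℤ (+ n) ℚ.* a) (ℚₚ.*-identityˡ a) ⟨
    1ℚ ℚ.* a ℚ.+ fromℤ (+ n) ℚ.* a     ≡⟨ ℚₚ.*-distribʳ-+ a 1ℚ (fromℤ (+ n)) ⟨
    (1ℚ ℚ.+ fromℤ (+ n)) ℚ.* a         ≡⟨ cong (ℚ._* a) (IsRingHomomorphism.+-homo fromℤ-hom (+ 1) (+ n)) ⟨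
    fromℤ (+ suc n) ℚ.* a              ∎
  lemma : ∀ {m} (x : Vec ℚ m) → Vec.zipWith ℚ._+_ x (Vec.map (fromℤ (+ n) ℚ.*_) x) ≡ Vec.map (fromℤ (+ suc n) ℚ.*_) x
  lemma [] = refl
  lemma (a ∷ x) = cong₂ _∷_ (step a) (lemma x)

fromℤ-* : ∀ i j → fromℤ (i ℤ.* j) ≡ fromℤ i ℚ.* fromℤ j
fromℤ-* = IsRingHomomorphism.*-homo fromℤ-hom

fromℤ-/ : ∀ d i .{{_ : ℕ.NonZero d}} → fromℤ (+ d) ℚ.* (i ℚ./ d) ≡ fromℤ i
fromℤ-/ (suc d) i = ℚₚ.toℚᵘ-injective
  (ℚᵘₚ.≃-trans (ℚₚ.toℚᵘ-homo-* (fromℤ (+ suc d)) (i ℚ./ suc d))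
  (ℚᵘₚ.≃-trans (ℚᵘₚ.*-cong (toℚᵘ-fromℤ (+ suc d)) (ℚₚ.toℚᵘ-fromℚᵘ (ℚᵘ.mkℚᵘ i d)))
  (ℚᵘₚ.≃-trans (ℚᵘ.*≡* lemma) (ℚᵘₚ.≃-sym (toℚᵘ-fromℤ i)))))
  where
  lemma : (+ suc d ℤ.* i) ℤ.* + 1 ≡ i ℤ.* ℚᵘ.↧ (ℚᵘ.mkℚᵘ (+ suc d) 0 ℚᵘ.* ℚᵘ.mkℚᵘ i d)
  lemma = trans (ℤₚ.*-identityʳ _) (trans (ℤₚ.*-comm (+ suc d) i) (cong (λ t → i ℤ.* + t) (sym (ℕₚ.*-identityˡ (suc d)))))

fromℤ-injective : ∀ {i j} → fromℤ i ≡ fromℤ j → i ≡ j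
fromℤ-injective {i} {j} eq = lemma
  (ℚᵘₚ.≃-trans (ℚᵘₚ.≃-sym (toℚᵘ-fromℤ i)) (ℚᵘₚ.≃-trans (ℚᵘₚ.≃-reflexive (cong ℚ.toℚᵘ eq)) (toℚᵘ-fromℤ j)))
  where
  lemma : ℚᵘ.mkℚᵘ i 0 ℚᵘ.≃ ℚᵘ.mkℚᵘ j 0 → i ≡ j
  lemma (ℚᵘ.*≡* p) = trans (sym (ℤₚ.*-identityʳ i)) (trans p (ℤₚ.*-identityʳ j))

×F-φ/ : ∀ d .{{_ : ℕ.NonZero d}} v → d ×F Vec.map (λ i → i ℚ./ d) v ≡ φ v
×F-φ/ d v = trans (×F-lookup d _) (lemma v)
  where
  lemma : ∀ {m} (v : Vec ℤ m) → Vec.map (fromℤ (+ d) ℚ.*_) (Vec.map (λ i → i ℚ./ d) v) ≡ Vec.map fromℤ v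
  lemma [] = refl
  lemma (i ∷ v) = cong₂ _∷_ (fromℤ-/ d i) (lemma v)

×F-/ : ∀ d .{{_ : ℕ.NonZero d}} {e} x v → e ≡ d → x ≡ Vec.map (λ i → i ℚ./ d) v → e ×F x ≡ φ v
×F-/ d x v e≡d x≡ = subst (λ e → e ×F x ≡ φ v) (sym e≡d) (trans (cong (d ×F_) x≡) (×F-φ/ d v))

D-α : Z34.D ×F α ≡ φ Z34.αℤ
D-α = trans (×F-/ 1557967416600764580522382952407 α Z34.α-coefficients Z34.D-def α-value) (cong φ Z34.αℤ-def)

-- Elementary symmetric functions in the field.

open CommutativeSemigroupProperties F.+-commutativeSemigroup using () renaming (x∙yz≈y∙xz to +-exchange)
open CommutativeSemigroupProperties F.*-commutativeSemigroup using () renaming (x∙yz≈y∙xz to *-exchange)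

sum-++ : ∀ xs ys → sum (xs List.++ ys) ≡ sum xs + sum ys
sum-++ [] ys = sym (F.+-identityˡ (sum ys))
sum-++ (x ∷ xs) ys = trans (cong (λ t → x + t) (sum-++ xs ys)) (sym (F.+-assoc x (sum xs) (sum ys)))

sum-map-product : ∀ x cs → sum (List.map product (List.map (x ∷_) cs)) ≡ x * sum (List.map product cs)
sum-map-product x [] = sym (F.zeroʳ x)
sum-map-product x (c ∷ cs) = trans (cong (λ t → x * product c + t) (sum-map-product x cs))
  (sym (F.distribˡ x (product c) (sum (List.map product cs))))

esym-∷ : ∀ j x xs → esym (suc j) (x ∷ xs) ≡ x * esym j xs + esym (suc j) xs
esym-∷ j x xs = begin
  sum (List.map product (List.map (x ∷_) (choose j xs) List.++ choose (suc j) xs))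
    ≡⟨ cong sum (Listₚ.map-++ product (List.map (x ∷_) (choose j xs)) (choose (suc j) xs)) ⟩
  sum (List.map product (List.map (x ∷_) (choose j xs)) List.++ List.map product (choose (suc j) xs))
    ≡⟨ sum-++ (List.map product (List.map (x ∷_) (choose j xs))) (List.map product (choose (suc j) xs)) ⟩
  sum (List.map product (List.map (x ∷_) (choose j xs))) + esym (suc j) xs
    ≡⟨ cong (λ t → t + esym (suc j) xs) (sum-map-product x (choose j xs)) ⟩
  x * esym j xs + esym (suc j) xs ∎

esym-0 : ∀ xs → esym 0 xs ≡ 1#
esym-0 xs = F.+-identityʳ 1#

-- Needed because a Galois automorphism permutes the eight conjugates, whereas the symmetric
-- functions are defined by positions in a list.
esym-↭ : ∀ {xs ys} → xs ↭ ys → ∀ j → esym j xs ≡ esym j ys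
esym-↭ {xs} {ys} p zero = trans (esym-0 xs) (sym (esym-0 ys))
esym-↭ Perm.refl (suc j) = refl
esym-↭ (Perm.prep {xs} {ys} x p) (suc j) = begin
  esym (suc j) (x ∷ xs)             ≡⟨ esym-∷ j x xs ⟩
  x * esym j xs + esym (suc j) xs   ≡⟨ cong₂ (λ s t → x * s + t) (esym-↭ p j) (esym-↭ p (suc j)) ⟩
  x * esym j ys + esym (suc j) ys   ≡⟨ esym-∷ j x ys ⟨
  esym (suc j) (x ∷ ys)             ∎
esym-↭ (Perm.swap {xs} {ys} x y p) (suc zero) = begin
  esym 1 (x ∷ y ∷ xs)                        ≡⟨ expand x y xs ⟩
  x * 1# + (y * 1# + esym 1 xs)              ≡⟨ +-exchange (x * 1#) (y * 1#) (esym 1 xs) ⟩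
  y * 1# + (x * 1# + esym 1 xs)              ≡⟨ cong (λ t → y * 1# + (x * 1# + t)) (esym-↭ p 1) ⟩
  y * 1# + (x * 1# + esym 1 ys)              ≡⟨ expand y x ys ⟨
  esym 1 (y ∷ x ∷ ys)                        ∎
  where
  expand : ∀ x y xs → esym 1 (x ∷ y ∷ xs) ≡ x * 1# + (y * 1# + esym 1 xs)
  expand x y xs = trans (esym-∷ 0 x (y ∷ xs)) (cong₂ (λ s t → x * s + t) (esym-0 (y ∷ xs))
    (trans (esym-∷ 0 y xs) (cong (λ s → y * s + esym 1 xs) (esym-0 xs))))
esym-↭ (Perm.swap {xs} {ys} x y p) (suc (suc j)) = begin
  esym (suc (suc j)) (x ∷ y ∷ xs)
    ≡⟨ expand x y xs ⟩
  (x * (y * esym j xs) + x * esym (suc j) xs) + (y * esym (suc j) xs + esym (suc (suc j)) xs)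
    ≡⟨ cong₂ _+_ (cong₂ _+_ (trans (*-exchange x y (esym j xs)) (cong (λ t → y * (x * t)) (esym-↭ p j)))
                            (cong (λ t → x * t) (esym-↭ p (suc j))))
                 (cong₂ _+_ (cong (λ t → y * t) (esym-↭ p (suc j))) (esym-↭ p (suc (suc j)))) ⟩
  (y * (x * esym j ys) + x * esym (suc j) ys) + (y * esym (suc j) ys + esym (suc (suc j)) ys)
    ≡⟨ interchange (y * (x * esym j ys)) (x * esym (suc j) ys) (y * esym (suc j) ys) (esym (suc (suc j)) ys) ⟩
  (y * (x * esym j ys) + y * esym (suc j) ys) + (x * esym (suc j) ys + esym (suc (suc j)) ys)
    ≡⟨ expand y x ys ⟨
  esym (suc (suc j)) (y ∷ x ∷ ys) ∎
  where
  open CommutativeSemigroupProperties F.+-commutativeSemigroup using (interchange)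
  expand : ∀ x y xs → esym (suc (suc j)) (x ∷ y ∷ xs) ≡
    (x * (y * esym j xs) + x * esym (suc j) xs) + (y * esym (suc j) xs + esym (suc (suc j)) xs)
  expand x y xs = trans (esym-∷ (suc j) x (y ∷ xs)) (cong₂ _+_
    (trans (cong (λ t → x * t) (esym-∷ j y xs)) (F.distribˡ x (y * esym j xs) (esym (suc j) xs)))
    (esym-∷ (suc j) y xs))
esym-↭ (Perm.trans p q) (suc j) = trans (esym-↭ p (suc j)) (esym-↭ q (suc j))

module _ {g : ℚζ₃₄ → ℚζ₃₄} (g-hom : Hom ℚζ-ring ℚζ-ring g) where
  private module G = IsRingHomomorphism g-hom

  esym-homo : ∀ j xs → g (esym j xs) ≡ esym j (List.map g xs)
  esym-homo zero xs = trans (cong g (esym-0 xs)) (trans G.1#-homo (sym (esym-0 (List.map g xs))))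
  esym-homo (suc j) [] = G.0#-homo
  esym-homo (suc j) (x ∷ xs) = begin
    g (esym (suc j) (x ∷ xs))
      ≡⟨ cong g (esym-∷ j x xs) ⟩
    g (x * esym j xs + esym (suc j) xs)
      ≡⟨ G.+-homo (x * esym j xs) (esym (suc j) xs) ⟩
    g (x * esym j xs) + g (esym (suc j) xs)
      ≡⟨ cong₂ _+_ (trans (G.*-homo x (esym j xs)) (cong (λ t → g x * t) (esym-homo j xs))) (esym-homo (suc j) xs) ⟩
    g x * esym j (List.map g xs) + esym (suc j) (List.map g xs)
      ≡⟨ esym-∷ j (g x) (List.map g xs) ⟨
    esym (suc j) (List.map g (x ∷ xs)) ∎

  ×F-homo : ∀ n x → g (n ×F x) ≡ n ×F g x
  ×F-homo zero x = G.0#-homo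
  ×F-homo (suc n) x = trans (G.+-homo x (n ×F x)) (cong (λ t → g x + t) (×F-homo n x))

-- The Galois action, and rationality of the symmetric functions.

module ℚζ-root = AdjoinRoot ℚₚ.+-*-commutativeRing 15 ζ₃₄¹⁶

substitute-ι : ∀ w q → substitute w (ι q) ≡ ι q
substitute-ι w q = begin
  ι q + w * substitute′ (Vec.replicate 15 0ℚ)  ≡⟨ cong (λ t → ι q + w * t) (Substitute.eval-𝟎 w 15) ⟩
  ι q + w * 0#                                 ≡⟨ cong (λ t → ι q + t) (F.zeroʳ w) ⟩
  ι q + 0#                                     ≡⟨ F.+-identityʳ (ι q) ⟩
  ι q                                          ∎
  where
  substitute′ : ∀ {n} → Vec ℚ n → ℚζ₃₄
  substitute′ = Substitute.eval w

substitute-substitute : ∀ {g} → Hom ℚζ-ring ℚζ-ring g → (∀ q → g (ι q) ≡ ι q) →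
  ∀ w {n} (x : Vec ℚ n) → g (Substitute.eval w x) ≡ Substitute.eval (g w) x
substitute-substitute {g} g-hom fix w [] = IsRingHomomorphism.0#-homo g-hom
substitute-substitute {g} g-hom fix w (a ∷ x) = begin
  g (ι a + w * Substitute.eval w x)
    ≡⟨ G.+-homo (ι a) (w * Substitute.eval w x) ⟩
  g (ι a) + g (w * Substitute.eval w x)
    ≡⟨ cong₂ _+_ (fix a) (trans (G.*-homo w (Substitute.eval w x)) (cong (λ t → g w * t) (substitute-substitute g-hom fix w x))) ⟩
  ι a + g w * Substitute.eval (g w) x ∎
  where module G = IsRingHomomorphism g-hom

substitute-ζ₃₄ : ∀ w → w ^ 16 ≡ substitute w ζ₃₄¹⁶ → ∀ z → z ≡ ℚζ.⟨x⟩ → substitute w z ≡ w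
substitute-ζ₃₄ w root z refl = begin
  substitute w (ℚζ.shift ℚζ.𝟏)   ≡⟨ Substitute.Hom-eval.ev-shift 15 ζ₃₄¹⁶ w root ℚζ.𝟏 ⟩
  w * substitute w ℚζ.𝟏          ≡⟨ cong (λ t → w * t) (substitute-ι w 1ℚ) ⟩
  w * 1#                         ≡⟨ F.*-identityʳ w ⟩
  w                              ∎

^-periodic : ∀ w k .{{_ : ℕ.NonZero k}} → w ^ k ≡ 1# → ∀ m n → m % k ≡ n % k → w ^ m ≡ w ^ n
^-periodic w k order m n eq = ^-≡% {w} {k} order {m} {n} eq

substitute-⟨x⟩ : ∀ w → w ≡ ℚζ.⟨x⟩ → ∀ x → substitute w x ≡ x
substitute-⟨x⟩ w eq x = strict (ℚζ-root.eval≈⟨x⟩ w (≡⇒Pointwise-≡ eq) x)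

abstract
  -- The automorphism ζ ↦ ζⁿ, for n prime to 34.
  O : ℕ → ℚζ₃₄ → ℚζ₃₄
  O n y = substitute (ζ₃₄ ^ n) y

  σ≡O : ∀ c n y → c ℤ.%ℕ 34 ≡ n → σ c y ≡ O n y
  σ≡O c n y refl = refl

  O-hom : ∀ {c} → Z34.Root c → Hom ℚζ-ring ℚζ-ring (O c)
  O-hom {c} root = mkHom ℚζ-ring ℚζ-ring (O c) (cong (O c)) H.+-homo H.*-homo H.1#-homo
    where module H = IsRingHomomorphism (Substitute.Hom-eval.eval-hom 15 ζ₃₄¹⁶ (ζ₃₄ ^ c) (Φ₃₄-root c root))

  O-φ : ∀ c v → O c (φ v) ≡ φ (σℤ c v)
  O-φ c v = trans (cong (λ w → substitute w (φ v)) (sym (φ-zeta c))) (substitute-φ (zeta c) v)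

  O≡substitute : ∀ n y → O n y ≡ substitute (ζ₃₄ ^ n) y
  O≡substitute n y = refl

  O-ζ^ : ∀ {c} → Z34.Root c → ∀ n → O c (ζ₃₄ ^ n) ≡ ζ₃₄ ^ (c ℕ.* n)
  O-ζ^ {c} root n = begin
    O c (ζ₃₄ ^ n)      ≡⟨ HomPowers.^-homo ℚζ-ring ℚζ-ring (O-hom root) ζ₃₄ n ⟩
    (O c ζ₃₄) ^ n      ≡⟨ cong (_^ n) (substitute-ζ₃₄ (ζ₃₄ ^ c) (Φ₃₄-root c root) ζ₃₄ ζ₃₄≡⟨x⟩) ⟩
    (ζ₃₄ ^ c) ^ n      ≡⟨ ^-assocʳ ζ₃₄ c n ⟩
    ζ₃₄ ^ (c ℕ.* n)    ∎

  O-O : ∀ {c} → Z34.Root c → ∀ n x → O c (O n x) ≡ O (c ℕ.* n) x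
  O-O {c} root n x = trans (substitute-substitute (O-hom root) (substitute-ι (ζ₃₄ ^ c)) (ζ₃₄ ^ n) x)
    (cong (λ w → substitute w x) (O-ζ^ root n))

  O-≡% : ∀ m n → m % 34 ≡ n % 34 → ∀ x → O m x ≡ O n x
  O-≡% m n eq x = cong (λ w → substitute w x) (^-periodic ζ₃₄ 34 ζ₃₄^34 m n eq)

  O-1 : ∀ x → O 1 x ≡ x
  O-1 x = trans (cong (λ w → substitute w x) (F.*-identityʳ ζ₃₄)) (substitute-⟨x⟩ ζ₃₄ ζ₃₄≡⟨x⟩ x)

Rational : ℚζ₃₄ → Set
Rational x = ∃[ q ] x ≡ ι q

rational-+ : ∀ {x y} → Rational x → Rational y → Rational (x + y)
rational-+ (p , refl) (q , refl) = p ℚ.+ q , sym (IsRingHomomorphism.+-homo ι-hom p q)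

rational-* : ∀ {x y} → Rational x → Rational y → Rational (x * y)
rational-* (p , refl) (q , refl) = p ℚ.* q , sym (IsRingHomomorphism.*-homo ι-hom p q)

rational-÷ : ∀ d .{{_ : ℕ.NonZero d}} x → Rational (d ×F x) → Rational x
rational-÷ d x (q , eq) = (+ 1 ℚ./ d) ℚ.* q , (begin
  x
    ≡⟨ lemma x ⟨
  Vec.map ((+ 1 ℚ./ d) ℚ.*_) (Vec.map (fromℤ (+ d) ℚ.*_) x)
    ≡⟨ cong (Vec.map ((+ 1 ℚ./ d) ℚ.*_)) (trans (sym (×F-lookup d x)) eq) ⟩
  Vec.map ((+ 1 ℚ./ d) ℚ.*_) (ι q)
    ≡⟨ cong (((+ 1 ℚ./ d) ℚ.* q) ∷_) (zeros 15) ⟩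
  ι ((+ 1 ℚ./ d) ℚ.* q) ∎)
  where
  zeros : ∀ n → Vec.map ((+ 1 ℚ./ d) ℚ.*_) (Vec.replicate n 0ℚ) ≡ Vec.replicate n 0ℚ
  zeros zero = refl
  zeros (suc n) = cong₂ _∷_ (ℚₚ.*-zeroʳ (+ 1 ℚ./ d)) (zeros n)
  cancel : ∀ a → (+ 1 ℚ./ d) ℚ.* (fromℤ (+ d) ℚ.* a) ≡ a
  cancel a = trans (sym (ℚₚ.*-assoc (+ 1 ℚ./ d) (fromℤ (+ d)) a))
    (trans (cong (ℚ._* a) (trans (ℚₚ.*-comm (+ 1 ℚ./ d) (fromℤ (+ d))) (fromℤ-/ d (+ 1)))) (ℚₚ.*-identityˡ a))
  lemma : ∀ {n} (x : Vec ℚ n) → Vec.map ((+ 1 ℚ./ d) ℚ.*_) (Vec.map (fromℤ (+ d) ℚ.*_) x) ≡ x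
  lemma [] = refl
  lemma (a ∷ x) = cong₂ _∷_ (cancel a) (lemma x)

-- An x fixed by all substitutions ζ ↦ wᵢ satisfies m x = x(w₀) + ⋯ + x(wₘ₋₁), a rational
-- combination of power sums of the wᵢ. Rational power sums therefore make x rational.
module Trace (w : ℕ → ℚζ₃₄) (m : ℕ) (power-sums : ∀ e → Rational (∑ m (λ i → w i ^ e))) where

  ∑-+ : ∀ m f g → ∑ m (λ i → f i + g i) ≡ ∑ m f + ∑ m g
  ∑-+ zero f g = sym (F.+-identityʳ 0#)
  ∑-+ (suc m) f g = trans (cong (λ t → f 0 + g 0 + t) (∑-+ m (f ∘ suc) (g ∘ suc)))
    (interchange (f 0) (g 0) (∑ m (f ∘ suc)) (∑ m (g ∘ suc)))
    where open CommutativeSemigroupProperties F.+-commutativeSemigroup using (interchange)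

  weighted-step : ∀ (b : ℚζ₃₄) (u : ℕ → ℚζ₃₄) e →
    ∑ m (λ i → w i ^ e * (b + w i * u i)) ≡ b * ∑ m (λ i → w i ^ e) + ∑ m (λ i → w i ^ suc e * u i)
  weighted-step b u e = begin
    ∑ m (λ i → w i ^ e * (b + w i * u i))
      ≡⟨ ∑-cong m {λ i → w i ^ e * (b + w i * u i)} {λ i → b * w i ^ e + w i ^ suc e * u i} (λ i _ → pointwise (w i) (u i)) ⟩
    ∑ m (λ i → b * w i ^ e + w i ^ suc e * u i)
      ≡⟨ ∑-+ m (λ i → b * w i ^ e) (λ i → w i ^ suc e * u i) ⟩
    ∑ m (λ i → b * w i ^ e) + ∑ m (λ i → w i ^ suc e * u i)
      ≡⟨ cong (λ t → t + ∑ m (λ i → w i ^ suc e * u i)) (sym (*-distribˡ-sum {m} b (λ i → w (toℕ i) ^ e))) ⟩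
    b * ∑ m (λ i → w i ^ e) + ∑ m (λ i → w i ^ suc e * u i) ∎
    where
    pointwise : ∀ z t → z ^ e * (b + z * t) ≡ b * z ^ e + z ^ suc e * t
    pointwise z t = trans (F.distribˡ (z ^ e) b (z * t)) (cong₂ _+_ (F.*-comm (z ^ e) b)
      (trans (sym (F.*-assoc (z ^ e) z t)) (cong (λ s → s * t) (F.*-comm (z ^ e) z))))

  -- The weight wᵢᵉ is what makes the induction close: each step of Horner's rule splits off one
  -- coefficient and raises e by one.
  weighted : ∀ {n} (x : Vec ℚ n) e → Rational (∑ m (λ i → w i ^ e * Substitute.eval (w i) x))
  weighted [] e = 0ℚ , zeros m w
    where
    zeros : ∀ m (w : ℕ → ℚζ₃₄) → ∑ m (λ i → w i ^ e * 0#) ≡ 0#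
    zeros zero w = refl
    zeros (suc m) w = trans (cong₂ _+_ (F.zeroʳ (w 0 ^ e)) (zeros m (w ∘ suc))) (F.+-identityˡ 0#)
  weighted (a ∷ x) e = subst Rational (sym (weighted-step (ι a) (λ i → Substitute.eval (w i) x) e))
    (rational-+ (rational-* (a , refl) (power-sums e)) (weighted x (suc e)))

  ∑-constant : ∀ m x → ∑ m (λ _ → x) ≡ m ×F x
  ∑-constant zero x = refl
  ∑-constant (suc m) x = cong (λ t → x + t) (∑-constant m x)

  fixed⇒rational : .{{_ : ℕ.NonZero m}} → ∀ x → (∀ i → substitute (w i) x ≡ x) → Rational x
  fixed⇒rational x fixed = rational-÷ m x (subst Rational eq (weighted x 0))
    where
    substitute≡eval : ∀ w → substitute w x ≡ Substitute.eval w x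
    substitute≡eval w = refl
    ^0 : ∀ z t → z ^ 0 * t ≡ t
    ^0 z t = F.*-identityˡ t
    eq : ∑ m (λ i → w i ^ 0 * Substitute.eval (w i) x) ≡ m ×F x
    eq = trans (∑-cong m {λ i → w i ^ 0 * Substitute.eval (w i) x} {λ _ → x}
      (λ i _ → trans (^0 (w i) (Substitute.eval (w i) x)) (trans (sym (substitute≡eval (w i))) (fixed i)))) (∑-constant m x)

root-3 : Z34.Root 3
root-3 = All.head Z34.roots

root-33 : Z34.Root 33
root-33 with Z34.roots
... | _ ∷ _ ∷ _ ∷ _ ∷ _ ∷ _ ∷ _ ∷ r ∷ [] = r

abstract
  ζ^3^ : ℕ → ℚζ₃₄
  ζ^3^ i = ζ₃₄ ^ (3 ℕ.^ i)

  ζ^3^≡ : ∀ i → ζ^3^ i ≡ ζ₃₄ ^ (3 ℕ.^ i)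
  ζ^3^≡ i = refl

φ-rational : ∀ {v i} → v ≡ ℤζ.constant i → Rational (φ v)
φ-rational {v} {i} eq = fromℤ i , trans (cong φ eq) (φ-constant i)

power-sums : ∀ e → Rational (∑ 16 (λ i → ζ^3^ i ^ e))
power-sums e = subst Rational (sym (sums 16)) (φ-rational (Z34.trace-rational (m%n<n e 34)))
  where
  %-absorb : ∀ i → (3 ℕ.^ i ℕ.* (e % 34)) % 34 ≡ (3 ℕ.^ i ℕ.* e) % 34
  %-absorb i = *-≡% 34 (3 ℕ.^ i) {e % 34} {e} (m%n%n≡m%n e 34)
  powers : ∀ i → ζ^3^ i ^ e ≡ φ (zeta ((3 ℕ.^ i ℕ.* (e % 34)) % 34))
  powers i = trans (trans (cong (_^ e) (ζ^3^≡ i)) (^-assocʳ ζ₃₄ (3 ℕ.^ i) e)) (trans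
    (^-periodic ζ₃₄ 34 ζ₃₄^34 (3 ℕ.^ i ℕ.* e) ((3 ℕ.^ i ℕ.* (e % 34)) % 34)
      (trans (sym (%-absorb i)) (sym (m%n%n≡m%n (3 ℕ.^ i ℕ.* (e % 34)) 34))))
    (sym (φ-zeta ((3 ℕ.^ i ℕ.* (e % 34)) % 34))))
  sums : ∀ m → ∑ m (λ i → ζ^3^ i ^ e) ≡
    φ (Summation.∑ ℤ[ζ] m (λ i → zeta ((3 ℕ.^ i ℕ.* (e % 34)) % 34)))
  sums m = trans (∑-cong m {λ i → ζ^3^ i ^ e} {λ i → φ (zeta ((3 ℕ.^ i ℕ.* (e % 34)) % 34))} (λ i _ → powers i))
    (sym (HomSum.∑-homo ℤ[ζ] ℚζ-ring φ-hom m (λ i → zeta ((3 ℕ.^ i ℕ.* (e % 34)) % 34))))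

-- σ₃ generates the Galois group, so being fixed by it means being fixed by all 16 automorphisms ζ ↦
-- ζ^(3ⁱ).
fixed⇒rational : ∀ x → O 3 x ≡ x → Rational x
fixed⇒rational x eq = Trace.fixed⇒rational ζ^3^ 16 power-sums x
  (λ i → trans (cong (λ w → substitute w x) (ζ^3^≡ i)) (trans (sym (O≡substitute (3 ℕ.^ i) x)) (fixed i)))
  where
  fixed : ∀ i → O (3 ℕ.^ i) x ≡ x
  fixed zero = O-1 x
  fixed (suc i) = trans (sym (O-O root-3 (3 ℕ.^ i) x)) (trans (cong (O 3) (fixed i)) eq)

orbit : ℚζ₃₄ → List ℚζ₃₄
orbit y = y ∷ List.map (λ i → σ (+ (2 ℕ.* i ℕ.∸ 1)) y) (2 ∷ 3 ∷ 4 ∷ 5 ∷ 6 ∷ 7 ∷ 8 ∷ [])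

indices : List ℕ
indices = 1 ∷ 3 ∷ 5 ∷ 7 ∷ 9 ∷ 11 ∷ 13 ∷ 15 ∷ []

map-σ≡O : ∀ y is → List.map (λ i → σ (+ (2 ℕ.* i ℕ.∸ 1)) y) is ≡
  List.map (λ c → O c y) (List.map (λ i → (2 ℕ.* i ℕ.∸ 1) % 34) is)
map-σ≡O y [] = refl
map-σ≡O y (i ∷ is) = cong₂ _∷_ (σ≡O (+ (2 ℕ.* i ℕ.∸ 1)) ((2 ℕ.* i ℕ.∸ 1) % 34) y refl) (map-σ≡O y is)

orbit≡O : ∀ y → orbit y ≡ List.map (λ c → O c y) indices
orbit≡O y = cong₂ _∷_ (sym (O-1 y)) (map-σ≡O y (2 ∷ 3 ∷ 4 ∷ 5 ∷ 6 ∷ 7 ∷ 8 ∷ []))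

module _ {y : ℚζ₃₄} (real : O 33 y ≡ y) where

  O-≡±% : ∀ {c} → Z34.Root c → ∀ n → n % 34 ≡ (c ℕ.* 33) % 34 → O n y ≡ O c y
  O-≡±% {c} root n eq = trans (O-≡% n (c ℕ.* 33) eq y) (trans (sym (O-O root 33 y)) (cong (O c) real))

  O-3-orbit : List.map (O 3) (orbit y) ↭ orbit y
  O-3-orbit = Perm.↭-trans (Perm.↭-reflexive images) (Perm.↭-trans (Permₚ.map⁺ (λ c → O c y) permuted)
    (Perm.↭-reflexive (sym (orbit≡O y))))
    where
    -- Three times each index, reduced modulo 34 and up to sign: 21 ≡ -13, 27 ≡ -7, 33 ≡ -1, 39 ≡ 5
    -- and 45 ≡ 11. The sign does not change the conjugate of a real element.
    permuted : 3 ∷ 9 ∷ 15 ∷ 13 ∷ 7 ∷ 1 ∷ 5 ∷ 11 ∷ [] ↭ indices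
    permuted = sorted⇒↭ refl
    step : ∀ c {t} → O (3 ℕ.* c) y ≡ t → O 3 (O c y) ≡ t
    step c eq = trans (O-O root-3 c y) eq
    images : List.map (O 3) (orbit y) ≡ List.map (λ c → O c y) (3 ∷ 9 ∷ 15 ∷ 13 ∷ 7 ∷ 1 ∷ 5 ∷ 11 ∷ [])
    images = trans (cong (List.map (O 3)) (orbit≡O y)) (go Z34.roots)
      where
      go : All Z34.Root (3 ∷ 5 ∷ 7 ∷ 9 ∷ 11 ∷ 13 ∷ 15 ∷ 33 ∷ []) →
        List.map (O 3) (List.map (λ c → O c y) indices) ≡ List.map (λ c → O c y) (3 ∷ 9 ∷ 15 ∷ 13 ∷ 7 ∷ 1 ∷ 5 ∷ 11 ∷ [])
      go (r₃ ∷ r₅ ∷ r₇ ∷ r₉ ∷ r₁₁ ∷ r₁₃ ∷ r₁₅ ∷ r₃₃ ∷ []) =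
        cong₂ _∷_ (step 1 refl) (cong₂ _∷_ (step 3 refl) (cong₂ _∷_ (step 5 refl)
        (cong₂ _∷_ (step 7 (O-≡±% r₁₃ 21 refl)) (cong₂ _∷_ (step 9 (O-≡±% r₇ 27 refl))
        (cong₂ _∷_ (step 11 (trans real (sym (O-1 y)))) (cong₂ _∷_ (step 13 (O-≡% 39 5 refl y))
        (cong₂ _∷_ (step 15 (O-≡% 45 11 refl y)) refl)))))))

  esym-orbit-rational : ∀ j → Rational (esym j (orbit y))
  esym-orbit-rational j = fixed⇒rational (esym j (orbit y))
    (trans (esym-homo (O-hom root-3) j (orbit y)) (esym-↭ O-3-orbit j))

conj≡O : ∀ x → conj x ≡ O 33 x
conj≡O x = σ≡O (- + 1) 33 x refl

conj-conj : ∀ x → conj (conj x) ≡ x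
conj-conj x = trans (conj≡O (conj x)) (trans (cong (O 33) (conj≡O x))
  (trans (O-O root-33 33 x) (trans (O-≡% 1089 1 refl x) (O-1 x))))

conj-^ : ∀ x n → O 33 (x ^ n) ≡ conj x ^ n
conj-^ x n = trans (HomPowers.^-homo ℚζ-ring ℚζ-ring (O-hom root-33) x n) (cong (_^ n) (sym (conj≡O x)))

real-part : ∀ x n → O 33 (x ^ n + conj x ^ n) ≡ x ^ n + conj x ^ n
real-part x n = begin
  O 33 (x ^ n + conj x ^ n)          ≡⟨ IsRingHomomorphism.+-homo (O-hom root-33) (x ^ n) (conj x ^ n) ⟩
  O 33 (x ^ n) + O 33 (conj x ^ n)   ≡⟨ cong₂ _+_ (conj-^ x n) (trans (conj-^ (conj x) n) (cong (_^ n) (conj-conj x))) ⟩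
  conj x ^ n + x ^ n                 ≡⟨ F.+-comm (conj x ^ n) (x ^ n) ⟩
  x ^ n + conj x ^ n                 ∎

S-rational : ∀ k j → Rational (S k j)
S-rational k j = esym-orbit-rational {α₁ k} (real-part α (34 ℕ.^ k)) j

-- Denominators, and reduction of field elements modulo a prime.

×F-ι : ∀ n q → n ×F ι q ≡ ι (fromℤ (+ n) ℚ.* q)
×F-ι n q = trans (×F-lookup n (ι q)) (cong ((fromℤ (+ n) ℚ.* q) ∷_) (zeros 15))
  where
  zeros : ∀ m → Vec.map (fromℤ (+ n) ℚ.*_) (Vec.replicate m 0ℚ) ≡ Vec.replicate m 0ℚ
  zeros zero = refl
  zeros (suc m) = cong₂ _∷_ (ℚₚ.*-zeroʳ (fromℤ (+ n))) (zeros m)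

head-×F : ∀ n x → Vec.head (n ×F x) ≡ fromℤ (+ n) ℚ.* Vec.head x
head-×F n x = trans (cong Vec.head (×F-lookup n x)) (head-map x)
  where
  head-map : ∀ (x : ℚζ₃₄) → Vec.head (Vec.map (fromℤ (+ n) ℚ.*_) x) ≡ fromℤ (+ n) ℚ.* Vec.head x
  head-map (a ∷ x) = refl

head-φ : ∀ v → Vec.head (φ v) ≡ fromℤ (Vec.head v)
head-φ (i ∷ v) = refl

denominator-* : ∀ t → fromℤ (+ ℚ.denominatorℕ t) ℚ.* t ≡ fromℤ (ℚ.numerator t)
denominator-* t = trans (cong (fromℤ (+ ℚ.denominatorℕ t) ℚ.*_) (sym (ℚₚ.↥p/↧p≡p t)))
  (fromℤ-/ (ℚ.denominatorℕ t) (ℚ.numerator t))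

numerator⊥denominator : ∀ t → Coprime ℤ.∣ ℚ.numerator t ∣ (ℚ.denominatorℕ t)
numerator⊥denominator (ℚ.mkℚ _ _ c) = Coprimality.recompute c

-- The reduced denominator divides d times the numerator and is prime to the numerator. This turns
-- any denominator prime to p into the reduced one required by the congruences of the statement.
denominator-∣ : ∀ t d i → fromℤ (+ d) ℚ.* t ≡ fromℤ i → ℚ.denominatorℕ t ∣ d
denominator-∣ t d i eq = Coprimality.coprime-divisor
  (Coprimality.sym (numerator⊥denominator t))
  (divides ℤ.∣ i ∣ (trans (ℕₚ.*-comm ℤ.∣ n ∣ d) (trans (sym (ℤₚ.abs-* (+ d) n)) (trans (cong ℤ.∣_∣ ints)
    (trans (ℤₚ.abs-* e i) (ℕₚ.*-comm (ℚ.denominatorℕ t) ℤ.∣ i ∣))))))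
  where
  n = ℚ.numerator t
  e = + ℚ.denominatorℕ t
  ints : + d ℤ.* n ≡ e ℤ.* i
  ints = fromℤ-injective (begin
    fromℤ (+ d ℤ.* n)                 ≡⟨ fromℤ-* (+ d) n ⟩
    fromℤ (+ d) ℚ.* fromℤ n           ≡⟨ cong (fromℤ (+ d) ℚ.*_) (denominator-* t) ⟨
    fromℤ (+ d) ℚ.* (fromℤ e ℚ.* t)   ≡⟨ trans (sym (ℚₚ.*-assoc (fromℤ (+ d)) (fromℤ e) t)) (trans (cong (ℚ._* t) (ℚₚ.*-comm (fromℤ (+ d)) (fromℤ e))) (ℚₚ.*-assoc (fromℤ e) (fromℤ (+ d)) t)) ⟩
    fromℤ e ℚ.* (fromℤ (+ d) ℚ.* t)   ≡⟨ cong (fromℤ e ℚ.*_) eq ⟩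
    fromℤ e ℚ.* fromℤ i               ≡⟨ fromℤ-* e i ⟨
    fromℤ (e ℤ.* i)                   ∎)
    where open ≡-Reasoning

D-nonZero : NonZero Z34.D
D-nonZero = subst NonZero (sym Z34.D-def) _

D-conj-α : Z34.D ×F conj α ≡ φ Z34.ᾱℤ
D-conj-α = lemma Z34.D α Z34.αℤ Z34.ᾱℤ D-α Z34.conj-α
  where
  lemma : ∀ d x v w → d ×F x ≡ φ v → σℤ 33 v ≡ w → d ×F conj x ≡ φ w
  lemma d x v w eq eq′ = begin
    d ×F conj x    ≡⟨ cong (d ×F_) (conj≡O x) ⟩
    d ×F O 33 x    ≡⟨ ×F-homo (O-hom root-33) d x ⟨
    O 33 (d ×F x)  ≡⟨ cong (O 33) eq ⟩
    O 33 (φ v)     ≡⟨ trans (O-φ 33 v) (cong φ eq′) ⟩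
    φ w            ∎
    where open ≡-Reasoning

-- The denominator of α is a power of 103, so p prime to 103 places α and its conjugates in the
-- localised ring.
module ModPrime (p : ℕ) (p-prime : Prime p) (103⊥p : Coprime 103 p) where
  module L = Localised ℤ[ζ] ℚζ-ring φ-hom p
  open L using (Element; Integral; _≋_; difference; ≈⇒≋; localised; ψᴸ; ψᴸ-hom)
  module K = CommutativeRing localised
  open Image localised ψᴸ-hom using (h; h-ℕ; h-hom; z; z^34≈1; ψ-zeta; ψ-zeta-%; ψ-frobenius)
  open Mult K.semiring using () renaming (_×_ to _×ᴷ_)

  instance
    p-nonZero : NonZero p
    p-nonZero = prime⇒nonZero p-prime

  D⊥p : Coprime Z34.D p
  D⊥p = subst (λ d → Coprime d p) (sym Z34.D-def) (coprime-^ 103⊥p 15)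

  ×ᴷ-element : ∀ d (x : Element) v → d ×F proj₁ x ≡ φ v → (d ×ᴷ K.1#) K.* x ≋ ψᴸ v
  ×ᴷ-element d x v eq = K.trans {(d ×ᴷ K.1#) K.* x} {d ×ᴷ x} {ψᴸ v} (K.sym {d ×ᴷ x} {(d ×ᴷ K.1#) K.* x} (Powers.×≈×1* localised d x))
    (≈⇒≋ (trans (L.·ᴸ-proj₁ d x) eq))

  inverse : ∀ d .{{_ : NonZero d}} → Coprime d p → ∃[ e ] h (+ d) K.* e ≋ K.1#
  inverse d d⊥p = e , K.trans {h (+ d) K.* e} {(d ×ᴷ K.1#) K.* e} {K.1#}
    (K.*-congʳ {e} {h (+ d)} {d ×ᴷ K.1#} (h-ℕ d))
    (K.trans {(d ×ᴷ K.1#) K.* e} {ψᴸ ℤζ.𝟏} {K.1#} (×ᴷ-element d e ℤζ.𝟏 (×F-φ/ d ℤζ.𝟏)) (IsRingHomomorphism.1#-homo ψᴸ-hom))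
    where
    e : Element
    e = Vec.map (λ i → i ℚ./ d) ℤζ.𝟏 , d , d⊥p , ℤζ.𝟏 , ×F-φ/ d ℤζ.𝟏


  inverse-ψ : ∀ d .{{_ : NonZero d}} → Coprime d p → ∀ v → v ≡ ℤζ.constant (+ d) → ∃[ e ] ψᴸ v K.* e ≋ K.1#
  inverse-ψ d d⊥p v v≡ = lemma (inverse d d⊥p)
    where
    lemma : (∃[ e ] h (+ d) K.* e ≋ K.1#) → ∃[ e ] ψᴸ v K.* e ≋ K.1#
    lemma (e , eq) = e , subst (λ v → ψᴸ v K.* e ≋ K.1#) (sym v≡) eq

  abstract
    103ℤ : Vec ℤ 16
    103ℤ = ℤζ.constant (+ 103)

    103ℤ-def : 103ℤ ≡ ℤζ.constant (+ 103)
    103ℤ-def = refl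

    D-inverse : ∃[ e ] ψᴸ Z34.Dℤ K.* e ≋ K.1#
    D-inverse = inverse-ψ Z34.D {{D-nonZero}} D⊥p Z34.Dℤ Z34.Dℤ-def

    103-inverse : ∃[ e ] ψᴸ 103ℤ K.* e ≋ K.1#
    103-inverse = inverse-ψ 103 103⊥p 103ℤ 103ℤ-def

  private
    Dℤ-element : ∀ (x : Element) v → Z34.D ×F proj₁ x ≡ φ v → ψᴸ Z34.Dℤ K.* x ≋ ψᴸ v
    Dℤ-element x v eq = subst (λ w → ψᴸ w K.* x ≋ ψᴸ v) (sym Z34.Dℤ-def)
      (K.trans {h (+ Z34.D) K.* x} {(Z34.D ×ᴷ K.1#) K.* x} {ψᴸ v} (K.*-congʳ {x} {h (+ Z34.D)} {Z34.D ×ᴷ K.1#} (h-ℕ Z34.D))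
        (×ᴷ-element Z34.D x v eq))

  element : ∀ x → Integral x → Σ[ e ∈ Element ] proj₁ e ≡ x
  element x ix = (x , ix) , refl

  abstract
    α-element : Σ[ e ∈ Element ] proj₁ e ≡ α
    α-element = element α (Z34.D , D⊥p , Z34.αℤ , D-α)

    ᾱ-element : Σ[ e ∈ Element ] proj₁ e ≡ conj α
    ᾱ-element = element (conj α) (Z34.D , D⊥p , Z34.ᾱℤ , D-conj-α)

  a a′ : Element
  a = proj₁ α-element
  a′ = proj₁ ᾱ-element

  proj₁-a : proj₁ a ≡ α
  proj₁-a = proj₂ α-element

  proj₁-a′ : proj₁ a′ ≡ conj α
  proj₁-a′ = proj₂ ᾱ-element

  D-a : ψᴸ Z34.Dℤ K.* a ≋ ψᴸ Z34.αℤ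
  D-a = Dℤ-element a Z34.αℤ (trans (cong (Z34.D ×F_) proj₁-a) D-α)

  D-a′ : ψᴸ Z34.Dℤ K.* a′ ≋ ψᴸ Z34.ᾱℤ
  D-a′ = Dℤ-element a′ Z34.ᾱℤ (trans (cong (Z34.D ×F_) proj₁-a′) D-conj-α)

  ψ-*≡ : ∀ v w v′ w′ → v Z34.* w ≡ v′ Z34.* w′ → ψᴸ v K.* ψᴸ w ≋ ψᴸ v′ K.* ψᴸ w′
  ψ-*≡ v w v′ w′ eq = ≈⇒≋ (trans (sym (φ.*-homo v w)) (trans (cong φ eq) (φ.*-homo v′ w′)))

  conjugate-inverseᴷ : ∀ (δ δ′ a a′ A A′ : Element) → δ K.* δ′ ≋ K.1# → δ K.* a ≋ A → δ K.* a′ ≋ A′ → A K.* A′ ≋ δ K.* δ →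
    a K.* a′ ≋ K.1#
  conjugate-inverseᴷ δ δ′ a a′ A A′ = ConjugateInverse.conjugate-inverse localised {δ} {δ′} {a} {a′} {A} {A′}

  a-a′ : a K.* a′ ≋ K.1#
  a-a′ = conjugate-inverseᴷ (ψᴸ Z34.Dℤ) (proj₁ D-inverse) a a′ (ψᴸ Z34.αℤ) (ψᴸ Z34.ᾱℤ)
    (proj₂ D-inverse) D-a D-a′ (ψ-*≡ Z34.αℤ Z34.ᾱℤ Z34.Dℤ Z34.Dℤ Z34.α-ᾱ)

  open Powers localised using () renaming (_^_ to _^ᴷ_)

  xᴷ : ℕ → Element
  xᴷ n = a ^ᴷ n K.+ a′ ^ᴷ n

  proj₁-xᴷ : ∀ n → proj₁ (xᴷ n) ≡ α ^ n + conj α ^ n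
  proj₁-xᴷ n = lemma a a′ α (conj α) proj₁-a proj₁-a′
    where
    lemma : ∀ (a a′ : Element) x y → proj₁ a ≡ x → proj₁ a′ ≡ y → proj₁ (a ^ᴷ n K.+ a′ ^ᴷ n) ≡ x ^ n + y ^ n
    lemma a a′ x y refl refl = cong₂ _+_ (L.^ᴸ-proj₁ a n) (L.^ᴸ-proj₁ a′ n)

  O-integral : ∀ {c} → Z34.Root c → ∀ {x} → Integral x → Integral (O c x)
  O-integral {c} root {x} (d , d⊥p , v , eq) = d , d⊥p , σℤ c v ,
    trans (sym (×F-homo (O-hom root) d x)) (trans (cong (O c) eq) (O-φ c v))

  Oᴷ : ∀ {c} → Z34.Root c → Element → Element
  Oᴷ {c} root (x , ix) = O c x , O-integral root ix

  -- Automorphisms preserve ℤ[ζ] and hence integrality of the quotient, so one congruence for the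
  -- first conjugate yields those for all eight.
  Oᴷ-cong : ∀ {c} (root : Z34.Root c) {x y} → x ≋ y → Oᴷ root x ≋ Oᴷ root y
  Oᴷ-cong {c} root {x , _} {y , _} (difference t it eq) = difference (O c t) (O-integral root it)
    (trans (cong (O c) eq) (trans (H.+-homo y (p ×F t)) (cong (λ s → O c y + s) (×F-homo (O-hom root) p t))))
    where module H = IsRingHomomorphism (O-hom root)

  conjugatesᴷ : All Z34.Root (3 ∷ 5 ∷ 7 ∷ 9 ∷ 11 ∷ 13 ∷ 15 ∷ 33 ∷ []) → Element → List Element
  conjugatesᴷ (r₃ ∷ r₅ ∷ r₇ ∷ r₉ ∷ r₁₁ ∷ r₁₃ ∷ r₁₅ ∷ r₃₃ ∷ []) x =
    Oᴷ r₃ x ∷ Oᴷ r₅ x ∷ Oᴷ r₇ x ∷ Oᴷ r₉ x ∷ Oᴷ r₁₁ x ∷ Oᴷ r₁₃ x ∷ Oᴷ r₁₅ x ∷ []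

  length-conjugatesᴷ : ∀ rs x → List.length (conjugatesᴷ rs x) ≡ 7
  length-conjugatesᴷ (r₃ ∷ r₅ ∷ r₇ ∷ r₉ ∷ r₁₁ ∷ r₁₃ ∷ r₁₅ ∷ r₃₃ ∷ []) x = refl

  orbitᴷ : All Z34.Root (3 ∷ 5 ∷ 7 ∷ 9 ∷ 11 ∷ 13 ∷ 15 ∷ 33 ∷ []) → Element → List Element
  orbitᴷ rs x = x ∷ conjugatesᴷ rs x

  map-proj₁-orbitᴷ : ∀ rs x → List.map proj₁ (orbitᴷ rs x) ≡ orbit (proj₁ x)
  map-proj₁-orbitᴷ (r₃ ∷ r₅ ∷ r₇ ∷ r₉ ∷ r₁₁ ∷ r₁₃ ∷ r₁₅ ∷ r₃₃ ∷ []) (x , _) =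
    trans (cong (λ t → t ∷ O 3 x ∷ O 5 x ∷ O 7 x ∷ O 9 x ∷ O 11 x ∷ O 13 x ∷ O 15 x ∷ []) (sym (O-1 x))) (sym (orbit≡O x))

  orbitᴷ-cong : ∀ rs {x y} → x ≋ y → Pointwiseᴸ _≋_ (orbitᴷ rs x) (orbitᴷ rs y)
  orbitᴷ-cong (r₃ ∷ r₅ ∷ r₇ ∷ r₉ ∷ r₁₁ ∷ r₁₃ ∷ r₁₅ ∷ r₃₃ ∷ []) p =
    p ∷ Oᴷ-cong r₃ p ∷ Oᴷ-cong r₅ p ∷ Oᴷ-cong r₇ p ∷ Oᴷ-cong r₉ p ∷ Oᴷ-cong r₁₁ p ∷ Oᴷ-cong r₁₃ p ∷ Oᴷ-cong r₁₅ p ∷ []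

  open ElementarySymmetric localised using (E)

  proj₁-E : ∀ j xs → proj₁ (E j xs) ≡ esym j (List.map proj₁ xs)
  proj₁-E zero xs = sym (esym-0 (List.map proj₁ xs))
  proj₁-E (suc j) [] = refl
  proj₁-E (suc j) (x ∷ xs) = trans (cong₂ (λ s t → proj₁ x * s + t) (proj₁-E j xs) (proj₁-E (suc j) xs))
    (sym (esym-∷ j (proj₁ x) (List.map proj₁ xs)))

  Sᴷ : ℕ → ℕ → Element
  Sᴷ k j = E j (orbitᴷ Z34.roots (xᴷ (34 ℕ.^ k)))

  proj₁-Sᴷ : ∀ k j → proj₁ (Sᴷ k j) ≡ S k j
  proj₁-Sᴷ k j = trans (proj₁-E j (orbitᴷ Z34.roots (xᴷ (34 ℕ.^ k))))
    (cong (esym j) (trans (map-proj₁-orbitᴷ Z34.roots (xᴷ (34 ℕ.^ k))) (cong orbit (proj₁-xᴷ (34 ℕ.^ k)))))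

  -- With m = p e, the quotient modulo p is e t, and a denominator prime to m is prime to its
  -- divisor p.
  mod′⇒≋ : ∀ {m} (x : Element) c → p ∣ m → proj₁ x ≡ c [mod′ m ] → x ≋ ψᴸ (ℤζ.constant c)
  mod′⇒≋ {m} (x , _) c (divides e eq) (t , t⊥m , x≡) = difference (e ×F ι t) integral (begin
    x
      ≡⟨ add-back x (ι (fromℤ c)) ⟩
    ι (fromℤ c) + (x - ι (fromℤ c))
      ≡⟨ cong (λ s → ι (fromℤ c) + s) (begin
           x - ι (fromℤ c)          ≡⟨ x≡ ⟩
           ι (fromℤ (+ m) ℚ.* t)    ≡⟨ ×F-ι m t ⟨
           m ×F ι t                 ≡⟨ cong (_×F ι t) (trans eq (ℕₚ.*-comm e p)) ⟩
           (p ℕ.* e) ×F ι t         ≡⟨ MonoidMult.×-assocˡ F.+-monoid (ι t) p e ⟨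
           p ×F (e ×F ι t)          ∎) ⟩
    ι (fromℤ c) + p ×F (e ×F ι t) ∎)
    where
    open ≡-Reasoning
    add-back : ∀ x y → x ≡ y + (x - y)
    add-back x y = sym (trans (cong (λ s → y + s) (F.+-comm x (neg y))) (trans (sym (F.+-assoc y (neg y) x))
      (trans (cong (λ s → s + x) (F.-‿inverseʳ y)) (F.+-identityˡ x))))
    integral-ι : Integral (ι t)
    integral-ι = ℚ.denominatorℕ t , (λ (k∣d , k∣p) → t⊥m (k∣d , ∣.∣-trans k∣p (divides e eq))) ,
      ℤζ.constant (ℚ.numerator t) , trans (×F-ι (ℚ.denominatorℕ t) t) (cong ι (denominator-* t))
    integral-×F : ∀ n {x} → Integral x → Integral (n ×F x)
    integral-×F zero ix = L.integral-0
    integral-×F (suc n) ix = L.integral-+ ix (integral-×F n ix)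
    integral : Integral (e ×F ι t)
    integral = integral-×F e integral-ι

  -- A priori the quotient t lies only in ℚ(ζ). But p t is rational, hence so is t, and its reduced
  -- denominator divides the d that witnesses integrality.
  ≋⇒mod′ : ∀ (x : Element) c → Rational (proj₁ x) → x ≋ ψᴸ (ℤζ.constant c) → proj₁ x ≡ c [mod′ p ]
  ≋⇒mod′ (x , _) c (q , refl) (difference t it eq) = lemma (rational-÷ p t (q ℚ.- fromℤ c , p×t)) it
    where
    open ≡-Reasoning
    p×t : p ×F t ≡ ι (q ℚ.- fromℤ c)
    p×t = begin
      p ×F t                                      ≡⟨ F.+-identityʳ (p ×F t) ⟨
      p ×F t + 0#                                 ≡⟨ cong (λ s → p ×F t + s) (F.-‿inverseʳ (ι (fromℤ c))) ⟨
      p ×F t + (ι (fromℤ c) - ι (fromℤ c))        ≡⟨ F.+-assoc (p ×F t) (ι (fromℤ c)) (neg (ι (fromℤ c))) ⟨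
      (p ×F t + ι (fromℤ c)) - ι (fromℤ c)        ≡⟨ cong (λ s → s - ι (fromℤ c)) (trans (F.+-comm (p ×F t) (ι (fromℤ c))) (sym eq)) ⟩
      ι q - ι (fromℤ c)                           ≡⟨ ι-minus q (fromℤ c) ⟨
      ι (q ℚ.- fromℤ c)                           ∎
      where
      ι-minus : ∀ a b → ι (a ℚ.- b) ≡ ι a - ι b
      ι-minus a b = trans (IsRingHomomorphism.+-homo ι-hom a (ℚ.- b)) (cong (λ s → ι a + s) (IsRingHomomorphism.-‿homo ι-hom b))
    lemma : Rational t → Integral t → ι q ≡ c [mod′ p ]
    lemma (s , refl) (d , d⊥p , v , ds) = s ,
      (λ (k∣den , k∣p) → d⊥p (∣.∣-trans k∣den (denominator-∣ s d (Vec.head v)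
        (trans (sym (head-×F d (ι s))) (trans (cong Vec.head ds) (head-φ v)))) , k∣p)) ,
      trans (sym ×F-p) (×F-ι p s)
      where
      ×F-p : p ×F ι s ≡ ι q - ι (fromℤ c)
      ×F-p = trans p×t (trans (IsRingHomomorphism.+-homo ι-hom q (ℚ.- fromℤ c)) (cong (λ s → ι q + s) (IsRingHomomorphism.-‿homo ι-hom (fromℤ c))))

module PrimeResidues (p : ℕ) (p-prime : Prime p) (103⊥p : Coprime 103 p) where
  open ModPrime p p-prime 103⊥p
  open L using (Element; _≋_; difference; ≈⇒≋; localised; ψᴸ; ψᴸ-hom)
  open ElementarySymmetric localised using (E; E-cong; E-ψ)
  open Powers localised using () renaming (_^_ to _^ᴷ_)
  module R = Residues localised ψᴸ-hom

  -- If 1 = p t with d t in ℤ[ζ], comparing constant coefficients shows that p divides d, contrary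
  -- to d being prime to p.
  1≉0 : ¬ (K.1# ≋ K.0#)
  1≉0 (difference t (d , d⊥p , v , dt) eq) =
    ¬prime[1] (subst Prime (d⊥p (p∣d , ∣.∣-refl)) p-prime)
    where
    open ≡-Reasoning
    s = Vec.head t
    ps : fromℤ (+ p) ℚ.* s ≡ 1ℚ
    ps = trans (sym (head-×F p t)) (trans (sym (cong Vec.head (F.+-identityˡ (p ×F t)))) (sym (cong Vec.head eq)))
    ds : fromℤ (+ d) ℚ.* s ≡ fromℤ (Vec.head v)
    ds = trans (sym (head-×F d t)) (trans (cong Vec.head dt) (head-φ v))
    d≡ : + d ≡ + p ℤ.* Vec.head v
    d≡ = fromℤ-injective (begin
      fromℤ (+ d)                                ≡⟨ ℚₚ.*-identityʳ (fromℤ (+ d)) ⟨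
      fromℤ (+ d) ℚ.* 1ℚ                         ≡⟨ cong (fromℤ (+ d) ℚ.*_) ps ⟨
      fromℤ (+ d) ℚ.* (fromℤ (+ p) ℚ.* s)        ≡⟨ trans (sym (ℚₚ.*-assoc (fromℤ (+ d)) (fromℤ (+ p)) s)) (trans (cong (ℚ._* s) (ℚₚ.*-comm (fromℤ (+ d)) (fromℤ (+ p)))) (ℚₚ.*-assoc (fromℤ (+ p)) (fromℤ (+ d)) s)) ⟩
      fromℤ (+ p) ℚ.* (fromℤ (+ d) ℚ.* s)        ≡⟨ cong (fromℤ (+ p) ℚ.*_) ds ⟩
      fromℤ (+ p) ℚ.* fromℤ (Vec.head v)         ≡⟨ fromℤ-* (+ p) (Vec.head v) ⟨
      fromℤ (+ p ℤ.* Vec.head v)                 ∎)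
    p∣d : p ∣ d
    p∣d = divides ℤ.∣ Vec.head v ∣ (trans (cong ℤ.∣_∣ d≡) (trans (ℤₚ.abs-* (+ p) (Vec.head v)) (ℕₚ.*-comm p ℤ.∣ Vec.head v ∣)))

  Relations : ℕ → List ℤ → Set
  Relations k values = ∀ j → j ℕ.< 8 → Sᴷ k (suc j) ≋ ψᴸ (ℤζ.constant (nthℤ values j))

  order-divisibleᴷ : Coprime 17 p → (p ℕ.^ 16) % 34 ≡ 1 % 34 → ∀ {N} → p ℕ.^ 16 ≡ suc N →
    ∀ v w (v′ b b′ : Element) → ψᴸ v K.* v′ ≋ K.1# → ψᴸ v K.* b ≋ ψᴸ w → b K.* b′ ≋ K.1# →
    ∀ k ys → List.length ys ≡ 7 →
    (∀ j → j ℕ.< 8 → E (suc j) ((b ^ᴷ (34 ℕ.^ k) K.+ b′ ^ᴷ (34 ℕ.^ k)) ∷ ys) ≋ ψᴸ (ℤζ.constant (nthℤ values⁺ j))) ⊎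
    (∀ j → j ℕ.< 8 → E (suc j) ((b ^ᴷ (34 ℕ.^ k) K.+ b′ ^ᴷ (34 ℕ.^ k)) ∷ ys) ≋ ψᴸ (ℤζ.constant (nthℤ values⁻ j))) →
    17 ℕ.^ suc k ∣ N
  order-divisibleᴷ 17⊥p p^16 {N} p^16≡1+N v w v′ b b′ =
    R.order-divisible p-prime L.characteristic 1≉0 17⊥p p^16 {N} p^16≡1+N v w {v′} {b} {b′}

  order-divisible : Coprime 17 p → (p ℕ.^ 16) % 34 ≡ 1 % 34 → ∀ {N} → p ℕ.^ 16 ≡ suc N →
    ∀ k → Relations k values⁺ ⊎ Relations k values⁻ → 17 ℕ.^ suc k ∣ N
  order-divisible 17⊥p p^16 {N} p^16≡1+N k =
    order-divisibleᴷ 17⊥p p^16 {N} p^16≡1+N Z34.Dℤ Z34.αℤ (proj₁ D-inverse) a a′ (proj₂ D-inverse) D-a a-a′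
      k (conjugatesᴷ Z34.roots (xᴷ (34 ℕ.^ k))) (length-conjugatesᴷ Z34.roots (xᴷ (34 ℕ.^ k)))

  O-zeta : ∀ {c} → Z34.Root c → ∀ n → O c (φ (zeta n)) ≡ φ (zeta ((c ℕ.* n) % 34))
  O-zeta {c} root n = trans (cong (O c) (φ-zeta n)) (trans (O-ζ^ root n) (ζ^≡φ (c ℕ.* n)))
    where
    ζ^≡φ : ∀ n → ζ₃₄ ^ n ≡ φ (zeta (n % 34))
    ζ^≡φ n = trans (^-periodic ζ₃₄ 34 ζ₃₄^34 n (n % 34) (sym (m%n%n≡m%n n 34))) (sym (φ-zeta (n % 34)))

  Oᴷ-trace : ∀ {c} (root : Z34.Root c) m n →
    Oᴷ root (ψᴸ (zeta m ℤζ.⊕ zeta n)) ≋ ψᴸ (zeta ((c ℕ.* m) % 34) ℤζ.⊕ zeta ((c ℕ.* n) % 34))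
  Oᴷ-trace {c} root m n = ≈⇒≋ (begin
    O c (φ (zeta m ℤζ.⊕ zeta n))
      ≡⟨ trans (cong (O c) (φ.+-homo (zeta m) (zeta n))) (IsRingHomomorphism.+-homo (O-hom root) (φ (zeta m)) (φ (zeta n))) ⟩
    O c (φ (zeta m)) + O c (φ (zeta n))
      ≡⟨ cong₂ _+_ (O-zeta root m) (O-zeta root n) ⟩
    φ (zeta ((c ℕ.* m) % 34)) + φ (zeta ((c ℕ.* n) % 34))
      ≡⟨ φ.+-homo (zeta ((c ℕ.* m) % 34)) (zeta ((c ℕ.* n) % 34)) ⟨
    φ (zeta ((c ℕ.* m) % 34) ℤζ.⊕ zeta ((c ℕ.* n) % 34)) ∎)
    where open ≡-Reasoning

  trace-1 : ∀ m n → ψᴸ (zeta m ℤζ.⊕ zeta n) ≋ ψᴸ (zeta ((1 ℕ.* m) % 34) ℤζ.⊕ zeta ((1 ℕ.* n) % 34))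
  trace-1 m n = ≈⇒≋ (trans (φ.+-homo (zeta m) (zeta n)) (trans (cong₂ _+_ (lemma m) (lemma n))
    (sym (φ.+-homo (zeta ((1 ℕ.* m) % 34)) (zeta ((1 ℕ.* n) % 34))))))
    where
    lemma : ∀ n → φ (zeta n) ≡ φ (zeta ((1 ℕ.* n) % 34))
    lemma n = trans (φ-zeta n) (trans (^-periodic ζ₃₄ 34 ζ₃₄^34 n ((1 ℕ.* n) % 34)
      (trans (cong (_% 34) (sym (ℕₚ.*-identityˡ n))) (sym (m%n%n≡m%n (1 ℕ.* n) 34)))) (sym (φ-zeta ((1 ℕ.* n) % 34))))

  orbitᴷ-trace : ∀ rs m → Pointwiseᴸ _≋_ (orbitᴷ rs (ψᴸ (zeta m ℤζ.⊕ zeta (33 ℕ.* m)))) (List.map ψᴸ (Z34.conjugates m))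
  orbitᴷ-trace (r₃ ∷ r₅ ∷ r₇ ∷ r₉ ∷ r₁₁ ∷ r₁₃ ∷ r₁₅ ∷ r₃₃ ∷ []) m =
    trace-1 m n ∷ Oᴷ-trace r₃ m n ∷ Oᴷ-trace r₅ m n ∷ Oᴷ-trace r₇ m n ∷ Oᴷ-trace r₉ m n
      ∷ Oᴷ-trace r₁₁ m n ∷ Oᴷ-trace r₁₃ m n ∷ Oᴷ-trace r₁₅ m n ∷ []
    where n = 33 ℕ.* m

  symmetric-valuesᴷ : ∀ xs ys vs cs → Pointwiseᴸ _≋_ xs ys → Pointwiseᴸ _≋_ ys (List.map ψᴸ vs) →
    Z34.esyms vs ≡ List.map ℤζ.constant cs → ∀ j → E (suc j) xs ≋ ψᴸ (ℤζ.constant (nthℤ cs j))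
  symmetric-valuesᴷ xs ys = R.symmetric-values {xs} {ys}

  orbit-values : ∀ m cs → Z34.esyms (Z34.conjugates m) ≡ List.map ℤζ.constant cs →
    ∀ (x : Element) → x ≋ ψᴸ (zeta m ℤζ.⊕ zeta (33 ℕ.* m)) →
    ∀ j → E (suc j) (orbitᴷ Z34.roots x) ≋ ψᴸ (ℤζ.constant (nthℤ cs j))
  orbit-values m cs eq x x≋ = symmetric-valuesᴷ (orbitᴷ Z34.roots x)
    (orbitᴷ Z34.roots (ψᴸ (zeta m ℤζ.⊕ zeta (33 ℕ.* m)))) (Z34.conjugates m) cs
    (orbitᴷ-cong Z34.roots x≋) (orbitᴷ-trace Z34.roots m) eq

  conjugate-sumᴷ : ∀ m → p % 103 ≡ (86 ℕ.^ m) % 103 → ∀ k → p ≡ suc (34 ℕ.* (34 ℕ.* k)) → ∀ w → w ≡ ℤζ.constant (+ 103) →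
    ∀ (b b′ δ′ u′ : Element) → ψᴸ Z34.Dℤ K.* δ′ ≋ K.1# → ψᴸ w K.* u′ ≋ K.1# → ψᴸ Z34.Dℤ K.* b ≋ ψᴸ Z34.αℤ → b K.* b′ ≋ K.1# →
    b ^ᴷ (34 ℕ.* k) K.+ b′ ^ᴷ (34 ℕ.* k) ≋ ψᴸ (zeta m ℤζ.⊕ zeta (33 ℕ.* m))
  conjugate-sumᴷ m p≡86^m k p≡ w w≡ b b′ δ′ u′ =
    R.conjugate-sum p-prime L.characteristic m p≡86^m k p≡ {w} w≡ {b} {b′} {δ′} {u′}

  xᴷ-value : ∀ m → p % 103 ≡ (86 ℕ.^ m) % 103 → ∀ k → p ≡ suc (34 ℕ.* (34 ℕ.* k)) →
    xᴷ (34 ℕ.* k) ≋ ψᴸ (zeta m ℤζ.⊕ zeta (33 ℕ.* m))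
  xᴷ-value m p≡86^m k p≡ = conjugate-sumᴷ m p≡86^m k p≡ 103ℤ 103ℤ-def a a′ (proj₁ D-inverse) (proj₁ 103-inverse)
    (proj₂ D-inverse) (proj₂ 103-inverse) D-a a-a′

  xᴷ-value-at : ∀ n k m → n ≡ 34 ℕ.* k → p ≡ suc (34 ℕ.* n) → p % 103 ≡ (86 ℕ.^ m) % 103 →
    xᴷ n ≋ ψᴸ (zeta m ℤζ.⊕ zeta (33 ℕ.* m))
  xᴷ-value-at n k m refl p≡ p≡86^m = xᴷ-value m p≡86^m k p≡

  34^suc : ∀ k → 34 ℕ.^ suc k ≡ 34 ℕ.* 34 ℕ.^ k
  34^suc k = refl

  S-valueᴷ : ∀ k j c → Sᴷ k j ≋ ψᴸ (ℤζ.constant c) → S k j ≡ c [mod′ p ]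
  S-valueᴷ k j c eq = subst (λ s → s ≡ c [mod′ p ]) (proj₁-Sᴷ k j)
    (≋⇒mod′ (Sᴷ k j) c (subst Rational (sym (proj₁-Sᴷ k j)) (S-rational k j)) eq)

  S-values : ∀ m → p % 103 ≡ (86 ℕ.^ m) % 103 → ∀ k → p ≡ suc (34 ℕ.* 34 ℕ.^ suc k) →
    ∀ cs → Z34.esyms (Z34.conjugates m) ≡ List.map ℤζ.constant cs →
    ∀ j → S (suc k) (suc j) ≡ nthℤ cs j [mod′ p ]
  S-values m p≡86^m k p≡ cs eq j = S-valueᴷ (suc k) (suc j) (nthℤ cs j)
    (orbit-values m cs eq (xᴷ (34 ℕ.^ suc k)) (xᴷ-value-at (34 ℕ.^ suc k) (34 ℕ.^ k) m (34^suc k) p≡ p≡86^m) j)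

  relations : ∀ {m} k cs → p ∣ m → (∀ j → j ℕ.< 8 → S k (suc j) ≡ nthℤ cs j [mod′ m ]) → Relations k cs
  relations {m} k cs p∣m S≡ j j<8 = mod′⇒≋ (Sᴷ k (suc j)) (nthℤ cs j) p∣m
    (subst (λ s → s ≡ nthℤ cs j [mod′ m ]) (sym (proj₁-Sᴷ k (suc j))) (S≡ j j<8))

-- Residues of M modulo 103, and prime divisors of M.

^-%-cong : ∀ n .{{_ : NonZero n}} {a b} k → a % n ≡ b % n → (a ^ᴺ k) % n ≡ (b ^ᴺ k) % n
^-%-cong n zero eq = refl
^-%-cong n {a} {b} (suc k) eq = trans (*-≡% n a (^-%-cong n k eq))
  (trans (cong (_% n) (ℕₚ.*-comm a (b ^ᴺ k))) (trans (*-≡% n (b ^ᴺ k) eq) (cong (_% n) (ℕₚ.*-comm (b ^ᴺ k) b))))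

-- The cycle of 34² under repeated squaring modulo 103, which returns to 34 after eight steps.
-- Adding 1 gives the eight residues in the statement, so every M with n ≥ 1 lies in one of these
-- classes.
squares : List ℕ
squares = 23 ∷ 14 ∷ 93 ∷ 100 ∷ 9 ∷ 81 ∷ 72 ∷ 34 ∷ []

squares-closed : All (λ t → Any ((t ℕ.* t) % 103 ≡_) squares) squares
squares-closed = from-yes (All.all? (λ t → any? ((t ℕ.* t) % 103 ℕₚ.≟_) squares) squares)

34^2^n% : ∀ n → Any ((34 ^ᴺ (2 ^ᴺ suc n)) % 103 ≡_) squares
34^2^n% zero = here refl
34^2^n% (suc n) = step squares-closed (34^2^n% n)
  where
  X = 34 ^ᴺ (2 ^ᴺ suc n)
  square : ∀ {t} → X % 103 ≡ t → (34 ^ᴺ (2 ^ᴺ suc (suc n))) % 103 ≡ (t ℕ.* t) % 103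
  square {t} eq = trans (cong (_% 103) (trans (cong (34 ^ᴺ_) (cong (2 ^ᴺ suc n ℕ.+_) (ℕₚ.+-identityʳ (2 ^ᴺ suc n))))
    (ℕₚ.^-distribˡ-+-* 34 (2 ^ᴺ suc n) (2 ^ᴺ suc n)))) (trans (%-distribˡ-* X X 103) (cong (λ t → (t ℕ.* t) % 103) eq))
  step : ∀ {ts} → All (λ t → Any ((t ℕ.* t) % 103 ≡_) squares) ts → Any (X % 103 ≡_) ts →
    Any ((34 ^ᴺ (2 ^ᴺ suc (suc n))) % 103 ≡_) squares
  step (closed ∷ _) (here eq) = Any.map (trans (square eq)) closed
  step (_ ∷ closed) (there any) = step closed any

≡-mod : ∀ {m a} n .{{_ : NonZero n}} → m % n ≡ a %ℕ n → + m ≡ a [mod n ]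
≡-mod {m} {a} n eq = divides ℤ.∣ q ℤ.- q′ ∣ (trans (cong ℤ.∣_∣ lemma) (ℤₚ.abs-* (q ℤ.- q′) (+ n)))
  where
  q = (+ m) /ℕ n
  q′ = a /ℕ n
  s = + (a %ℕ n)
  m≡ : + m ≡ s ℤ.+ q ℤ.* + n
  m≡ = trans (ℤDivMod.a≡a%ℕn+[a/ℕn]*n (+ m) n) (cong (λ t → + t ℤ.+ q ℤ.* + n) eq)
  lemma : + m ℤ.- a ≡ (q ℤ.- q′) ℤ.* + n
  lemma = trans (cong₂ ℤ._-_ m≡ (ℤDivMod.a≡a%ℕn+[a/ℕn]*n a n))
    (solve 4 (λ s q q′ n → (s :+ q :* n) :- (s :+ q′ :* n) := (q :- q′) :* n) refl s q q′ (+ n))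
    where open ℤ-Solver

Conditions⁺ Conditions⁻ : ℕ → ℕ → Set
Conditions⁺ k m = S k 1 ≡ - + 1 [mod′ m ] × S k 2 ≡ - + 7 [mod′ m ] × S k 3 ≡ + 6 [mod′ m ]
  × S k 4 ≡ + 15 [mod′ m ] × S k 5 ≡ - + 10 [mod′ m ] × S k 6 ≡ - + 10 [mod′ m ]
  × S k 7 ≡ + 4 [mod′ m ] × S k 8 ≡ + 1 [mod′ m ]
Conditions⁻ k m = S k 1 ≡ + 1 [mod′ m ] × S k 2 ≡ - + 7 [mod′ m ] × S k 3 ≡ - + 6 [mod′ m ]
  × S k 4 ≡ + 15 [mod′ m ] × S k 5 ≡ + 10 [mod′ m ] × S k 6 ≡ - + 10 [mod′ m ]
  × S k 7 ≡ - + 4 [mod′ m ] × S k 8 ≡ + 1 [mod′ m ]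

S-cast : ∀ k m j j′ c c′ → j ≡ j′ → c ≡ c′ → S k j ≡ c [mod′ m ] → S k j′ ≡ c′ [mod′ m ]
S-cast k m j j′ c c′ refl refl p = p

module _ {k m : ℕ} where
  private
    Family : List ℤ → Set
    Family cs = ∀ j → j < 8 → S k (suc j) ≡ nthℤ cs j [mod′ m ]

    at : ∀ cs → (∀ j → S k (suc j) ≡ nthℤ cs j [mod′ m ]) → ∀ j j′ c → suc j ≡ j′ → nthℤ cs j ≡ c → S k j′ ≡ c [mod′ m ]
    at cs f j j′ c p q = S-cast k m (suc j) j′ (nthℤ cs j) c p q (f j)

  conditions⁺ : (∀ j → S k (suc j) ≡ nthℤ values⁺ j [mod′ m ]) → Conditions⁺ k m
  conditions⁺ f = g 0 1 (- + 1) refl refl , g 1 2 (- + 7) refl refl , g 2 3 (+ 6) refl refl , g 3 4 (+ 15) refl refl ,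
    g 4 5 (- + 10) refl refl , g 5 6 (- + 10) refl refl , g 6 7 (+ 4) refl refl , g 7 8 (+ 1) refl refl
    where g = at values⁺ f

  conditions⁻ : (∀ j → S k (suc j) ≡ nthℤ values⁻ j [mod′ m ]) → Conditions⁻ k m
  conditions⁻ f = g 0 1 (+ 1) refl refl , g 1 2 (- + 7) refl refl , g 2 3 (- + 6) refl refl , g 3 4 (+ 15) refl refl ,
    g 4 5 (+ 10) refl refl , g 5 6 (- + 10) refl refl , g 6 7 (- + 4) refl refl , g 7 8 (+ 1) refl refl
    where g = at values⁻ f

  private
    family : ∀ cs c₁ c₂ c₃ c₄ c₅ c₆ c₇ c₈ → c₁ ∷ c₂ ∷ c₃ ∷ c₄ ∷ c₅ ∷ c₆ ∷ c₇ ∷ c₈ ∷ [] ≡ cs →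
      S k 1 ≡ c₁ [mod′ m ] → S k 2 ≡ c₂ [mod′ m ] → S k 3 ≡ c₃ [mod′ m ] → S k 4 ≡ c₄ [mod′ m ] →
      S k 5 ≡ c₅ [mod′ m ] → S k 6 ≡ c₆ [mod′ m ] → S k 7 ≡ c₇ [mod′ m ] → S k 8 ≡ c₈ [mod′ m ] → Family cs
    family _ c₁ c₂ c₃ c₄ c₅ c₆ c₇ c₈ refl s₁ s₂ s₃ s₄ s₅ s₆ s₇ s₈ = λ
      { 0 _ → S-cast k m 1 1 c₁ c₁ refl refl s₁
      ; 1 _ → S-cast k m 2 2 c₂ c₂ refl refl s₂
      ; 2 _ → S-cast k m 3 3 c₃ c₃ refl refl s₃
      ; 3 _ → S-cast k m 4 4 c₄ c₄ refl refl s₄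
      ; 4 _ → S-cast k m 5 5 c₅ c₅ refl refl s₅
      ; 5 _ → S-cast k m 6 6 c₆ c₆ refl refl s₆
      ; 6 _ → S-cast k m 7 7 c₇ c₇ refl refl s₇
      ; 7 _ → S-cast k m 8 8 c₈ c₈ refl refl s₈
      ; (suc (suc (suc (suc (suc (suc (suc (suc _)))))))) (s≤s (s≤s (s≤s (s≤s (s≤s (s≤s (s≤s (s≤s ()))))))))
      }

  family⁺ : Conditions⁺ k m → Family values⁺
  family⁺ (s₁ , s₂ , s₃ , s₄ , s₅ , s₆ , s₇ , s₈) = family values⁺ (- + 1) (- + 7) (+ 6) (+ 15) (- + 10) (- + 10) (+ 4) (+ 1) refl s₁ s₂ s₃ s₄ s₅ s₆ s₇ s₈

  family⁻ : Conditions⁻ k m → Family values⁻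
  family⁻ (s₁ , s₂ , s₃ , s₄ , s₅ , s₆ , s₇ , s₈) = family values⁻ (+ 1) (- + 7) (- + 6) (+ 15) (+ 10) (- + 10) (- + 4) (+ 1) refl s₁ s₂ s₃ s₄ s₅ s₆ s₇ s₈

34^R-odd : ∀ {q} R → Prime q → q ∣ 34 ^ᴺ suc R ℕ.+ 1 → ¬ (q ∣ 34)
34^R-odd {q} R q-prime q∣M q∣34 = ¬prime[1] (subst Prime (∣.∣1⇒≡1 (∣.∣m+n∣m⇒∣n q∣M (∣.∣m⇒∣m*n (34 ^ᴺ R) q∣34))) q-prime)

power-16 : ∀ {t} → t < 34 → (t ^ᴺ 16) % 34 ≡ 1 ⊎ (2 ∣ t ⊎ 17 ∣ t)
power-16 = from-yes (ℕₚ.allUpTo? (λ t → ((t ^ᴺ 16) % 34 ℕₚ.≟ 1) Dec.⊎-dec ((2 ∣? t) Dec.⊎-dec (17 ∣? t))) 34)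

-- Euler's theorem for 34, with φ(34) = 16; a factor 2 or 17 shared by q and 34 would be the prime q
-- itself.
prime-power-16 : ∀ {q} → Prime q → ¬ (q ∣ 34) → (q ^ᴺ 16) % 34 ≡ 1
prime-power-16 {q} q-prime q∤34 = conclude (power-16 (m%n<n q 34))
  where
  divisor : ∀ {d} → d ∣ 34 → d ≢ 1 → ¬ (d ∣ q % 34)
  divisor {d} d∣34 d≢1 d∣t = impossible (prime⇒irreducible q-prime
    (subst (d ∣_) (sym (m≡m%n+[m/n]*n q 34)) (∣.∣m∣n⇒∣m+n d∣t (∣.∣n⇒∣m*n (q / 34) d∣34))))
    where
    impossible : ¬ (d ≡ 1 ⊎ d ≡ q)
    impossible (inj₁ d≡1) = d≢1 d≡1
    impossible (inj₂ d≡q) = q∤34 (subst (_∣ 34) d≡q d∣34)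
  conclude : ((q % 34) ^ᴺ 16) % 34 ≡ 1 ⊎ (2 ∣ q % 34 ⊎ 17 ∣ q % 34) → (q ^ᴺ 16) % 34 ≡ 1
  conclude (inj₁ eq) = trans (^-%-cong 34 {q} {q % 34} 16 (sym (m%n%n≡m%n q 34))) eq
  conclude (inj₂ (inj₁ 2∣)) = ⊥-elim (divisor (divides 17 refl) (λ ()) 2∣)
  conclude (inj₂ (inj₂ 17∣)) = ⊥-elim (divisor (divides 2 refl) (λ ()) 17∣)

prime-103 : Prime 103
prime-103 = from-yes (prime? 103)

prime-divisor : ∀ {m} → 1 < m → ∃[ q ] Prime q × q ∣ m
prime-divisor {m@(suc _)} 1<m with factorise m
... | record { factors = [] ; isFactorisation = eq } = ⊥-elim (ℕₚ.<-irrefl (sym eq) 1<m)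
... | record { factors = q ∷ qs ; isFactorisation = eq ; factorsPrime = q-prime ∷ _ } =
  q , q-prime , divides (ListAction.product qs) (trans eq (ℕₚ.*-comm q (ListAction.product qs)))

small-prime-divisor : ∀ {m b} → Composite m → m < b ℕ.* b → ∃[ q ] Prime q × q ∣ m × q < b
small-prime-divisor {m} {b} (composite {d} d<m d∣m@(divides e m≡ed)) m<b² = split (d ℕₚ.<? b)
  where
  bounded : ∀ f → 1 < f → f ∣ m → f < b → ∃[ q ] Prime q × q ∣ m × q < b
  bounded f@(suc _) 1<f f∣m f<b with prime-divisor 1<f
  ... | q , q-prime , q∣f = q , q-prime , ∣.∣-trans q∣f f∣m , ℕₚ.≤-<-trans (∣.∣⇒≤ q∣f) f<b
  1<e : 1 < e
  1<e = ℕₚ.*-cancelʳ-< d 1 e (subst₂ _<_ (sym (ℕₚ.*-identityˡ d)) m≡ed d<m)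
  split : Dec (d < b) → ∃[ q ] Prime q × q ∣ m × q < b
  split (yes d<b) = bounded d (ℕ.nonTrivial⇒n>1 d) d∣m d<b
  split (no d≮b) = bounded e 1<e (divides d (trans m≡ed (ℕₚ.*-comm e d)))
    (ℕₚ.≰⇒> (λ b≤e → ℕₚ.<⇒≱ m<b² (subst (b ℕ.* b ≤_) (sym m≡ed) (ℕₚ.*-mono-≤ b≤e (ℕₚ.≮⇒≥ d≮b)))))

pos-^ : ∀ q k → (+ q) ^ᶻ k ≡ + (q ^ᴺ k)
pos-^ q zero = refl
pos-^ q (suc k) = trans (cong (+ q ℤ.*_) (pos-^ q k)) (sym (ℤₚ.pos-* q (q ^ᴺ k)))

prime∣103 : ∀ {q m} → Prime q → q ∣ m → ¬ (103 ∣ m) → ¬ (q ∣ 103)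
prime∣103 q-prime q∣m 103∤m q∣103 with prime⇒irreducible prime-103 q∣103
... | inj₁ refl = ¬prime[1] q-prime
... | inj₂ refl = 103∤m q∣m

abs-power : ∀ q N → q ^ᴺ 16 ≡ suc N → ℤ.∣ (+ q) ^ᶻ 16 ℤ.- 1ℤ ∣ ≡ N
abs-power q N eq = cong ℤ.∣_∣ (trans (cong (ℤ._- 1ℤ) (trans (pos-^ q 16) (cong +_ eq))) (minus-one N))
  where
  minus-one : ∀ N → + suc N ℤ.- 1ℤ ≡ + N
  minus-one N = refl

-- In the residue ring modulo q, the order of α divides q¹⁶ - 1 and is divisible by 17ᵏ⁺¹. This
-- makes q one of the residues that the hypothesis on divisors of M speaks of.
prime-power-congruence : ∀ k {m q} → Prime q → q ∣ m → ¬ (q ∣ 34) → ¬ (103 ∣ m) →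
  Conditions⁺ k m ⊎ Conditions⁻ k m → (+ q) ^ᶻ 16 ≡ 1ℤ [mod 17 ^ᴺ suc k ]
prime-power-congruence k {m} {q} q-prime q∣m q∤34 103∤m conditions =
  subst (17 ^ᴺ suc k ∣_) (sym (abs-power q (ℕ.pred (q ^ᴺ 16)) q^16))
    (order-divisible (prime∤⇒coprime q-prime (λ q∣17 → q∤34 (∣.∣n⇒∣m*n 2 q∣17))) (prime-power-16 q-prime q∤34)
      q^16 k (residues conditions))
  where
  q^16 : q ^ᴺ 16 ≡ suc (ℕ.pred (q ^ᴺ 16))
  q^16 = sym (ℕₚ.suc-pred (q ^ᴺ 16) {{ℕₚ.m^n≢0 q 16 {{prime⇒nonZero q-prime}}}})
  open PrimeResidues q q-prime (prime∤⇒coprime q-prime (prime∣103 q-prime q∣m 103∤m))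
  residues : Conditions⁺ k m ⊎ Conditions⁻ k m → Relations k values⁺ ⊎ Relations k values⁻
  residues (inj₁ c) = inj₁ (relations {m} k values⁺ q∣m (family⁺ {k} {m} c))
  residues (inj₂ c) = inj₂ (relations {m} k values⁻ q∣m (family⁻ {k} {m} c))

-- The two implications.

module _ (R : ℕ) where
  private
    m b : ℕ
    m = 34 ^ᴺ suc (suc R) ℕ.+ 1
    b = 17 ^ᴺ suc (suc R)

  prime-of-conditions : ¬ (103 ∣ m) →
    ((x : ℤ) → 1ℤ <ᶻ x → x <ᶻ + b → x ^ᶻ 16 ≡ 1ℤ [mod b ] → ¬ (x ∣ᶻ + m)) →
    Conditions⁺ (suc R) m ⊎ Conditions⁻ (suc R) m → Prime m
  prime-of-conditions 103∤m no-divisor conditions = decide (prime? m)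
    where
    refute : ¬ (∃[ q ] Prime q × q ∣ m × q < b)
    refute (q , q-prime , q∣m , q<b) = no-divisor (+ q) (ℤ.+<+ (ℕ.nonTrivial⇒n>1 q {{prime⇒nonTrivial q-prime}})) (ℤ.+<+ q<b)
      (prime-power-congruence (suc R) {m} {q} q-prime q∣m (34^R-odd (suc R) q-prime q∣m) 103∤m conditions) q∣m
    nonTrivial : NonTrivial m
    nonTrivial = ℕ.n>1⇒nonTrivial (ℕₚ.≤-trans (s≤s (ℕₚ.m^n>0 34 (suc (suc R)))) (ℕₚ.≤-reflexive (ℕₚ.+-comm 1 (34 ^ᴺ suc (suc R)))))
    decide : Dec (Prime m) → Prime m
    decide (yes m-prime) = m-prime
    decide (no ¬prime) = ⊥-elim (refute (small-prime-divisor (¬prime⇒composite {{nonTrivial}} ¬prime) (34^R<289^R (suc R))))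

  conditions-of-prime : ∀ (cs : List ℤ) c → Prime m → m % 103 ≡ (86 ^ᴺ c) % 103 →
    Z34.esyms (Z34.conjugates c) ≡ List.map Z34.ℤζ.constant cs →
    ∀ j → S (suc R) (suc j) ≡ nthℤ cs j [mod′ m ]
  conditions-of-prime cs c m-prime m≡86^c eq =
    PrimeResidues.S-values m m-prime (prime∤⇒coprime m-prime (∣.>⇒∤ 103<m)) c m≡86^c R m≡1+34 cs eq
    where
    103<m : 103 < m
    103<m = ℕₚ.≤-trans (from-yes (104 ℕₚ.≤? 34 ^ᴺ 2)) (ℕₚ.≤-trans (ℕₚ.^-monoʳ-≤ 34 {2} {suc (suc R)} (s≤s (s≤s z≤n))) (ℕₚ.m≤m+n (34 ^ᴺ suc (suc R)) 1))
    m≡1+34 : m ≡ suc (34 ℕ.* 34 ^ᴺ suc R)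
    m≡1+34 = ℕₚ.+-comm (34 ^ᴺ suc (suc R)) 1

residues⁺ residues⁻ : List ℤ
residues⁺ = - + 21 ∷ + 15 ∷ []
residues⁻ = + 35 ∷ + 24 ∷ - + 2 ∷ - + 9 ∷ + 10 ∷ - + 30 ∷ []

Statement⁺ Statement⁻ : ℕ → ℕ → Set
Statement⁺ k m = Any (λ a → + m ≡ a [mod 103 ]) residues⁺ × Conditions⁺ k m
Statement⁻ k m = Any (λ a → + m ≡ a [mod 103 ]) residues⁻ × Conditions⁻ k m

module _ (R : ℕ) (class : Any ((34 ^ᴺ suc (suc R)) % 103 ≡_) squares) where
  private
    X m : ℕ
    X = 34 ^ᴺ suc (suc R)
    m = X ℕ.+ 1

    m% : ∀ {t} → X % 103 ≡ t → m % 103 ≡ (t ℕ.+ 1) % 103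
    m% eq = trans (%-distribˡ-+ X 1 103) (cong (λ t → (t ℕ.+ 1) % 103) eq)

    residue : ∀ t a → X % 103 ≡ t → (t ℕ.+ 1) % 103 ≡ a %ℕ 103 → + m ≡ a [mod 103 ]
    residue t a eq p = ≡-mod {m} {a} 103 (trans (m% eq) p)

    103∤ : ∀ t → ¬ ((t ℕ.+ 1) % 103 ≡ 0) → X % 103 ≡ t → ¬ (103 ∣ m)
    103∤ t t≢ eq 103∣m = t≢ (trans (sym (m% eq)) (∣.n∣m⇒m%n≡0 m 103 103∣m))

  -- None of the eight classes is -1 modulo 103. Hence 103 is invertible modulo every prime divisor
  -- of M, as the reduction of α demands.
  103∤m : ¬ (103 ∣ m)
  103∤m = go class
    where
    go : Any (X % 103 ≡_) squares → ¬ (103 ∣ m)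
    go any with Any.lookup any | All.lookupAny (from-yes (All.all? (λ t → Dec.¬? ((t ℕ.+ 1) % 103 ℕₚ.≟ 0)) squares)) any
    ... | _ | t≢ , eq = 103∤ _ t≢ eq

  private
    conclude⁺ : ∀ t c → X % 103 ≡ t → (t ℕ.+ 1) % 103 ≡ (86 ^ᴺ c) % 103 →
      Z34.esyms (Z34.conjugates c) ≡ List.map Z34.ℤζ.constant values⁺ → Prime m → Conditions⁺ (suc R) m
    conclude⁺ t c eq p esyms m-prime = conditions⁺ {suc R} {m} (conditions-of-prime R values⁺ c m-prime (trans (m% eq) p) esyms)

    conclude⁻ : ∀ t c → X % 103 ≡ t → (t ℕ.+ 1) % 103 ≡ (86 ^ᴺ c) % 103 →
      Z34.esyms (Z34.conjugates c) ≡ List.map Z34.ℤζ.constant values⁻ → Prime m → Conditions⁻ (suc R) m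
    conclude⁻ t c eq p esyms m-prime = conditions⁻ {suc R} {m} (conditions-of-prime R values⁻ c m-prime (trans (m% eq) p) esyms)

  -- The class of 34ʳ modulo 103 fixes the logarithm c of M to base 86. Even c leads to conjugates
  -- of ζ₁₇ + ζ₁₇⁻¹ and condition (i), odd c to conjugates of ζ₃₄ + ζ₃₄⁻¹ and condition (ii); no c
  -- that occurs is divisible by 17.
  statement-of-prime : Prime m → Statement⁺ (suc R) m ⊎ Statement⁻ (suc R) m
  statement-of-prime m-prime = go class Z34.esyms-even Z34.esyms-odd
    where
    go : Any (X % 103 ≡_) squares →
      All (λ c → Z34.esyms (Z34.conjugates c) ≡ List.map Z34.ℤζ.constant values⁺) (64 ∷ 88 ∷ []) →
      All (λ c → Z34.esyms (Z34.conjugates c) ≡ List.map Z34.ℤζ.constant values⁻) (11 ∷ 9 ∷ 5 ∷ 39 ∷ 99 ∷ 93 ∷ []) →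
      Statement⁺ (suc R) m ⊎ Statement⁻ (suc R) m
    go (here eq) _ (_ ∷ e ∷ _) = inj₂ (there (here (residue 23 (+ 24) eq refl)) , conclude⁻ 23 9 eq refl e m-prime)
    go (there (here eq)) (_ ∷ e ∷ _) _ = inj₁ (there (here (residue 14 (+ 15) eq refl)) , conclude⁺ 14 88 eq refl e m-prime)
    go (there (there (here eq))) _ (_ ∷ _ ∷ _ ∷ e ∷ _) =
      inj₂ (there (there (there (here (residue 93 (- + 9) eq refl)))) , conclude⁻ 93 39 eq refl e m-prime)
    go (there (there (there (here eq)))) _ (_ ∷ _ ∷ e ∷ _) =
      inj₂ (there (there (here (residue 100 (- + 2) eq refl))) , conclude⁻ 100 5 eq refl e m-prime)
    go (there (there (there (there (here eq))))) _ (_ ∷ _ ∷ _ ∷ _ ∷ e ∷ _) =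
      inj₂ (there (there (there (there (here (residue 9 (+ 10) eq refl))))) , conclude⁻ 9 99 eq refl e m-prime)
    go (there (there (there (there (there (here eq)))))) (e ∷ _) _ =
      inj₁ (here (residue 81 (- + 21) eq refl) , conclude⁺ 81 64 eq refl e m-prime)
    go (there (there (there (there (there (there (here eq))))))) _ (_ ∷ _ ∷ _ ∷ _ ∷ _ ∷ e ∷ _) =
      inj₂ (there (there (there (there (there (here (residue 72 (- + 30) eq refl)))))) , conclude⁻ 72 93 eq refl e m-prime)
    go (there (there (there (there (there (there (there (here eq)))))))) _ (e ∷ _) =
      inj₂ (here (residue 34 (+ 35) eq refl) , conclude⁻ 34 11 eq refl e m-prime)

Criterion : ℕ → ℕ → Set
Criterion r m =
  ((x : ℤ) → 1ℤ <ᶻ x → x <ᶻ + (17 ^ᴺ r) → x ^ᶻ 16 ≡ 1ℤ [mod 17 ^ᴺ r ] → ¬ (x ∣ᶻ + m)) →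
  Prime m ⇔ (Statement⁺ (r ∸ 1) m ⊎ Statement⁻ (r ∸ 1) m)

criterion : ∀ R → Any ((34 ^ᴺ suc (suc R)) % 103 ≡_) squares → Criterion (suc (suc R)) (34 ^ᴺ suc (suc R) ℕ.+ 1)
criterion R class no-divisor = mk⇔ (statement-of-prime R class) backward
  where
  m = 34 ^ᴺ suc (suc R) ℕ.+ 1
  backward : Statement⁺ (suc R) m ⊎ Statement⁻ (suc R) m → Prime m
  backward (inj₁ (_ , c)) = prime-of-conditions R (103∤m R class) no-divisor (inj₁ c)
  backward (inj₂ (_ , c)) = prime-of-conditions R (103∤m R class) no-divisor (inj₂ c)

criterion-≡ : ∀ R r m → r ≡ suc (suc R) → m ≡ 34 ^ᴺ r ℕ.+ 1 → Any ((34 ^ᴺ r) % 103 ≡_) squares → Criterion r m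
criterion-≡ R _ _ refl refl class = criterion R class

2≤2^suc : ∀ n → 2 ≤ 2 ^ᴺ suc n
2≤2^suc n = ℕₚ.^-monoʳ-≤ 2 {1} {suc n} (s≤s z≤n)

criterion-2^ : ∀ n → n ≥ 1 → Criterion (r n) (M n)
-- r = 2ⁿ⁺¹ is at least 2 and is written as R + 2. The second factor 34 this gives in M - 1 = 34 ·
-- 34ʳ⁻¹ is the one that removes ζ²¹.
criterion-2^ (suc n) _ = criterion-≡ (2 ^ᴺ suc n ∸ 2) (r (suc n)) (M (suc n))
  (sym (ℕₚ.m+[n∸m]≡n (2≤2^suc n))) refl (34^2^n% n)

proposition4p6 : (n : ℕ) → n ≥ 1 →
    ((x : ℤ) → 1ℤ <ᶻ x → x <ᶻ + (17 ^ᴺ r n) → x ^ᶻ 16 ≡ 1ℤ [mod 17 ^ᴺ r n ] → ¬ (x ∣ᶻ + M n)) →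
    Prime (M n) ⇔
    ( ( Any (λ a → + M n ≡ a [mod 103 ]) (- + 21 ∷ + 15 ∷ [])
    × S (r n ∸ 1) 1 ≡ - + 1  [mod′ M n ]
    × S (r n ∸ 1) 2 ≡ - + 7  [mod′ M n ]
    × S (r n ∸ 1) 3 ≡ + 6    [mod′ M n ]
    × S (r n ∸ 1) 4 ≡ + 15   [mod′ M n ]
    × S (r n ∸ 1) 5 ≡ - + 10 [mod′ M n ]
    × S (r n ∸ 1) 6 ≡ - + 10 [mod′ M n ]
    × S (r n ∸ 1) 7 ≡ + 4    [mod′ M n ]
    × S (r n ∸ 1) 8 ≡ + 1    [mod′ M n ] )
    ⊎ ( Any (λ a → + M n ≡ a [mod 103 ]) (+ 35 ∷ + 24 ∷ - + 2 ∷ - + 9 ∷ + 10 ∷ - + 30 ∷ [])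
    × S (r n ∸ 1) 1 ≡ + 1    [mod′ M n ]
    × S (r n ∸ 1) 2 ≡ - + 7  [mod′ M n ]
    × S (r n ∸ 1) 3 ≡ - + 6  [mod′ M n ]
    × S (r n ∸ 1) 4 ≡ + 15   [mod′ M n ]
    × S (r n ∸ 1) 5 ≡ + 10   [mod′ M n ]
    × S (r n ∸ 1) 6 ≡ - + 10 [mod′ M n ]
    × S (r n ∸ 1) 7 ≡ - + 4  [mod′ M n ]
    × S (r n ∸ 1) 8 ≡ + 1    [mod′ M n ] ) )
proposition4p6 n n≥1 = criterion-2^ n n≥1
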